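{- Let $m\le n$, let $B\subseteq[m]\times[n]$ be a board, and let $0\le d\le m$. Then $M_d(B,x+1)$ and $H_d(B,x+1)$ are both polynomial modulo $x^6$ with integer coefficients. That is, there are polynomials $P,Q\in\mathbb Z[x]$ of degree at most $5$ such that for all prime powers $q$, $$M_d(B,q)\equiv P(q-1)\pmod{(q-1)^6}\quad\text{and}\quad H_d(B,q)\equiv Q(q-1)\pmod{(q-1)^6}.$$
   Context: Notation: $[n]=\{1,\dots,n\}$. A board is a subset $B\subseteq[m]\times[n]$. For a prime power $q>1$, $\mathfrak m_i(B,q)$ is the number of $m\times n$ matrices over $\mathbb F_q$ of rank $i$ whose support (set of positions of nonzero entries) is contained in $B$. The $q$-rook number is $M_i(B,q)=\mathfrak m_i(B,q)/(q-1)^i$ (known to be an integer). Put $[k]_q=1+q+\cdots+q^{k-1}$, $[k]!_q=[k]_q\cdots[1]_q$, $(t;q)_k=\prod_{j=0}^{k-1}(1-tq^j)$. For $m\le n$, the $q$-hit numbers $H_i(B,q)$ (integers) are defined by the identity of polynomials in $t$ $$\sum_{i=0}^{m}H_i(B,q)t^i=q^{\binom m2}\sum_{i=0}^{m}M_i(B,q)\frac{[n-i]!_q}{[n-m]!_q}(-1)^i(t;q^{ -1})_i .$$ -}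

module Defs where

open import Algebra.Apartness.Structures using (IsHeytingField)
open import Algebra.Bundles using (CommutativeRing)
import Algebra.Properties.Monoid.Sum as MonoidSum
open import Data.Fin.Base using (Fin; zero; suc; toℕ)
import Data.Fin.Properties as Fin
open import Data.Fin.Subset using (Subset; _∈_; _∉_; ∣_∣)
open import Data.Fin.Subset.Properties using (_∈?_; anySubset?)
open import Data.Integer.Base as ℤ using (ℤ; +_)
import Data.Integer.Properties as ℤ
open import Data.List.Base as List using (List; []; _∷_)
import Data.List.Membership.Propositional as List
open import Data.List.Membership.Propositional.Properties
  using (∈-cartesianProductWith⁺; ∈-tabulate⁺)
import Data.List.Relation.Unary.All as All
open import Data.List.Relation.Unary.Any using (here)
open import Data.Nat.Base as ℕ using (ℕ; zero; suc; _∸_; NonZero; NonTrivial)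
open import Data.Nat.Combinatorics using (_C_)
open import Data.Nat.Primality using (Prime)
import Data.Nat.Properties as ℕ
open import Data.Product.Base using (∃-syntax; _×_; _,_)
open import Data.Rational.Base as ℚ using (ℚ; 0ℚ; 1ℚ; _/_)
import Data.Rational.Properties as ℚ
open import Data.Vec.Base as Vec using (Vec; []; _∷_; lookup)
import Data.Vec.Functional as Vector
open import Function.Base using (_∘_; _$_)
open import Function.Bundles using (_↔_; Inverse)
open import Function.Properties.Inverse using (↔⇒↣)
open import Level using (0ℓ)
open import Relation.Binary.Definitions using (DecidableEquality)
open import Relation.Binary.PropositionalEquality
  using (_≡_; _≢_; refl; sym; trans; cong; subst; module ≡-Reasoning)
open import Relation.Nullary.Decidable
  using (Dec; map′; ¬?; _×-dec_; _→-dec_; decidable-stable; via-injection)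
open import Relation.Nullary.Negation using (contradiction)

open MonoidSum ℕ.+-0-monoid using () renaming (sum to sumℕ)
open MonoidSum ℤ.+-0-monoid using () renaming (sum to sumℤ)
open import Algebra.Definitions.RawSemiring ℚ.+-*-rawSemiring using (_^_)

IsPrimePower : ℕ → Set
IsPrimePower q = ∃[ p ] ∃[ k ] Prime p × q ≡ p ℕ.^ suc k

-- With apartness taken to be _≢_, a Heyting field is a commutative ring in
-- which an element is invertible exactly when it is nonzero (so 0 ≢ 1).
record FiniteField (q : ℕ) : Set₁ where
  infix  8 -_
  infixl 7 _*_
  infixl 6 _+_
  field
    Carrier        : Set
    _+_ _*_        : Carrier → Carrier → Carrier
    -_             : Carrier → Carrier
    0# 1#          : Carrier
    isHeytingField : IsHeytingField _≡_ _≢_ _+_ _*_ -_ 0# 1#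
    enumeration    : Carrier ↔ Fin q

  open IsHeytingField isHeytingField public
    using (isCommutativeRing; #⇒invertible; invertible⇒#)

  commutativeRing : CommutativeRing 0ℓ 0ℓ
  commutativeRing = record { isCommutativeRing = isCommutativeRing }

  open CommutativeRing commutativeRing public
    using (+-monoid; *-identityˡ; zeroˡ)
  open MonoidSum +-monoid public using (sum-syntax)

  open Inverse enumeration using (to; from; strictlyInverseʳ)

  infix 4 _≟_
  _≟_ : DecidableEquality Carrier
  _≟_ = via-injection (↔⇒↣ enumeration) Fin._≟_

  elements : List Carrier
  elements = List.tabulate from

  ∈-elements : ∀ x → x List.∈ elements
  ∈-elements x =
    subst (List._∈ elements) (strictlyInverseʳ x) (∈-tabulate⁺ (to x))

  0≢1 : 0# ≢ 1#
  0≢1 0≡1 = invertible⇒# {0#} {0#} (1# , x≡1 _ , x≡1 _) refl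
    where
    open ≡-Reasoning
    x≡1 : ∀ x → x ≡ 1#
    x≡1 x = begin
      x       ≡⟨ *-identityˡ x ⟨
      1# * x  ≡⟨ cong (_* x) 0≡1 ⟨
      0# * x  ≡⟨ zeroˡ x ⟩
      0#      ≡⟨ 0≡1 ⟩
      1#      ∎

  order-nonTrivial : NonTrivial q
  order-nonTrivial = nonTrivial q (to 0#) (to 1#) (0≢1 ∘ to-injective)
    where
    to-injective : to 0# ≡ to 1# → 0# ≡ 1#
    to-injective eq = trans (sym (strictlyInverseʳ 0#))
                        (trans (cong from eq) (strictlyInverseʳ 1#))
    nonTrivial : ∀ k (i j : Fin k) → i ≢ j → NonTrivial k
    nonTrivial (suc zero)    zero zero i≢j = contradiction refl i≢j
    nonTrivial (suc (suc k)) _    _    _   = _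

vectors : ∀ {A : Set} → List A → (n : ℕ) → List (Vec A n)
vectors xs zero    = [] ∷ []
vectors xs (suc n) = List.cartesianProductWith _∷_ xs (vectors xs n)

∈-vectors : ∀ {A : Set} {xs : List A} → (∀ x → x List.∈ xs) →
            ∀ {n} (v : Vec A n) → v List.∈ vectors xs n
∈-vectors ∈xs []      = here refl
∈-vectors ∈xs (x ∷ v) = ∈-cartesianProductWith⁺ _∷_ (∈xs x) (∈-vectors ∈xs v)

-- The square (i , j) belongs to the board B when j ∈ lookup B i.
Board : ℕ → ℕ → Set
Board m n = Vec (Subset n) m

module _ {q : ℕ} (F : FiniteField q) where
  open FiniteField F

  Matrix : ℕ → ℕ → Set
  Matrix m n = Vec (Vec Carrier n) m

  SupportedOn : ∀ {m n} → Board m n → Matrix m n → Set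
  SupportedOn B A = ∀ i j → lookup (lookup A i) j ≢ 0# → j ∈ lookup B i

  -- The columns of A with index in S are linearly independent.
  IndependentColumns : ∀ {m n} → Matrix m n → Subset n → Set
  IndependentColumns {m} {n} A S =
    ∀ (c : Vec Carrier n) → (∀ j → j ∉ S → lookup c j ≡ 0#) →
    (∀ i → ∑[ j < n ] (lookup c j * lookup (lookup A i) j) ≡ 0#) →
    ∀ j → lookup c j ≡ 0#

  -- The rank is the largest number of linearly independent columns.
  HasRank : ∀ {m n} → Matrix m n → ℕ → Set
  HasRank {m} {n} A r =
    (∃[ S ] IndependentColumns A S × ∣ S ∣ ≡ r) ×
    (∀ S → IndependentColumns A S → ∣ S ∣ ℕ.≤ r)

  supportedOn? : ∀ {m n} (B : Board m n) (A : Matrix m n) → Dec (SupportedOn B A)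
  supportedOn? B A = Fin.all? λ i → Fin.all? λ j →
    ¬? (lookup (lookup A i) j ≟ 0#) →-dec (j ∈? lookup B i)

  independentColumns? : ∀ {m n} (A : Matrix m n) (S : Subset n) →
                        Dec (IndependentColumns A S)
  independentColumns? {m} {n} A S =
    map′ (λ all c → All.lookup all (∈-vectors ∈-elements c))
         (λ indep → All.universal indep _)
         (All.all? (λ c →
           Fin.all? (λ j → ¬? (j ∈? S) →-dec (lookup c j ≟ 0#)) →-dec
           (Fin.all? (λ i → ∑[ j < n ] (lookup c j * lookup (lookup A i) j) ≟ 0#) →-dec
           Fin.all? (λ j → lookup c j ≟ 0#)))
         (vectors elements n))

  hasRank? : ∀ {m n} (A : Matrix m n) (r : ℕ) → Dec (HasRank A r)
  hasRank? A r =
    anySubset? (λ S → independentColumns? A S ×-dec (∣ S ∣ ℕ.≟ r)) ×-dec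
    map′ (λ none S indep → decidable-stable (∣ S ∣ ℕ.≤? r) λ ≰r → none (S , indep , ≰r))
         (λ bound (S , indep , ≰r) → ≰r (bound S indep))
         (¬? (anySubset? λ S → independentColumns? A S ×-dec ¬? (∣ S ∣ ℕ.≤? r)))

  matrixCount : ∀ {m n} → Board m n → ℕ → ℕ
  matrixCount {m} {n} B i = List.length $
    List.filter (λ A → hasRank? A i ×-dec supportedOn? B A)
                (vectors (vectors elements n) m)

qInteger : ℕ → ℕ → ℕ
qInteger q k = sumℕ λ (j : Fin k) → q ℕ.^ toℕ j

qFactorial : ℕ → ℕ → ℕ
qFactorial q zero    = 1
qFactorial q (suc k) = qInteger q (suc k) ℕ.* qFactorial q k

qFactorial-nonZero : ∀ q k → NonZero (qFactorial q k)
qFactorial-nonZero q zero    = _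
qFactorial-nonZero q (suc k) =
  ℕ.m*n≢0 (qInteger q (suc k)) (qFactorial q k) {{_}} {{qFactorial-nonZero q k}}

fromℤ : ℤ → ℚ
fromℤ z = z / 1

-- Polynomials in t over ℚ, as lists of coefficients starting with the
-- constant term; trailing zeros are allowed.
ℚ[t] : Set
ℚ[t] = List ℚ

infixl 6 _⊕_
infixl 7 _⊗_
infixr 7 _•_

_⊕_ : ℚ[t] → ℚ[t] → ℚ[t]
[]      ⊕ g       = g
f       ⊕ []      = f
(a ∷ f) ⊕ (b ∷ g) = (a ℚ.+ b) ∷ (f ⊕ g)

_•_ : ℚ → ℚ[t] → ℚ[t]
a • f = List.map (a ℚ.*_) f

_⊗_ : ℚ[t] → ℚ[t] → ℚ[t]
[]      ⊗ g = []
(a ∷ f) ⊗ g = (a • g) ⊕ (0ℚ ∷ (f ⊗ g))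

∑-poly : (k : ℕ) → (Fin k → ℚ[t]) → ℚ[t]
∑-poly k = Vector.foldr _⊕_ []

coefficient : ℚ[t] → ℕ → ℚ
coefficient []      k       = 0ℚ
coefficient (a ∷ f) zero    = a
coefficient (a ∷ f) (suc k) = coefficient f k

-- (t; a)ₖ = (1 - t) (1 - t a) ⋯ (1 - t aᵏ⁻¹)
pochhammer : ℚ → ℕ → ℚ[t]
pochhammer a zero    = 1ℚ ∷ []
pochhammer a (suc k) = pochhammer a k ⊗ (1ℚ ∷ ℚ.- (a ^ k) ∷ [])

module _ {q : ℕ} (F : FiniteField q) where
  private
    instance
      q-nonTrivial : NonTrivial q
      q-nonTrivial = FiniteField.order-nonTrivial F

      q-nonZero : NonZero q
      q-nonZero = ℕ.nonTrivial⇒nonZero q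

      q∸1-nonZero : NonZero (q ∸ 1)
      q∸1-nonZero = ℕ.>-nonZero (ℕ.m<n⇒0<n∸m (ℕ.nonTrivial⇒n>1 q))

  qRookNumber : ∀ {m n} → Board m n → ℕ → ℚ
  qRookNumber B i = (+ matrixCount F B i / (q ∸ 1) ℕ.^ i) {{ℕ.m^n≢0 (q ∸ 1) i}}

  -- The generating polynomial of the q-hit numbers; only meaningful for m ≤ n,
  -- when none of the subtractions n ∸ i is truncated.
  qHitPolynomial : ∀ {m n} → Board m n → ℚ[t]
  qHitPolynomial {m} {n} B =
    fromℤ (+ (q ℕ.^ (m C 2))) • ∑-poly (suc m) λ j →
      let i = toℕ j in
      (qRookNumber B i
        ℚ.* (+ qFactorial q (n ∸ i) / qFactorial q (n ∸ m)) {{qFactorial-nonZero q (n ∸ m)}}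
        ℚ.* (ℚ.- 1ℚ) ^ i)
      • pochhammer (+ 1 / q) i

  qHitNumber : ∀ {m n} → Board m n → ℕ → ℚ
  qHitNumber B i = coefficient (qHitPolynomial B) i

-- An integer polynomial of degree at most k, by its coefficients of x⁰, …, xᵏ.
ℤ[x]≤ : ℕ → Set
ℤ[x]≤ k = Vec ℤ (suc k)

eval : ∀ {k} → ℤ[x]≤ k → ℤ → ℤ
eval {k} P x = sumℤ λ (i : Fin (suc k)) → lookup P i ℤ.* x ℤ.^ toℕ i

-- Congruence of a rational number a with an integer b modulo N: the difference
-- must be an integer multiple of N, so in particular a must be an integer.
infix 4 _≡_[mod_]
_≡_[mod_] : ℚ → ℤ → ℤ → Set
a ≡ b [mod N ] = ∃[ k ] a ℚ.- fromℤ b ≡ fromℤ (k ℤ.* N)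

{-# OPTIONS --safe #-}
module Submission where

-- Put x = q - 1 and sort the matrices by their exact support S, a bipartite graph of
-- rows and columns. Rank is additive over the components of S, so it suffices that,
-- for S connected, the number of matrices of rank d and support S is xᵈ times an
-- integer that is congruent to a polynomial in x modulo x⁶.
--
-- If S has at least 7 columns and r rows, the torus of row and column scalings acts
-- freely modulo scalars and makes the number divisible by x^(r + 6), hence, as d ≤ r, by
-- x^(d + 6). If S has at most 6 columns, the number is exactly a polynomial: the k-th
-- moment of the size of the kernel counts pairs of a matrix A and a family of columns
-- v₁, …, vₙ in 𝔽ᵏ killed by A, and for fixed columns the rows of A can be chosen
-- independently, in a number of ways that depends only on the matroid of the columns.
-- Summing over the columns one at a time gives a polynomial in x and y = qᵏ, because
-- for at most 5 columns the matroid determines the dimensions of all intersections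
-- of spans: among three flats of a matroid on at most 5 elements, two always differ by
-- at most one element on one side, and then their spans meet in the span of their
-- intersection (for 6 elements this fails, which is where the Fano plane enters).
-- Comparing coefficients of y isolates each rank, and nonempty rows contribute the
-- factor x^r, where d ≤ r.

open import Defs
open import Algebra.Bundles using (CommutativeRing)
import Algebra.Properties.Monoid.Sum as MonoidSum
import Algebra.Solver.Ring.NaturalCoefficients.Default as SemiringSolver
open import Data.Bool.Base using (Bool; true; false; if_then_else_; _∧_; not)
import Data.Bool.Properties as Bool
open import Data.Fin.Base using (Fin; zero; suc; toℕ)
import Data.Fin.Properties as Fin
open import Data.Fin.Subset as Subset
  using (Subset; inside; outside; _∩_; _∪_; ∁; ⁅_⁆; _∈_; _∉_; _⊆_; ∣_∣)
  renaming (⊤ to full; ⊥ to ∅)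
import Data.Fin.Subset.Properties as Subset
open import Data.Integer.Base as ℤ using (ℤ; +_; -_; _+_; _-_; _*_; _^_; 0ℤ; 1ℤ)
import Data.Integer.Properties as ℤ
open import Data.Integer.Tactic.RingSolver using (solve-∀)
open import Data.List.Base as List using (List; []; _∷_; _++_)
import Data.List.Membership.Propositional as List
open import Data.List.Membership.Propositional.Properties using (∈-allFin)
open import Data.List.Relation.Unary.All as All using (All; []; _∷_)
open import Data.List.Relation.Unary.Any as Any using (any?; here; there)
open import Data.Nat.Base as ℕ using (ℕ; zero; suc; _≤_; _<_; _∸_)
open import Data.Nat.Combinatorics using (nC1≡n; nCk+nC[k+1]≡[n+1]C[k+1]) renaming (_C_ to _choose_)
import Data.Nat.Properties as ℕ
open import Data.Nat.Tactic.RingSolver using () renaming (solve-∀ to solveℕ-∀)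
open import Data.Product.Base using (Σ-syntax; ∃-syntax; _×_; _,_; proj₁; proj₂)
open import Data.Rational.Base as ℚ using (ℚ; 1ℚ; _/_)
import Data.Rational.Properties as ℚ
open import Data.Rational.Solver using (module +-*-Solver)
open import Data.Rational.Unnormalised.Base as ℚᵘ using (mkℚᵘ; *≡*)
import Data.Rational.Unnormalised.Properties as ℚᵘ
open import Data.Sum.Base as Sum using (_⊎_; inj₁; inj₂)
open import Data.Unit.Base using (tt) renaming (⊤ to Unit)
open import Data.Vec.Base as Vec using (Vec; []; _∷_; lookup; here; there)
import Data.Vec.Properties as Vec
open import Data.Vec.Relation.Unary.All as VecAll using ([]; _∷_)
open import Function.Base using (_∘_; id)
open import Function.Bundles using (mk⇔; Inverse)
open import Relation.Binary.Definitions using (DecidableEquality)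
open import Relation.Binary.PropositionalEquality
open import Relation.Nullary using (¬_; Dec; yes; no; does; contradiction)
open import Relation.Nullary.Decidable
  using (_×-dec_; _⊎-dec_; _→-dec_; ¬?; does-⇔; dec-true; dec-false; decidable-stable; from-no; map′)
open MonoidSum ℤ.+-0-monoid using () renaming (sum to sumℤ)
open MonoidSum ℕ.+-0-monoid using () renaming (sum to sumℕ)
open import Algebra.Definitions.RawSemiring ℚ.+-*-rawSemiring using () renaming (_^_ to _^ℚ_)
open ≡-Reasoning

-- The polynomials have to be fixed before the field is known. Therefore counts are built as
-- expressions in an indeterminate, and a configuration of columns is a table of truth values that
-- mentions no field. A table may be realisable over some fields only; over the others, the
-- inclusion-exclusion coefficient that multiplies its contribution evaluates to 0, so a single
-- expression serves all q. The exponent 6 is where two bounds meet. A spanning tree of a connected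
-- graph on r rows and c columns has r + c - 1 edges, and each edge yields one factor x, so that 7
-- columns give r + 6 factors. With 6 columns, on the other hand, the sixth column only has to be
-- placed relative to the spans of five others. Exact supports are needed because the torus can
-- normalise the entries along a tree to 1 only if they are known to be nonzero. The boards
-- themselves come back at the end, by summing over all supports inside them.

private variable
  A B   : Set
  k m n : ℕ

-- Finite sums

bit : Bool → ℤ
bit b = if b then 1ℤ else 0ℤ

⟦_⟧ : {P : Set} → Dec P → ℤ
⟦ P? ⟧ = bit (does P?)

⟦⟧-cong : {P Q : Set} (P? : Dec P) (Q? : Dec Q) → (P → Q) → (Q → P) → ⟦ P? ⟧ ≡ ⟦ Q? ⟧
⟦⟧-cong P? Q? to from = cong bit (does-⇔ (mk⇔ to from) P? Q?)

⟦⟧-true : {P : Set} (P? : Dec P) → P → ⟦ P? ⟧ ≡ 1ℤ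
⟦⟧-true P? p = cong bit (dec-true P? p)

⟦⟧-false : {P : Set} (P? : Dec P) → ¬ P → ⟦ P? ⟧ ≡ 0ℤ
⟦⟧-false P? ¬p = cong bit (dec-false P? ¬p)

bit-∧ : ∀ b c → bit (b ∧ c) ≡ bit b * bit c
bit-∧ true  c = sym (ℤ.*-identityˡ _)
bit-∧ false c = refl

⟦⟧-× : {P Q : Set} (P? : Dec P) (Q? : Dec Q) → ⟦ P? ×-dec Q? ⟧ ≡ ⟦ P? ⟧ * ⟦ Q? ⟧
⟦⟧-× P? Q? = bit-∧ (does P?) (does Q?)

⟦⟧-*-cong : {P : Set} (P? : Dec P) {a b : ℤ} → (P → a ≡ b) → ⟦ P? ⟧ * a ≡ ⟦ P? ⟧ * b
⟦⟧-*-cong (yes p) eq = cong (1ℤ *_) (eq p)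
⟦⟧-*-cong (no ¬p) eq = refl

infixr 1 ∑
∑ : {A : Set} → List A → (A → ℤ) → ℤ
∑ []       f = 0ℤ
∑ (x ∷ xs) f = f x + ∑ xs f
syntax ∑ xs (λ x → e) = ∑[ x ← xs ] e

∑-cong : (xs : List A) {f g : A → ℤ} → (∀ x → f x ≡ g x) → ∑ xs f ≡ ∑ xs g
∑-cong []       eq = refl
∑-cong (x ∷ xs) eq = cong₂ _+_ (eq x) (∑-cong xs eq)

∑-zero : (xs : List A) → (∑[ x ← xs ] 0ℤ) ≡ 0ℤ
∑-zero []       = refl
∑-zero (x ∷ xs) = trans (ℤ.+-identityˡ _) (∑-zero xs)

∑-+ : (xs : List A) (f g : A → ℤ) → (∑[ x ← xs ] f x + g x) ≡ ∑ xs f + ∑ xs g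
∑-+ []       f g = refl
∑-+ (x ∷ xs) f g = trans (cong₂ _+_ {x = f x + g x} refl (∑-+ xs f g)) (interchange (f x) (g x) _ _)
  where
  interchange : ∀ a b c d → a + b + (c + d) ≡ a + c + (b + d)
  interchange = solve-∀

∑-*ˡ : (c : ℤ) (xs : List A) (f : A → ℤ) → (∑[ x ← xs ] c * f x) ≡ c * ∑ xs f
∑-*ˡ c []       f = sym (ℤ.*-zeroʳ c)
∑-*ˡ c (x ∷ xs) f = trans (cong₂ _+_ {x = c * f x} refl (∑-*ˡ c xs f)) (sym (ℤ.*-distribˡ-+ c (f x) _))

∑-*ʳ : (c : ℤ) (xs : List A) (f : A → ℤ) → (∑[ x ← xs ] f x * c) ≡ ∑ xs f * c
∑-*ʳ c xs f = trans (∑-cong xs λ x → ℤ.*-comm (f x) c) (trans (∑-*ˡ c xs f) (ℤ.*-comm c _))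

∑-++ : (xs ys : List A) (f : A → ℤ) → ∑ (xs ++ ys) f ≡ ∑ xs f + ∑ ys f
∑-++ []       ys f = sym (ℤ.+-identityˡ _)
∑-++ (x ∷ xs) ys f = trans (cong₂ _+_ {x = f x} refl (∑-++ xs ys f)) (sym (ℤ.+-assoc (f x) _ _))

∑-map : (h : B → A) (xs : List B) (f : A → ℤ) → ∑ (List.map h xs) f ≡ ∑ xs (f ∘ h)
∑-map h []       f = refl
∑-map h (x ∷ xs) f = cong₂ _+_ {x = f (h x)} refl (∑-map h xs f)

∑-swap : (xs : List A) (ys : List B) (f : A → B → ℤ) →
         (∑[ x ← xs ] ∑[ y ← ys ] f x y) ≡ (∑[ y ← ys ] ∑[ x ← xs ] f x y)
∑-swap []       ys f = sym (∑-zero ys)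
∑-swap (x ∷ xs) ys f = trans (cong₂ _+_ {x = ∑ ys (f x)} refl (∑-swap xs ys f)) (sym (∑-+ ys _ _))

∑-filter : {P : A → Set} (P? : ∀ x → Dec (P x)) (xs : List A) →
           + List.length (List.filter P? xs) ≡ (∑[ x ← xs ] ⟦ P? x ⟧)
∑-filter P? []       = refl
∑-filter P? (x ∷ xs) with does (P? x)
... | true  = trans (ℤ.pos-+ 1 (List.length (List.filter P? xs))) (cong₂ _+_ {x = 1ℤ} refl (∑-filter P? xs))
... | false = trans (∑-filter P? xs) (sym (ℤ.+-identityˡ _))

-- That the list meets every element exactly once is stated as a sum of Kronecker deltas, the form
-- in which `∑-δ` and the reindexing of sums consume it.
record Finite (A : Set) : Set where
  field
    elems : List A
    _≟_   : DecidableEquality A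
    once  : ∀ a → (∑[ b ← elems ] ⟦ a ≟ b ⟧) ≡ 1ℤ

  ∑-δ : ∀ a (f : A → ℤ) → (∑[ b ← elems ] ⟦ a ≟ b ⟧ * f b) ≡ f a
  ∑-δ a f = begin
    (∑[ b ← elems ] ⟦ a ≟ b ⟧ * f b)  ≡⟨ ∑-cong elems (λ b → ⟦⟧-*-cong (a ≟ b) (λ eq → cong f (sym eq))) ⟩
    (∑[ b ← elems ] ⟦ a ≟ b ⟧ * f a)  ≡⟨ ∑-*ʳ (f a) elems _ ⟩
    (∑[ b ← elems ] ⟦ a ≟ b ⟧) * f a  ≡⟨ cong (_* f a) (once a) ⟩
    1ℤ * f a                          ≡⟨ ℤ.*-identityˡ (f a) ⟩
    f a                               ∎

open Finite using (elems)

∑-fibres : (𝔹 : Finite B) (xs : List A) (φ : A → B) (f : A → ℤ) →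
           ∑ xs f ≡ (∑[ b ← elems 𝔹 ] ∑[ a ← xs ] ⟦ Finite._≟_ 𝔹 (φ a) b ⟧ * f a)
∑-fibres 𝔹 xs φ f = sym (trans (∑-swap (elems 𝔹) xs _)
  (∑-cong xs λ a → Finite.∑-δ 𝔹 (φ a) (λ _ → f a)))

-- Both sides arise from one double sum over pairs (a , b) with b = φ a, by summing out one variable
-- or the other; no permutation of lists is needed.
∑-bijection : (𝔸 : Finite A) (𝔹 : Finite B) (φ : A → B) (ψ : B → A) →
              (∀ a → ψ (φ a) ≡ a) → (∀ b → φ (ψ b) ≡ b) → (f : B → ℤ) →
              ∑ (elems 𝔸) (f ∘ φ) ≡ ∑ (elems 𝔹) f
∑-bijection 𝔸 𝔹 φ ψ ψφ φψ f = begin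
  ∑ A.elems (f ∘ φ)
    ≡⟨ ∑-cong A.elems (λ a → B.∑-δ (φ a) f) ⟨
  (∑[ a ← A.elems ] ∑[ b ← B.elems ] ⟦ φ a B.≟ b ⟧ * f b)
    ≡⟨ ∑-swap A.elems B.elems _ ⟩
  (∑[ b ← B.elems ] ∑[ a ← A.elems ] ⟦ φ a B.≟ b ⟧ * f b)
    ≡⟨ ∑-cong B.elems (λ b → ∑-cong A.elems λ a → cong (_* f b)
         (⟦⟧-cong (φ a B.≟ b) (ψ b A.≟ a)
           (λ eq → trans (cong ψ (sym eq)) (ψφ a)) (λ eq → trans (cong φ (sym eq)) (φψ b)))) ⟩
  (∑[ b ← B.elems ] ∑[ a ← A.elems ] ⟦ ψ b A.≟ a ⟧ * f b)
    ≡⟨ ∑-cong B.elems (λ b → A.∑-δ (ψ b) (λ _ → f b)) ⟩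
  ∑ B.elems f ∎
  where module A = Finite 𝔸
        module B = Finite 𝔹

∑-vectors : (xs : List A) (n : ℕ) (f : Vec A (suc n) → ℤ) →
            ∑ (vectors xs (suc n)) f ≡ (∑[ x ← xs ] ∑[ v ← vectors xs n ] f (x ∷ v))
∑-vectors {A} xs n f = go xs
  where
  go : ∀ ys → ∑ (List.cartesianProductWith _∷_ ys (vectors xs n)) f ≡ (∑[ x ← ys ] ∑[ v ← vectors xs n ] f (x ∷ v))
  go []       = refl
  go (y ∷ ys) = trans (∑-++ (List.map (y ∷_) (vectors xs n)) _ f)
                      (cong₂ _+_ (∑-map (y ∷_) (vectors xs n) f) (go ys))

∏ : {n : ℕ} → (Vec (A → ℤ) n) → Vec A n → ℤ
∏ []       []      = 1ℤ
∏ (f ∷ fs) (x ∷ v) = f x * ∏ fs v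

∏-sums : List A → {n : ℕ} → Vec (A → ℤ) n → ℤ
∏-sums xs []       = 1ℤ
∏-sums xs (f ∷ fs) = ∑ xs f * ∏-sums xs fs

∑-∏ : (xs : List A) {n : ℕ} (fs : Vec (A → ℤ) n) → ∑ (vectors xs n) (∏ fs) ≡ ∏-sums xs fs
∑-∏ xs []       = refl
∑-∏ xs {suc n} (f ∷ fs) = begin
  ∑ (vectors xs (suc n)) (∏ (f ∷ fs))                   ≡⟨ ∑-vectors xs n _ ⟩
  (∑[ x ← xs ] ∑[ v ← vectors xs n ] f x * ∏ fs v)     ≡⟨ ∑-cong xs (λ x → ∑-*ˡ (f x) (vectors xs n) (∏ fs)) ⟩
  (∑[ x ← xs ] f x * ∑ (vectors xs n) (∏ fs))          ≡⟨ ∑-*ʳ _ xs f ⟩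
  ∑ xs f * ∑ (vectors xs n) (∏ fs)                      ≡⟨ cong (∑ xs f *_) (∑-∏ xs fs) ⟩
  ∑ xs f * ∏-sums xs fs                                 ∎

vecFinite : Finite A → (n : ℕ) → Finite (Vec A n)
vecFinite {A = A} 𝔸 n = record { elems = vectors A.elems n ; _≟_ = Vec.≡-dec A._≟_ ; once = once n }
  where
  module A = Finite 𝔸
  once : ∀ n (v : Vec A n) → (∑[ w ← vectors A.elems n ] ⟦ Vec.≡-dec A._≟_ v w ⟧) ≡ 1ℤ
  once zero    []      = refl
  once (suc n) (a ∷ v) = begin
    (∑[ w ← vectors A.elems (suc n) ] ⟦ Vec.≡-dec A._≟_ (a ∷ v) w ⟧)
      ≡⟨ ∑-vectors A.elems n _ ⟩
    (∑[ b ← A.elems ] ∑[ w ← vectors A.elems n ] ⟦ Vec.≡-dec A._≟_ (a ∷ v) (b ∷ w) ⟧)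
      ≡⟨ ∑-cong A.elems (λ b → trans (∑-cong (vectors A.elems n) λ w → bit-∧ (does (a A.≟ b)) _)
                                     (∑-*ˡ ⟦ a A.≟ b ⟧ (vectors A.elems n) _)) ⟩
    (∑[ b ← A.elems ] ⟦ a A.≟ b ⟧ * (∑[ w ← vectors A.elems n ] ⟦ Vec.≡-dec A._≟_ v w ⟧))
      ≡⟨ ∑-cong A.elems (λ b → cong (⟦ a A.≟ b ⟧ *_) (once n v)) ⟩
    (∑[ b ← A.elems ] ⟦ a A.≟ b ⟧ * 1ℤ)
      ≡⟨ A.∑-δ a (λ _ → 1ℤ) ⟩
    1ℤ ∎

finite-Bool : Finite Bool
finite-Bool = record { elems = true ∷ false ∷ [] ; _≟_ = Bool._≟_ ; once = once }
  where
  once : ∀ a → _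
  once true  = refl
  once false = refl

-- Subspaces of Kᵏ

∑-none : (_≟_ : DecidableEquality A) (a : A) (xs : List A) → ¬ (a List.∈ xs) → (∑[ b ← xs ] ⟦ a ≟ b ⟧) ≡ 0ℤ
∑-none _≟_ a []       a∉ = refl
∑-none _≟_ a (x ∷ xs) a∉ =
  cong₂ _+_ (⟦⟧-false (a ≟ x) λ a≡x → a∉ (here a≡x)) (∑-none _≟_ a xs (a∉ ∘ there))

module _ (𝔸 : Finite A) where
  open Finite 𝔸

  ∈-elems : ∀ a → a List.∈ elems 𝔸
  ∈-elems a with any? (a ≟_) (elems 𝔸)
  ... | yes a∈ = a∈
  ... | no  a∉ = contradiction (trans (sym (∑-none _≟_ a _ a∉)) (once a)) λ ()

  ∃? : {P : A → Set} → (∀ a → Dec (P a)) → Dec (∃[ a ] P a)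
  ∃? P? = map′ Any.satisfied (λ (a , p) → List.lose (∈-elems a) p) (any? P? (elems 𝔸))

  ∑-unique : {P : A → Set} (P? : ∀ a → Dec (P a)) (∃P? : Dec (∃[ a ] P a)) → (∀ {a b} → P a → P b → a ≡ b) →
             (∑[ a ← elems 𝔸 ] ⟦ P? a ⟧) ≡ ⟦ ∃P? ⟧
  ∑-unique P? (yes (a , p)) unique =
    trans (∑-cong (elems 𝔸) λ b → ⟦⟧-cong (P? b) (a ≟ b) (unique p) λ { refl → p }) (once a)
  ∑-unique P? (no ∄)        unique =
    trans (∑-cong (elems 𝔸) λ b → ⟦⟧-false (P? b) λ p → ∄ (b , p)) (∑-zero (elems 𝔸))

-- The matroid of a list of columns: for every column, the truth values of its lying in
-- the span of T, where T runs through the sets of later columns in the order of subsets.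
Conf : ℕ → Set
Conf zero    = Unit
Conf (suc n) = List Bool × Conf n

subsets : (n : ℕ) → List (Subset n)
subsets = vectors (outside ∷ inside ∷ [])

∈-subsets : (T : Subset n) → T List.∈ subsets n
∈-subsets = ∈-vectors λ { outside → here refl ; inside → there (here refl) }

_≟ˢ_ : DecidableEquality (Subset n)
_≟ˢ_ = Vec.≡-dec Bool._≟_

-- Tables are flat lists of booleans because `tableSum` branches on one truth value at a time. As
-- `subsets n` is complete, the default `false` is never reached for a genuine table.
entry : List (Subset n) → List Bool → Subset n → Bool
entry (S ∷ Ss) (b ∷ bs) T = if does (S ≟ˢ T) then b else entry Ss bs T
entry _        _        T = false

entry-map : (g : Subset n → Bool) {Ss : List (Subset n)} {T : Subset n} → T List.∈ Ss →
            entry Ss (List.map g Ss) T ≡ g T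
entry-map g {S ∷ Ss} {T} T∈ with S ≟ˢ T | T∈
... | yes refl | _        = refl
... | no  S≢T  | here eq  = contradiction (sym eq) S≢T
... | no  S≢T  | there T∈ = entry-map g T∈

-- Greedy rank, starting from the last column: a column counts exactly when the table places it
-- outside the span of the later columns in T.
rank : Conf n → Subset n → ℕ
rank _       []            = 0
rank (t , μ) (outside ∷ T) = rank μ T
rank (t , μ) (inside ∷ T)  = if entry (subsets _) t T then rank μ T else suc (rank μ T)

nullity : Conf n → Subset n → ℕ
nullity _       []            = 0
nullity (t , μ) (outside ∷ T) = nullity μ T
nullity (t , μ) (inside ∷ T)  = if entry (subsets _) t T then suc (nullity μ T) else nullity μ T

module LinearAlgebra {q : ℕ} (F : FiniteField q) where

  open FiniteField F using (elements; enumeration; #⇒invertible; commutativeRing; 0#; 1#) public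
  open FiniteField F using () renaming (Carrier to K; _+_ to _⊹_; _*_ to _·_; -_ to ⊖_; _≟_ to _≟ᴷ_) public

  Mat : ℕ → ℕ → Set
  Mat m n = Vec (Vec K n) m

  finiteK : Finite K
  finiteK = record { elems = elements ; _≟_ = _≟ᴷ_ ; once = once }
    where
    open Inverse enumeration
    onceFin : ∀ {m} (g : Fin m → K) → (∀ {i j} → g i ≡ g j → i ≡ j) → ∀ i →
              (∑[ b ← List.tabulate g ] ⟦ g i ≟ᴷ b ⟧) ≡ 1ℤ
    zeros : ∀ {m} (g : Fin m → K) a → (∀ i → a ≢ g i) → (∑[ b ← List.tabulate g ] ⟦ a ≟ᴷ b ⟧) ≡ 0ℤ
    zeros {zero}  g a a≢ = refl
    zeros {suc m} g a a≢ = cong₂ _+_ (⟦⟧-false (a ≟ᴷ _) (a≢ zero)) (zeros (g ∘ suc) a (a≢ ∘ suc))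
    onceFin g inj zero    = cong₂ _+_ (⟦⟧-true (g zero ≟ᴷ g zero) refl)
      (zeros (g ∘ suc) (g zero) λ i eq → contradiction (inj eq) λ ())
    onceFin g inj (suc i) = cong₂ _+_ (⟦⟧-false (g (suc i) ≟ᴷ g zero) λ eq → contradiction (inj eq) λ ())
      (onceFin (g ∘ suc) (λ eq → Fin.suc-injective (inj eq)) i)
    from-injective : ∀ {i j} → from i ≡ from j → i ≡ j
    from-injective {i} {j} eq = trans (sym (strictlyInverseˡ i)) (trans (cong to eq) (strictlyInverseˡ j))
    once : ∀ a → (∑[ b ← elements ] ⟦ a ≟ᴷ b ⟧) ≡ 1ℤ
    once a = subst (λ a → (∑[ b ← elements ] ⟦ a ≟ᴷ b ⟧) ≡ 1ℤ) (strictlyInverseʳ a)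
        (onceFin from from-injective (to a))

  ∑-1 : (∑[ a ← elements ] 1ℤ) ≡ + q
  ∑-1 = go q (Inverse.from enumeration)
    where
    go : ∀ m (g : Fin m → K) → (∑[ a ← List.tabulate g ] 1ℤ) ≡ + m
    go zero    g = refl
    go (suc m) g = trans (cong₂ _+_ {x = 1ℤ} refl (go m (g ∘ suc))) (sym (ℤ.pos-+ 1 m))

  ∑-const : ∀ c → (∑[ a ← elements ] c) ≡ + q * c
  ∑-const c = begin
    (∑[ a ← elements ] c)        ≡⟨ ∑-cong elements (λ _ → ℤ.*-identityˡ c) ⟨
    (∑[ a ← elements ] 1ℤ * c)   ≡⟨ ∑-*ʳ c elements (λ _ → 1ℤ) ⟩
    (∑[ a ← elements ] 1ℤ) * c   ≡⟨ cong (_* c) ∑-1 ⟩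
    + q * c                      ∎

  module S = SemiringSolver (CommutativeRing.commutativeSemiring commutativeRing)
  module K = CommutativeRing commutativeRing

  inverse : ∀ {a} → a ≢ 0# → ∃[ b ] b · a ≡ 1#
  inverse {a} a≢0 with #⇒invertible {a} {0#} a≢0
  -- The inverse supplied belongs to the difference a - 0, which has to be rewritten to a.
  ... | b , eq , _ = b , trans (cong (b ·_) (sym lemma)) eq
    where
    lemma : a ⊹ ⊖ 0# ≡ a
    lemma = begin
      a ⊹ ⊖ 0#           ≡⟨ K.+-identityʳ _ ⟨
      a ⊹ ⊖ 0# ⊹ 0#      ≡⟨ K.+-assoc a (⊖ 0#) 0# ⟩
      a ⊹ (⊖ 0# ⊹ 0#)    ≡⟨ cong (a ⊹_) (K.-‿inverseˡ 0#) ⟩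
      a ⊹ 0#             ≡⟨ K.+-identityʳ a ⟩
      a                  ∎

  infixl 6 _+[_]_
  -- The operation u + a v covers both addition (a = 1) and scaling (u = 0), so that subspaces need
  -- only one closure axiom.
  _+[_]_ : Vec K k → K → Vec K k → Vec K k
  u +[ a ] v = Vec.zipWith (λ x y → x ⊹ a · y) u v

  𝟎 : Vec K k
  𝟎 = Vec.replicate _ 0#

  +[]-+[] : (u v : Vec K k) (a b : K) → (u +[ a ] v) +[ b ] v ≡ u +[ a ⊹ b ] v
  +[]-+[] []      []      a b = refl
  +[]-+[] (x ∷ u) (y ∷ v) a b = cong₂ _∷_
    (S.solve 4 (λ x y a b → (x S.:+ a S.:* y S.:+ b S.:* y) S.:= (x S.:+ (a S.:+ b) S.:* y)) refl x y a b)
    (+[]-+[] u v a b)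

  +[]-comm : (u v w : Vec K k) (a b : K) → (u +[ a ] v) +[ b ] w ≡ (u +[ b ] w) +[ a ] v
  +[]-comm []      []      []      a b = refl
  +[]-comm (x ∷ u) (y ∷ v) (z ∷ w) a b = cong₂ _∷_
    (S.solve 5 (λ x y z a b → (x S.:+ a S.:* y S.:+ b S.:* z) S.:= (x S.:+ b S.:* z S.:+ a S.:* y)) refl x y z a b)
    (+[]-comm u v w a b)

  +[]-distrib : (u v w : Vec K k) (a b c : K) →
                (u +[ b ] v) +[ a ⊹ b · c ] w ≡ (u +[ a ] w) +[ b ] (v +[ c ] w)
  +[]-distrib []      []      []      a b c = refl
  +[]-distrib (x ∷ u) (y ∷ v) (z ∷ w) a b c = cong₂ _∷_
    (S.solve 6 (λ x y z a b c → (x S.:+ b S.:* y S.:+ (a S.:+ b S.:* c) S.:* z) S.:=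
                                (x S.:+ a S.:* z S.:+ b S.:* (y S.:+ c S.:* z))) refl x y z a b c)
    (+[]-distrib u v w a b c)

  +[0] : (u v : Vec K k) → u +[ 0# ] v ≡ u
  +[0] []      []      = refl
  +[0] (x ∷ u) (y ∷ v) = cong₂ _∷_ (trans (cong (x ⊹_) (K.zeroˡ y)) (K.+-identityʳ x)) (+[0] u v)

  +[]𝟎 : (u : Vec K k) (a : K) → u +[ a ] 𝟎 ≡ u
  +[]𝟎 []      a = refl
  +[]𝟎 (x ∷ u) a = cong₂ _∷_ (trans (cong (x ⊹_) (K.zeroʳ a)) (K.+-identityʳ x)) (+[]𝟎 u a)

  𝟎+[1] : (u : Vec K k) → 𝟎 +[ 1# ] u ≡ u
  𝟎+[1] []      = refl
  𝟎+[1] (x ∷ u) = cong₂ _∷_ (trans (K.+-identityˡ _) (K.*-identityˡ x)) (𝟎+[1] u)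

  +[]-cancel : (u v : Vec K k) {a b : K} → a ⊹ b ≡ 0# → (u +[ a ] v) +[ b ] v ≡ u
  +[]-cancel u v {a} {b} eq = trans (+[]-+[] u v a b) (trans (cong (λ c → u +[ c ] v) eq) (+[0] u v))

  space : (k : ℕ) → List (Vec K k)
  space k = vectors elements k

  finiteSpace : (k : ℕ) → Finite (Vec K k)
  finiteSpace = vecFinite finiteK

  record Subspace (k : ℕ) : Set₁ where
    field
      Mem    : Vec K k → Set
      mem?   : ∀ u → Dec (Mem u)
      𝟎∈     : Mem 𝟎
      closed : ∀ {u v} a → Mem u → Mem v → Mem (u +[ a ] v)

    scaled : ∀ {v} a → Mem v → Mem (𝟎 +[ a ] v)
    scaled a = closed a 𝟎∈

    shift : ∀ {u v} a → Mem v → Mem (u +[ a ] v) → Mem u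
    shift {u} {v} a v∈ u+v∈ = subst Mem (+[]-cancel u v (K.-‿inverseʳ a)) (closed (⊖ a) u+v∈ v∈)

    size : ℤ
    size = ∑[ u ← space k ] ⟦ mem? u ⟧

  open Subspace

  unscale : (U : Subspace k) {v : Vec K k} {a : K} → a ≢ 0# → Mem U (𝟎 +[ a ] v) → Mem U v
  unscale U {v} {a} a≢0 av∈ = subst (Mem U) eq (scaled U b av∈)
    where
    b = proj₁ (inverse a≢0)
    scale-scale : ∀ {k} (v : Vec K k) → 𝟎 +[ b ] (𝟎 +[ a ] v) ≡ 𝟎 +[ b · a ] v
    scale-scale []      = refl
    scale-scale (x ∷ v) = cong₂ _∷_
      (cong (0# ⊹_) (trans (cong (b ·_) (K.+-identityˡ _)) (sym (K.*-assoc b a x)))) (scale-scale v)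
    eq : 𝟎 +[ b ] (𝟎 +[ a ] v) ≡ v
    eq = trans (scale-scale v) (trans (cong (λ c → 𝟎 +[ c ] v) (proj₂ (inverse a≢0))) (𝟎+[1] v))

  -- Subtracting the two memberships puts (b - a) v into U; were b - a invertible, v itself would
  -- lie in U.
  coefficient-unique : (U : Subspace k) {u v : Vec K k} → ¬ Mem U v → ∀ {a b} →
                       Mem U (u +[ a ] v) → Mem U (u +[ b ] v) → a ≡ b
  coefficient-unique U {u} {v} v∉ {a} {b} a∈ b∈ with (b ⊹ ⊖ a) ≟ᴷ 0#
  ... | yes eq = sym (x∙y⁻¹≈ε⇒x≈y b a eq)
    where open import Algebra.Properties.Group K.+-group using (x∙y⁻¹≈ε⇒x≈y)
  ... | no b-a≢0 = contradiction (unscale U b-a≢0 (shift U 1# a∈ (subst (Mem U) eq b∈))) v∉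
    where
    a+[b-a] : b ≡ a ⊹ (b ⊹ ⊖ a)
    a+[b-a] = begin
      b                 ≡⟨ K.+-identityʳ b ⟨
      b ⊹ 0#            ≡⟨ cong (b ⊹_) (K.-‿inverseˡ a) ⟨
      b ⊹ (⊖ a ⊹ a)     ≡⟨ K.+-assoc b (⊖ a) a ⟨
      b ⊹ ⊖ a ⊹ a       ≡⟨ K.+-comm _ a ⟩
      a ⊹ (b ⊹ ⊖ a)     ∎
    eq : u +[ b ] v ≡ (𝟎 +[ b ⊹ ⊖ a ] v) +[ 1# ] (u +[ a ] v)
    eq = begin
      u +[ b ] v                                     ≡⟨ cong (λ c → u +[ c ] v) a+[b-a] ⟩
      u +[ a ⊹ (b ⊹ ⊖ a) ] v                         ≡⟨ +[]-+[] u v a _ ⟨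
      u +[ a ] v +[ b ⊹ ⊖ a ] v                      ≡⟨ cong (_+[ b ⊹ ⊖ a ] v) (𝟎+[1] _) ⟨
      𝟎 +[ 1# ] (u +[ a ] v) +[ b ⊹ ⊖ a ] v          ≡⟨ +[]-comm 𝟎 (u +[ a ] v) v 1# (b ⊹ ⊖ a) ⟩
      𝟎 +[ b ⊹ ⊖ a ] v +[ 1# ] (u +[ a ] v)          ∎

  module _ {k : ℕ} where

    infixr 7 _⊓_
    infixr 6 _⊞_

    -- Membership of u in the sum is witnessed by some w in W with u + w in U. The witnesses for a
    -- given u form a coset of the intersection, which is what `size-⊓-⊞` counts.
    _⊓_ _⊞_ : Subspace k → Subspace k → Subspace k
    U ⊓ W = record
      { Mem    = λ u → Mem U u × Mem W u
      ; mem?   = λ u → mem? U u ×-dec mem? W u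
      ; 𝟎∈     = 𝟎∈ U , 𝟎∈ W
      ; closed = λ a (u , u′) (v , v′) → closed U a u v , closed W a u′ v′
      }
    U ⊞ W = record
      { Mem    = λ u → ∃[ w ] Mem W w × Mem U (u +[ 1# ] w)
      ; mem?   = λ u → ∃? (finiteSpace k) λ w → mem? W w ×-dec mem? U (u +[ 1# ] w)
      ; 𝟎∈     = 𝟎 , 𝟎∈ W , subst (Mem U) (sym (+[]𝟎 𝟎 _)) (𝟎∈ U)
      ; closed = λ {u} {v} a (w , w∈ , u+w) (t , t∈ , v+t) →
          w +[ a ] t , closed W a w∈ t∈ , subst (Mem U) (sym (lemma u v w t a 1#)) (closed U a u+w v+t)
      }
      where
      lemma : ∀ {k} (u v w t : Vec K k) a c → (u +[ a ] v) +[ c ] (w +[ a ] t) ≡ (u +[ c ] w) +[ a ] (v +[ c ] t)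
      lemma []       []       []       []       a c = refl
      lemma (u ∷ us) (v ∷ vs) (w ∷ ws) (t ∷ ts) a c = cong₂ _∷_
        (S.solve 6 (λ u v w t a c → (u S.:+ a S.:* v S.:+ c S.:* (w S.:+ a S.:* t)) S.:=
                                    (u S.:+ c S.:* w S.:+ a S.:* (v S.:+ c S.:* t))) refl u v w t a c)
        (lemma us vs ws ts a c)

    ∑-translate : (v : Vec K k) (a : K) (f : Vec K k → ℤ) → (∑[ u ← space k ] f (u +[ a ] v)) ≡ ∑ (space k) f
    ∑-translate v a = ∑-bijection (finiteSpace k) (finiteSpace k) (_+[ a ] v) (_+[ ⊖ a ] v)
      (λ u → +[]-cancel u v (K.-‿inverseʳ a)) (λ u → +[]-cancel u v (K.-‿inverseˡ a))

    -- Count the pairs (u , w) with w in W and u + w in U. For fixed w, the u form a translate of U;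
    -- for fixed u in the sum, the w form a coset of the intersection. This is the modular law for
    -- dimensions, in multiplicative form.
    size-⊓-⊞ : (U W : Subspace k) → size U * size W ≡ size (U ⊓ W) * size (U ⊞ W)
    size-⊓-⊞ U W = begin
      size U * size W
        ≡⟨ ∑-*ˡ (size U) (space k) _ ⟨
      (∑[ w ← space k ] size U * ⟦ mem? W w ⟧)
        ≡⟨ ∑-cong (space k) (λ w → trans (cong (_* ⟦ mem? W w ⟧)
             (sym (∑-translate w 1# (λ u → ⟦ mem? U u ⟧)))) (sym (∑-*ʳ _ (space k) _))) ⟩
      (∑[ w ← space k ] ∑[ u ← space k ] ⟦ mem? U (u +[ 1# ] w) ⟧ * ⟦ mem? W w ⟧)
        ≡⟨ ∑-swap (space k) (space k) _ ⟩
      (∑[ u ← space k ] ∑[ w ← space k ] ⟦ mem? U (u +[ 1# ] w) ⟧ * ⟦ mem? W w ⟧)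
        ≡⟨ ∑-cong (space k) (λ u → fibre u (mem? (U ⊞ W) u)) ⟩
      (∑[ u ← space k ] size (U ⊓ W) * ⟦ mem? (U ⊞ W) u ⟧)
        ≡⟨ ∑-*ˡ (size (U ⊓ W)) (space k) _ ⟩
      size (U ⊓ W) * size (U ⊞ W) ∎
      where
      fibre : ∀ u (u∈? : Dec (Mem (U ⊞ W) u)) →
              (∑[ w ← space k ] ⟦ mem? U (u +[ 1# ] w) ⟧ * ⟦ mem? W w ⟧) ≡ size (U ⊓ W) * ⟦ u∈? ⟧
      fibre u (no u∉) = begin
        (∑[ w ← space k ] ⟦ mem? U (u +[ 1# ] w) ⟧ * ⟦ mem? W w ⟧)
          ≡⟨ ∑-cong (space k) (λ w → trans (sym (⟦⟧-× (mem? U (u +[ 1# ] w)) (mem? W w)))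
               (⟦⟧-false (mem? U (u +[ 1# ] w) ×-dec mem? W w) λ (u+w , w∈) → u∉ (w , w∈ , u+w))) ⟩
        (∑[ w ← space k ] 0ℤ)  ≡⟨ ∑-zero (space k) ⟩
        0ℤ                     ≡⟨ ℤ.*-zeroʳ (size (U ⊓ W)) ⟨
        size (U ⊓ W) * 0ℤ      ∎
      fibre u (yes (w₀ , w₀∈ , u+w₀)) = begin
        (∑[ w ← space k ] ⟦ mem? U (u +[ 1# ] w) ⟧ * ⟦ mem? W w ⟧)
          ≡⟨ ∑-translate w₀ 1# _ ⟨
        (∑[ t ← space k ] ⟦ mem? U (u +[ 1# ] (t +[ 1# ] w₀)) ⟧ * ⟦ mem? W (t +[ 1# ] w₀) ⟧)
          ≡⟨ ∑-cong (space k) (λ t → trans (cong₂ _*_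
               (trans (cong (λ v → ⟦ mem? U v ⟧) (rotate t))
                 (⟦⟧-cong (mem? U (t +[ 1# ] (u +[ 1# ] w₀))) (mem? U t) (shift U 1# u+w₀) λ t∈ →
                     closed U 1# t∈ u+w₀))
               (⟦⟧-cong (mem? W (t +[ 1# ] w₀)) (mem? W t) (shift W 1# w₀∈) λ t∈ → closed W 1# t∈ w₀∈))
               (sym (⟦⟧-× (mem? U t) (mem? W t)))) ⟩
        size (U ⊓ W)         ≡⟨ ℤ.*-identityʳ _ ⟨
        size (U ⊓ W) * 1ℤ    ∎
        where
        rotate : ∀ t → u +[ 1# ] (t +[ 1# ] w₀) ≡ t +[ 1# ] (u +[ 1# ] w₀)
        rotate t = go u t w₀
          where
          drop-1 : ∀ a b c → a ⊹ 1# · (b ⊹ 1# · c) ≡ a ⊹ (b ⊹ c)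
          drop-1 a b c = cong (a ⊹_) (trans (K.*-identityˡ _) (cong (b ⊹_) (K.*-identityˡ c)))
          go : ∀ {k} (u t w : Vec K k) → u +[ 1# ] (t +[ 1# ] w) ≡ t +[ 1# ] (u +[ 1# ] w)
          go []       []       []       = refl
          go (u ∷ us) (t ∷ ts) (w ∷ ws) = cong₂ _∷_ (trans (drop-1 u t w) (trans
            (S.solve 3 (λ u t w → u S.:+ (t S.:+ w) S.:= t S.:+ (u S.:+ w)) refl u t w) (sym (drop-1 t u w))))
                (go us ts ws)

-- Intersections of spans of columns

∑-nonNegative : (xs : List A) (f : A → ℤ) → (∀ x → 0ℤ ℤ.≤ f x) → 0ℤ ℤ.≤ ∑ xs f
∑-nonNegative []       f f≥0 = ℤ.≤-refl
∑-nonNegative (x ∷ xs) f f≥0 = ℤ.+-mono-≤ (f≥0 x) (∑-nonNegative xs f f≥0)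

∑≡0 : (xs : List A) (f : A → ℤ) → (∀ x → 0ℤ ℤ.≤ f x) → ∑ xs f ≡ 0ℤ → ∀ {x} → x List.∈ xs → f x ≡ 0ℤ
∑≡0 (y ∷ xs) f f≥0 eq x∈ = go x∈
  where
  fy≤0 : f y ℤ.≤ 0ℤ
  fy≤0 = subst₂ ℤ._≤_ (ℤ.+-identityʳ _) eq (ℤ.+-monoʳ-≤ (f y) (∑-nonNegative xs f f≥0))
  fy≡0 : f y ≡ 0ℤ
  fy≡0 = ℤ.≤-antisym fy≤0 (f≥0 y)
  go : ∀ {x} → x List.∈ (y ∷ xs) → f x ≡ 0ℤ
  go (here refl) = fy≡0
  go (there x∈)  = ∑≡0 xs f f≥0 (trans (sym (ℤ.+-identityˡ _)) (trans (cong (_+ ∑ xs f) (sym fy≡0)) eq)) x∈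

∑-mono-≤ : (xs : List A) {f g : A → ℤ} → (∀ x → f x ℤ.≤ g x) → ∑ xs f ℤ.≤ ∑ xs g
∑-mono-≤ []       f≤g = ℤ.≤-refl
∑-mono-≤ (x ∷ xs) f≤g = ℤ.+-mono-≤ (f≤g x) (∑-mono-≤ xs f≤g)

0≤⟦⟧ : {P : Set} (P? : Dec P) → 0ℤ ℤ.≤ ⟦ P? ⟧
0≤⟦⟧ (yes _) = ℤ.+≤+ ℕ.z≤n
0≤⟦⟧ (no  _) = ℤ.≤-refl

-- Closures, set differences and close pairs

closure : Conf n → Subset n → Subset n
closure μ T = Vec.tabulate λ j → does (rank μ (T ∪ ⁅ j ⁆) ℕ.≟ rank μ T)

excess : Subset n → Subset n → ℕ
excess []           []            = 0
excess (inside ∷ S) (outside ∷ T) = suc (excess S T)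
excess (_ ∷ S)      (_ ∷ T)       = excess S T

excess≡0 : (S T : Subset n) → excess S T ≡ 0 → ∀ {i} → i ∈ S → i ∈ T
excess≡0 (inside  ∷ S) (inside  ∷ T) eq here       = here
excess≡0 (inside  ∷ S) (inside  ∷ T) eq (there i∈) = there (excess≡0 S T eq i∈)
excess≡0 (outside ∷ S) (_       ∷ T) eq (there i∈) = there (excess≡0 S T eq i∈)

excess≤1 : (S T : Subset n) → excess S T ≤ 1 →
           S ⊆ T ⊎ ∃[ a ] (a ∈ S × a ∉ T × (∀ {i} → i ∈ S → i ≡ a ⊎ i ∈ T))
excess≤1 [] [] _ = inj₁ id
excess≤1 (inside ∷ S) (outside ∷ T) (ℕ.s≤s ≤0) = inj₂ (zero , here , (λ ()) , λ
  { here → inj₁ refl ; (there i∈) → inj₂ (there (excess≡0 S T (ℕ.n≤0⇒n≡0 ≤0) i∈)) })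
excess≤1 (inside ∷ S) (inside ∷ T) ≤1 with excess≤1 S T ≤1
... | inj₁ S⊆T = inj₁ (Subset.s⊆s S⊆T)
... | inj₂ (a , a∈ , a∉ , only) = inj₂ (suc a , there a∈ , (λ { (there a∈T) → a∉ a∈T }) , λ
  { here → inj₂ here ; (there i∈) → Sum.map (cong suc) there (only i∈) })
excess≤1 (outside ∷ S) (t ∷ T) ≤1 with excess≤1 S T ≤1
... | inj₁ S⊆T = inj₁ (Subset.out⊆ S⊆T)
... | inj₂ (a , a∈ , a∉ , only) = inj₂ (suc a , there a∈ , (λ { (there a∈T) → a∉ a∈T }) , λ
  { (there i∈) → Sum.map (cong suc) there (only i∈) })

-- An element contributes to two of the six differences of S, T, U, or to none.
excess-sum : (S T U : Subset n) →
  excess S T ℕ.+ excess T S ℕ.+ (excess S U ℕ.+ excess U S) ℕ.+ (excess T U ℕ.+ excess U T) ≤ n ℕ.+ n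
excess-sum [] [] [] = ℕ.z≤n
excess-sum {suc n} (s ∷ S) (t ∷ T) (u ∷ U) = ℕ.≤-trans (step s t u) (ℕ.≤-trans (ℕ.+-monoʳ-≤ 2 (excess-sum S T U))
  (ℕ.≤-reflexive (cong suc (sym (ℕ.+-suc n n)))))
  where
  a = excess S T
  b = excess T S
  c = excess S U
  d = excess U S
  e = excess T U
  f = excess U T
  step : ∀ s t u →
    excess (s ∷ S) (t ∷ T) ℕ.+ excess (t ∷ T) (s ∷ S) ℕ.+ (excess (s ∷ S) (u ∷ U) ℕ.+ excess (u ∷ U) (s ∷ S)) ℕ.+
    (excess (t ∷ T) (u ∷ U) ℕ.+ excess (u ∷ U) (t ∷ T)) ≤ 2 ℕ.+ (a ℕ.+ b ℕ.+ (c ℕ.+ d) ℕ.+ (e ℕ.+ f))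
  step inside  inside  inside  = ℕ.m≤n+m _ 2
  step outside outside outside = ℕ.m≤n+m _ 2
  step inside  outside outside = ℕ.≤-reflexive (eq a b c d e f)
    where
    eq : ∀ a b c d e f → suc a ℕ.+ b ℕ.+ (suc c ℕ.+ d) ℕ.+ (e ℕ.+ f) ≡ 2 ℕ.+ (a ℕ.+ b ℕ.+ (c ℕ.+ d) ℕ.+ (e ℕ.+ f))
    eq = solveℕ-∀
  step outside inside  inside  = ℕ.≤-reflexive (eq a b c d e f)
    where
    eq : ∀ a b c d e f → a ℕ.+ suc b ℕ.+ (c ℕ.+ suc d) ℕ.+ (e ℕ.+ f) ≡ 2 ℕ.+ (a ℕ.+ b ℕ.+ (c ℕ.+ d) ℕ.+ (e ℕ.+ f))
    eq = solveℕ-∀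
  step outside inside  outside = ℕ.≤-reflexive (eq a b c d e f)
    where
    eq : ∀ a b c d e f → a ℕ.+ suc b ℕ.+ (c ℕ.+ d) ℕ.+ (suc e ℕ.+ f) ≡ 2 ℕ.+ (a ℕ.+ b ℕ.+ (c ℕ.+ d) ℕ.+ (e ℕ.+ f))
    eq = solveℕ-∀
  step inside  outside inside  = ℕ.≤-reflexive (eq a b c d e f)
    where
    eq : ∀ a b c d e f → suc a ℕ.+ b ℕ.+ (c ℕ.+ d) ℕ.+ (e ℕ.+ suc f) ≡ 2 ℕ.+ (a ℕ.+ b ℕ.+ (c ℕ.+ d) ℕ.+ (e ℕ.+ f))
    eq = solveℕ-∀
  step outside outside inside  = ℕ.≤-reflexive (eq a b c d e f)
    where
    eq : ∀ a b c d e f → a ℕ.+ b ℕ.+ (c ℕ.+ suc d) ℕ.+ (e ℕ.+ suc f) ≡ 2 ℕ.+ (a ℕ.+ b ℕ.+ (c ℕ.+ d) ℕ.+ (e ℕ.+ f))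
    eq = solveℕ-∀
  step inside  inside  outside = ℕ.≤-reflexive (eq a b c d e f)
    where
    eq : ∀ a b c d e f → a ℕ.+ b ℕ.+ (suc c ℕ.+ d) ℕ.+ (suc e ℕ.+ f) ≡ 2 ℕ.+ (a ℕ.+ b ℕ.+ (c ℕ.+ d) ℕ.+ (e ℕ.+ f))
    eq = solveℕ-∀

-- The condition under which the spans of two flats meet in the span of their intersection
-- (`span-∩`). It matters: among four vectors of a 3-dimensional space, any three of them
-- independent, the flats {1,2} and {3,4} are disjoint, but their spans share a line.
Close : Subset n → Subset n → Set
Close S T = excess S T ≤ 1 ⊎ excess T S ≤ 1

close? : (S T : Subset n) → Dec (Close S T)
close? S T = (excess S T ℕ.≤? 1) ⊎-dec (excess T S ℕ.≤? 1)

-- Were all six differences at least 2, their sum would be at least 12.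
close-pair : n ≤ 5 → (S T U : Subset n) → Close S T ⊎ Close S U ⊎ Close T U
close-pair {n} n≤5 S T U with close? S T | close? S U | close? T U
... | yes c | _     | _     = inj₁ c
... | no  _ | yes c | _     = inj₂ (inj₁ c)
... | no  _ | no  _ | yes c = inj₂ (inj₂ c)
... | no ¬a | no ¬b | no ¬c = contradiction
  (ℕ.≤-trans (ℕ.+-mono-≤ (ℕ.+-mono-≤ (four S T ¬a) (four S U ¬b)) (four T U ¬c))
    (ℕ.≤-trans (excess-sum S T U) (ℕ.+-mono-≤ n≤5 n≤5)))
  (from-no (12 ℕ.≤? 10))
  where
  four : ∀ (S T : Subset n) → ¬ Close S T → 4 ≤ excess S T ℕ.+ excess T S
  four S T ¬c = ℕ.+-mono-≤ (ℕ.≰⇒> (¬c ∘ inj₁)) (ℕ.≰⇒> (¬c ∘ inj₂))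

-- A pair of flats stands for the intersection of their two spans; adding a third
-- flat S leaves a pair, since two of the three flats are close.
meet : Subset n → Subset n × Subset n → Subset n × Subset n
meet S (T , U) with close? S T | close? S U
... | yes _ | _     = S ∩ T , U
... | no  _ | yes _ = S ∩ U , T
-- For n ≤ 5 the remaining pair T, U is close by `close-pair`; for larger n this branch is merely a
-- default.
... | no  _ | no  _ = T ∩ U , S

-- Starting from `full` confines the intersection to the span of all columns; the vectors outside it
-- are treated separately in `extensions`.
meets : Conf n → List (Subset n) → Subset n × Subset n
meets μ []       = full , full
meets μ (T ∷ Ts) = meet (closure μ T) (meets μ Ts)

-- Submodularity of the rank, proved as `r≤` in `count-meets`, ensures that the subtraction is not
-- truncated.
dimension : Conf n → List (Subset n) → ℕ
dimension μ Ts = let T , U = meets μ Ts in rank μ T ℕ.+ rank μ U ∸ rank μ (T ∪ U)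

module Spans {q : ℕ} (F : FiniteField q) where

  open LinearAlgebra F public
  open Subspace

  private instance
    q-nonTrivial : ℕ.NonTrivial q
    q-nonTrivial = FiniteField.order-nonTrivial F
    q-nonZero : ℕ.NonZero q
    q-nonZero = ℕ.nonTrivial⇒nonZero q

  infixr 9 q^_
  q^_ : ℕ → ℤ
  q^ e = (+ q) ^ e

  pos-^ : ∀ e → + (q ℕ.^ e) ≡ q^ e
  pos-^ zero    = refl
  pos-^ (suc e) = trans (ℤ.pos-* q (q ℕ.^ e)) (cong (+ q *_) (pos-^ e))

  -- Dimensions are never compared through bases: subspaces are counted, and the exponents are read
  -- off from their sizes by this and the next lemma.
  q^-cancel-≤ : ∀ {d e} → q^ d ℤ.≤ q^ e → d ≤ e
  q^-cancel-≤ {d} {e} le = ℕ.≮⇒≥ λ e<d → ℕ.<⇒≱ (ℕ.^-monoʳ-< q (ℕ.nonTrivial⇒n>1 q) e<d)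
    (ℤ.drop‿+≤+ (subst₂ ℤ._≤_ (sym (pos-^ d)) (sym (pos-^ e)) le))

  q^-injective : ∀ {d e} → q^ d ≡ q^ e → d ≡ e
  q^-injective {d} {e} eq =
    ℕ.≤-antisym (q^-cancel-≤ {d} {e} (ℤ.≤-reflexive eq)) (q^-cancel-≤ {e} {d} (ℤ.≤-reflexive (sym eq)))

  q^-nonNegative : ∀ e → ℤ.NonNegative (q^ e)
  q^-nonNegative e = subst ℤ.NonNegative (pos-^ e) (ℤ.nonNegative (ℤ.+≤+ ℕ.z≤n))

  q^-nonZero : ∀ e → ℤ.NonZero (q^ e)
  q^-nonZero e = subst ℤ.NonZero (pos-^ e) (ℕ.m^n≢0 q e)

  size-cong : (U W : Subspace k) → (∀ {u} → Mem U u → Mem W u) → (∀ {u} → Mem W u → Mem U u) → size U ≡ size W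
  size-cong {k} U W to from = ∑-cong (space k) λ u → ⟦⟧-cong (mem? U u) (mem? W u) to from

  size-mono : (U W : Subspace k) → (∀ {u} → Mem U u → Mem W u) → size U ℤ.≤ size W
  size-mono {k} U W U⊆W = ∑-mono-≤ (space k) λ u → le (mem? U u) (mem? W u) U⊆W
    where
    le : ∀ {P Q : Set} (P? : Dec P) (Q? : Dec Q) → (P → Q) → ⟦ P? ⟧ ℤ.≤ ⟦ Q? ⟧
    le (no  _) Q?      _   = 0≤⟦⟧ Q?
    le (yes _) (yes _) _   = ℤ.≤-refl
    le (yes p) (no ¬q) p→q = contradiction (p→q p) ¬q

  -- The difference of the two indicator functions is nonnegative and sums to 0, hence vanishes at
  -- every vector.
  size≡⇒⊇ : (U W : Subspace k) → (∀ {u} → Mem U u → Mem W u) → size U ≡ size W → ∀ {u} → Mem W u → Mem U u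
  size≡⇒⊇ {k} U W U⊆W eq {u} u∈W with mem? U u
  ... | yes u∈U = u∈U
  ... | no  u∉U = contradiction (∑≡0 (space k) diff diff≥0 ∑diff≡0 (∈-elems (finiteSpace k) u))
                    λ diff≡0 → contradiction (trans (sym one) diff≡0) λ ()
    where
    diff : Vec K k → ℤ
    diff u = ⟦ mem? W u ⟧ + - ⟦ mem? U u ⟧
    diff≥0 : ∀ u → 0ℤ ℤ.≤ diff u
    diff≥0 u with mem? W u | mem? U u
    ... | yes _  | yes _  = ℤ.≤-refl
    ... | yes _  | no  _  = ℤ.+≤+ ℕ.z≤n
    ... | no  u∉ | yes u∈ = contradiction (U⊆W u∈) u∉
    ... | no  _  | no  _  = ℤ.≤-refl
    ∑diff≡0 : ∑ (space k) diff ≡ 0ℤ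
    ∑diff≡0 = begin
      ∑ (space k) diff                                   ≡⟨ ∑-+ (space k) _ _ ⟩
      size W + (∑[ u ← space k ] - ⟦ mem? U u ⟧)          ≡⟨ cong (λ s → size W + s)
          (trans (∑-cong (space k) λ u → sym (ℤ.-1*i≡-i _)) (trans (∑-*ˡ (- 1ℤ) (space k) _) (ℤ.-1*i≡-i _))) ⟩
      size W + - size U                                   ≡⟨ cong (λ s → size W + - s) eq ⟩
      size W + - size W                                   ≡⟨ ℤ.+-inverseʳ (size W) ⟩
      0ℤ                                                  ∎
    one : diff u ≡ 1ℤ
    one = cong₂ (λ a b → a + - b) (⟦⟧-true (mem? W u) u∈W) (⟦⟧-false (mem? U u) u∉U)

  adjoin : Subspace k → Vec K k → Subspace k
  adjoin U v = record
    { Mem    = λ u → ∃[ a ] Mem U (u +[ a ] v)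
    ; mem?   = λ u → ∃? finiteK λ a → mem? U (u +[ a ] v)
    ; 𝟎∈     = 0# , subst (Mem U) (sym (+[0] 𝟎 v)) (𝟎∈ U)
    ; closed = λ b (a , u∈) (c , w∈) →
        a ⊹ b · c , subst (Mem U) (sym (+[]-distrib _ _ v a b c)) (closed U b u∈ w∈)
    }

  origin : Subspace k
  origin {k} = record
    { Mem    = _≡ 𝟎
    ; mem?   = λ u → Finite._≟_ (finiteSpace k) u 𝟎
    ; 𝟎∈     = refl
    ; closed = λ { a refl refl → +[]𝟎 𝟎 a }
    }

  span : Mat n k → Subset n → Subspace k
  span []      []            = origin
  span (v ∷ V) (outside ∷ T) = span V T
  span (v ∷ V) (inside ∷ T)  = adjoin (span V T) v

  conf : Mat n k → Conf n
  conf []      = _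
  conf (v ∷ V) = List.map (λ T → does (mem? (span V T) v)) (subsets _) , conf V

  adjoin⁺ : (U : Subspace k) {v u : Vec K k} → Mem U u → Mem (adjoin U v) u
  adjoin⁺ U u∈ = 0# , subst (Mem U) (sym (+[0] _ _)) u∈

  self∈adjoin : (U : Subspace k) (v : Vec K k) → Mem (adjoin U v) v
  self∈adjoin U v = ⊖ 1# , subst (Mem U)
    (sym (trans (cong (_+[ ⊖ 1# ] v) (sym (𝟎+[1] v))) (+[]-cancel 𝟎 v (K.-‿inverseʳ 1#)))) (𝟎∈ U)

  adjoin-least : (U W : Subspace k) {v : Vec K k} → (∀ {u} → Mem U u → Mem W u) → Mem W v →
                 ∀ {u} → Mem (adjoin U v) u → Mem W u
  adjoin-least U W U⊆W v∈ (a , u∈) = shift W a v∈ (U⊆W u∈)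

  generator : (V : Mat n k) {T : Subset n} {j : Fin n} → j ∈ T → Mem (span V T) (lookup V j)
  generator (v ∷ V) here                           = self∈adjoin (span V _) v
  generator (v ∷ V) {outside ∷ T} (there j∈) = generator V j∈
  generator (v ∷ V) {inside ∷ T}  (there j∈) = adjoin⁺ (span V T) (generator V j∈)

  span-least : (V : Mat n k) (T : Subset n) (W : Subspace k) →
               (∀ {j} → j ∈ T → Mem W (lookup V j)) → ∀ {u} → Mem (span V T) u → Mem W u
  span-least []      []            W gen refl = 𝟎∈ W
  span-least (v ∷ V) (outside ∷ T) W gen = span-least V T W (gen ∘ there)
  span-least (v ∷ V) (inside ∷ T)  W gen = adjoin-least (span V T) W (span-least V T W (gen ∘ there)) (gen here)

  span-mono : (V : Mat n k) {S T : Subset n} → S ⊆ T → ∀ {u} → Mem (span V S) u → Mem (span V T) u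
  span-mono V {S} {T} S⊆T = span-least V S (span V T) (generator V ∘ S⊆T)

  coefficients-in : (U : Subspace k) (v : Vec K k) → Mem U v → ∀ u →
                    (∑[ a ← elements ] ⟦ mem? U (u +[ a ] v) ⟧) ≡ + q * ⟦ mem? U u ⟧
  coefficients-in U v v∈ u = trans (∑-cong elements λ a →
    ⟦⟧-cong (mem? U (u +[ a ] v)) (mem? U u) (shift U a v∈) (λ u∈ → closed U a u∈ v∈)) (∑-const _)

  coefficients-out : (U : Subspace k) (v : Vec K k) → ¬ Mem U v → ∀ u →
                     (∑[ a ← elements ] ⟦ mem? U (u +[ a ] v) ⟧) ≡ ⟦ mem? (adjoin U v) u ⟧
  coefficients-out U v v∉ u = ∑-unique finiteK (λ a → mem? U (u +[ a ] v)) (mem? (adjoin U v) u)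
      (coefficient-unique U v∉)

  adjoin-mem : (U : Subspace k) {v : Vec K k} → Mem U v → ∀ {u} → Mem (adjoin U v) u → Mem U u
  adjoin-mem U v∈ = adjoin-least U U id v∈

  size-adjoin-in : (U : Subspace k) (v : Vec K k) → Mem U v → size (adjoin U v) ≡ size U
  size-adjoin-in U v v∈ = size-cong (adjoin U v) U (adjoin-mem U v∈) (adjoin⁺ U)

  -- Every vector of the larger space determines its coefficient a uniquely, and the vectors
  -- belonging to one a form a translate of U.
  size-adjoin-out : (U : Subspace k) (v : Vec K k) → ¬ Mem U v → size (adjoin U v) ≡ + q * size U
  size-adjoin-out {k} U v v∉ = begin
    size (adjoin U v)
      ≡⟨ ∑-cong (space k) (coefficients-out U v v∉) ⟨
    (∑[ u ← space k ] ∑[ a ← elements ] ⟦ mem? U (u +[ a ] v) ⟧)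
      ≡⟨ ∑-swap (space k) elements _ ⟩
    (∑[ a ← elements ] ∑[ u ← space k ] ⟦ mem? U (u +[ a ] v) ⟧)
      ≡⟨ ∑-cong elements (λ a → ∑-translate v a λ u → ⟦ mem? U u ⟧) ⟩
    (∑[ a ← elements ] size U)
      ≡⟨ ∑-const (size U) ⟩
    + q * size U ∎

  size-origin : size (origin {k}) ≡ 1ℤ
  size-origin {k} = trans (∑-cong (space k) λ u → ⟦⟧-cong (Finite._≟_ (finiteSpace k) u 𝟎)
    (Finite._≟_ (finiteSpace k) 𝟎 u) sym sym) (Finite.once (finiteSpace k) 𝟎)

  entry-conf : (v : Vec K k) (V : Mat n k) (T : Subset n) →
               entry (subsets n) (proj₁ (conf (v ∷ V))) T ≡ does (mem? (span V T) v)
  entry-conf v V T = entry-map (λ T → does (mem? (span V T) v)) (∈-subsets T)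

  size-span : (V : Mat n k) (T : Subset n) → size (span V T) ≡ q^ rank (conf V) T
  size-span {k = k} [] []         = size-origin {k}
  size-span (v ∷ V) (outside ∷ T) = size-span V T
  size-span (v ∷ V) (inside ∷ T)  rewrite entry-conf v V T with mem? (span V T) v
  ... | yes v∈ = trans (size-adjoin-in (span V T) v v∈) (size-span V T)
  ... | no  v∉ = trans (size-adjoin-out (span V T) v v∉) (cong (+ q *_) (size-span V T))

  span-∪ : (V : Mat n k) (S T : Subset n) → size (span V (S ∪ T)) ≡ size (span V S ⊞ span V T)
  span-∪ V S T = size-cong (span V (S ∪ T)) (span V S ⊞ span V T)
    (span-least V (S ∪ T) (span V S ⊞ span V T) gen)
    λ (w , w∈T , u+w∈S) → shift (span V (S ∪ T)) 1# (span-mono V (Subset.q⊆p∪q S T) w∈T)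
      (span-mono V (Subset.p⊆p∪q {p = S} T) u+w∈S)
    where
    self-cancel : ∀ v → v +[ 1# ] (𝟎 +[ ⊖ 1# ] v) ≡ 𝟎
    self-cancel v = begin
      v +[ 1# ] (𝟎 +[ ⊖ 1# ] v)               ≡⟨ cong (_+[ 1# ] (𝟎 +[ ⊖ 1# ] v)) (𝟎+[1] v) ⟨
      𝟎 +[ 1# ] v +[ 1# ] (𝟎 +[ ⊖ 1# ] v)     ≡⟨ +[]-distrib 𝟎 𝟎 v 1# 1# (⊖ 1#) ⟨
      𝟎 +[ 1# ] 𝟎 +[ 1# ⊹ 1# · ⊖ 1# ] v       ≡⟨ cong₂ (λ u c → u +[ c ] v) (+[]𝟎 𝟎 1#)
                                                   (trans (cong (1# ⊹_) (K.*-identityˡ _)) (K.-‿inverseʳ 1#)) ⟩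
      𝟎 +[ 0# ] v                             ≡⟨ +[0] 𝟎 v ⟩
      𝟎                                       ∎
    gen : ∀ {j} → j ∈ S ∪ T → Mem (span V S ⊞ span V T) (lookup V j)
    gen {j} j∈ with Subset.x∈p∪q⁻ S T j∈
    ... | inj₁ j∈S = 𝟎 , 𝟎∈ (span V T) , subst (Mem (span V S)) (sym (+[]𝟎 _ _)) (generator V j∈S)
    ... | inj₂ j∈T = 𝟎 +[ ⊖ 1# ] lookup V j , scaled (span V T) (⊖ 1#) (generator V j∈T) ,
      subst (Mem (span V S)) (sym (self-cancel (lookup V j))) (𝟎∈ (span V S))

  -- If adding column j leaves the rank unchanged, the two nested spans have equal size and
  -- therefore coincide.
  closure-sound : (V : Mat n k) (T : Subset n) {j : Fin n} →
                  j ∈ closure (conf V) T → Mem (span V T) (lookup V j)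
  closure-sound V T {j} j∈ = size≡⇒⊇ (span V T) (span V (T ∪ ⁅ j ⁆)) (span-mono V (Subset.p⊆p∪q ⁅ j ⁆))
      (trans (size-span V T) (trans (cong q^_ (sym r≡)) (sym (size-span V (T ∪ ⁅ j ⁆)))))
      (generator V (Subset.q⊆p∪q T ⁅ j ⁆ (Subset.x∈⁅x⁆ j)))
    where
    r≡ : rank (conf V) (T ∪ ⁅ j ⁆) ≡ rank (conf V) T
    r≡ = does-true (rank (conf V) (T ∪ ⁅ j ⁆) ℕ.≟ rank (conf V) T)
      (trans (sym (Vec.lookup∘tabulate _ j)) (Vec.[]=⇒lookup j∈))
      where
      does-true : {P : Set} (P? : Dec P) → does P? ≡ true → P
      does-true (yes p) _ = p

  closure-complete : (V : Mat n k) (T : Subset n) {j : Fin n} →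
                     Mem (span V T) (lookup V j) → j ∈ closure (conf V) T
  closure-complete V T {j} v∈ = Vec.lookup⇒[]= j _ (trans (Vec.lookup∘tabulate _ j)
    (dec-true (rank (conf V) (T ∪ ⁅ j ⁆) ℕ.≟ rank (conf V) T) (q^-injective
      (trans (sym (size-span V (T ∪ ⁅ j ⁆))) (trans (size-cong (span V (T ∪ ⁅ j ⁆)) (span V T)
        (span-least V (T ∪ ⁅ j ⁆) (span V T) gen) (span-mono V (Subset.p⊆p∪q ⁅ j ⁆))) (size-span V T))))))
    where
    gen : ∀ {i} → i ∈ T ∪ ⁅ j ⁆ → Mem (span V T) (lookup V i)
    gen i∈ with Subset.x∈p∪q⁻ T ⁅ j ⁆ i∈
    ... | inj₁ i∈T = generator V i∈T
    ... | inj₂ i∈j rewrite Subset.x∈⁅y⁆⇒x≡y j i∈j = v∈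

  Flat : Mat n k → Subset n → Set
  Flat V T = ∀ {j} → Mem (span V T) (lookup V j) → j ∈ T

  span-closure : (V : Mat n k) (T : Subset n) {u : Vec K k} →
                 Mem (span V (closure (conf V) T)) u → Mem (span V T) u
  span-closure V T = span-least V _ (span V T) (closure-sound V T)

  closure-flat : (V : Mat n k) (T : Subset n) → Flat V (closure (conf V) T)
  closure-flat V T v∈ = closure-complete V T (span-closure V T v∈)

  span-closure⁻ : (V : Mat n k) (T : Subset n) {u : Vec K k} →
                  Mem (span V T) u → Mem (span V (closure (conf V) T)) u
  span-closure⁻ V T = span-mono V λ j∈ → closure-complete V T (generator V j∈)

  ∩-flat : (V : Mat n k) {S T : Subset n} → Flat V S → Flat V T → Flat V (S ∩ T)
  ∩-flat V {S} {T} S-flat T-flat v∈ = Subset.x∈p∩q⁺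
    (S-flat (span-mono V (Subset.p∩q⊆p S T) v∈) , T-flat (span-mono V (Subset.p∩q⊆q S T) v∈))

  -- If S exceeds the flat T by one element a only, then a vector of span S is
  -- a multiple of the column a plus a vector of span (S ∩ T) ≤ span T.
  span-∩-excess : (V : Mat n k) {S T : Subset n} → Flat V T → excess S T ≤ 1 →
                  ∀ {u} → Mem (span V S) u → Mem (span V T) u → Mem (span V (S ∩ T)) u
  span-∩-excess V {S} {T} T-flat ≤1 u∈S u∈T with excess≤1 S T ≤1
  ... | inj₁ S⊆T = span-mono V (λ j∈ → Subset.x∈p∩q⁺ (j∈ , S⊆T j∈)) u∈S
  ... | inj₂ (a , a∈S , a∉T , only) = conclude (span-least V S (adjoin (span V (S ∩ T)) (lookup V a)) gen u∈S) u∈T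
    where
    gen : ∀ {j} → j ∈ S → Mem (adjoin (span V (S ∩ T)) (lookup V a)) (lookup V j)
    gen j∈ with only j∈
    ... | inj₁ refl = self∈adjoin (span V (S ∩ T)) _
    ... | inj₂ j∈T  = adjoin⁺ (span V (S ∩ T)) (generator V (Subset.x∈p∩q⁺ (j∈ , j∈T)))
    conclude : ∀ {u} → Mem (adjoin (span V (S ∩ T)) (lookup V a)) u → Mem (span V T) u → Mem (span V (S ∩ T)) u
    conclude {u} (c , u+cv∈) u∈T with c ≟ᴷ 0#
    ... | yes refl = subst (Mem (span V (S ∩ T))) (+[0] u _) u+cv∈
    -- Both u and u + c v lie in the span of T, where v is column a. Hence so does v, and flatness
    -- puts a into T.
    ... | no  c≢0  = contradiction (T-flat (unscale (span V T) c≢0 (shift (span V T) 1# u∈T (subst (Mem (span V T))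
        (trans (cong (_+[ c ] lookup V a) (sym (𝟎+[1] u))) (+[]-comm 𝟎 u _ 1# c))
            (span-mono V (Subset.p∩q⊆q S T) u+cv∈))))) a∉T

  span-∩ : (V : Mat n k) {S T : Subset n} → Flat V S → Flat V T → Close S T →
           ∀ {u} → Mem (span V S) u → Mem (span V T) u → Mem (span V (S ∩ T)) u
  span-∩ V         S-flat T-flat (inj₁ ≤1) u∈S u∈T = span-∩-excess V T-flat ≤1 u∈S u∈T
  span-∩ V {S} {T} S-flat T-flat (inj₂ ≤1) u∈S u∈T =
    subst (λ R → Mem (span V R) _) (Subset.∩-comm T S) (span-∩-excess V S-flat ≤1 u∈T u∈S)

  module _ (n≤5 : n ≤ 5) (V : Mat n k) where

    InBoth : Subset n × Subset n → Vec K k → Set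
    InBoth (T , U) u = Mem (span V T) u × Mem (span V U) u

    meet-flat : ∀ S ((T , U) : Subset n × Subset n) → Flat V S → Flat V T → Flat V U →
                Flat V (proj₁ (meet S (T , U))) × Flat V (proj₂ (meet S (T , U)))
    meet-flat S (T , U) fS fT fU with close? S T | close? S U
    ... | yes _ | _     = ∩-flat V fS fT , fU
    ... | no  _ | yes _ = ∩-flat V fS fU , fT
    ... | no  _ | no  _ = ∩-flat V fT fU , fS

    meet-sound : ∀ S TU {u} → InBoth (meet S TU) u → Mem (span V S) u × InBoth TU u
    meet-sound S (T , U) (u∈ , u∈′) with close? S T | close? S U
    ... | yes _ | _     = span-mono V (Subset.p∩q⊆p S T) u∈ , span-mono V (Subset.p∩q⊆q S T) u∈ , u∈′
    ... | no  _ | yes _ = span-mono V (Subset.p∩q⊆p S U) u∈ , u∈′ , span-mono V (Subset.p∩q⊆q S U) u∈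
    ... | no  _ | no  _ = u∈′ , span-mono V (Subset.p∩q⊆p T U) u∈ , span-mono V (Subset.p∩q⊆q T U) u∈

    meet-complete : ∀ S ((T , U) : Subset n × Subset n) → Flat V S → Flat V T → Flat V U →
                    ∀ {u} → Mem (span V S) u → InBoth (T , U) u → InBoth (meet S (T , U)) u
    meet-complete S (T , U) fS fT fU u∈S (u∈T , u∈U) with close? S T | close? S U
    ... | yes c  | _      = span-∩ V fS fT c u∈S u∈T , u∈U
    ... | no  _  | yes c  = span-∩ V fS fU c u∈S u∈U , u∈T
    ... | no ¬ST | no ¬SU with close-pair n≤5 S T U
    ... | inj₁ c        = contradiction c ¬ST
    ... | inj₂ (inj₁ c) = contradiction c ¬SU
    ... | inj₂ (inj₂ c) = span-∩ V fT fU c u∈T u∈U , u∈S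

    meets-flat : ∀ Ts → Flat V (proj₁ (meets (conf V) Ts)) × Flat V (proj₂ (meets (conf V) Ts))
    meets-flat []       = (λ _ → Subset.∈⊤) , (λ _ → Subset.∈⊤)
    meets-flat (T ∷ Ts) = meet-flat _ _ (closure-flat V T) (proj₁ (meets-flat Ts)) (proj₂ (meets-flat Ts))

    meets-sound : ∀ Ts {u} → InBoth (meets (conf V) Ts) u → Mem (span V full) u × All (λ T → Mem (span V T) u) Ts
    meets-sound []       (u∈ , _) = u∈ , []
    meets-sound (T ∷ Ts) u∈ with meet-sound (closure (conf V) T) (meets (conf V) Ts) u∈
    ... | u∈T , u∈Ts with meets-sound Ts u∈Ts
    ... | u∈full , all = u∈full , span-closure V T u∈T ∷ all

    meets-complete : ∀ Ts {u} → Mem (span V full) u → All (λ T → Mem (span V T) u) Ts → InBoth (meets (conf V) Ts) u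
    meets-complete []       u∈ []          = u∈ , u∈
    meets-complete (T ∷ Ts) u∈ (u∈T ∷ all) = meet-complete _ _ (closure-flat V T) (proj₁ (meets-flat Ts))
      (proj₂ (meets-flat Ts)) (span-closure⁻ V T u∈T) (meets-complete Ts u∈ all)

    -- The modular law gives the dimension.
    count-meets : ∀ Ts → (∑[ u ← space k ] ⟦ mem? (span V full) u ×-dec All.all? (λ T → mem? (span V T) u) Ts ⟧) ≡
                         q^ dimension (conf V) Ts
    count-meets Ts = trans (∑-cong (space k) λ u → ⟦⟧-cong
        (mem? (span V full) u ×-dec All.all? (λ T → mem? (span V T) u) Ts)
        (mem? (span V T) u ×-dec mem? (span V U) u)
        (λ (u∈ , all) → meets-complete Ts u∈ all) (meets-sound Ts))
      (solve-size (size-⊓-⊞ (span V T) (span V U)))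
      where
      μ = conf V
      T = proj₁ (meets μ Ts)
      U = proj₂ (meets μ Ts)
      s = size (span V T ⊓ span V U)
      s≥1 : 1ℤ ℤ.≤ s
      s≥1 = subst (ℤ._≤ s) (size-origin {k}) (size-mono origin (span V T ⊓ span V U)
        λ { refl → 𝟎∈ (span V T ⊓ span V U) })
      solve-size : size (span V T) * size (span V U) ≡ s * size (span V T ⊞ span V U) → s ≡ q^ dimension μ Ts
      solve-size eq = ℤ.*-cancelʳ-≡ s _ (q^ rank μ (T ∪ U)) {{q^-nonZero (rank μ (T ∪ U))}} (begin
        s * q^ rank μ (T ∪ U)                       ≡⟨ eq′ ⟨
        q^ (rank μ T ℕ.+ rank μ U)                  ≡⟨ cong q^_ (ℕ.m∸n+n≡m r≤) ⟨
        q^ (dimension μ Ts ℕ.+ rank μ (T ∪ U))      ≡⟨ ℤ.^-distribˡ-+-* (+ q) (dimension μ Ts) _ ⟩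
        q^ dimension μ Ts * q^ rank μ (T ∪ U)       ∎)
        where
        eq′ : q^ (rank μ T ℕ.+ rank μ U) ≡ s * q^ rank μ (T ∪ U)
        eq′ = begin
          q^ (rank μ T ℕ.+ rank μ U)             ≡⟨ ℤ.^-distribˡ-+-* (+ q) (rank μ T) _ ⟩
          q^ rank μ T * q^ rank μ U              ≡⟨ cong₂ _*_ (size-span V T) (size-span V U) ⟨
          size (span V T) * size (span V U)      ≡⟨ eq ⟩
          s * size (span V T ⊞ span V U)         ≡⟨ cong (s *_) (trans (sym (span-∪ V T U)) (size-span V (T ∪ U))) ⟩
          s * q^ rank μ (T ∪ U)                  ∎
        -- The intersection contains 0, so its size s is at least 1, and `eq′` bounds the power for
        -- T ∪ U by the product of the other two.
        r≤ : rank μ (T ∪ U) ≤ rank μ T ℕ.+ rank μ U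
        r≤ = q^-cancel-≤ (subst₂ ℤ._≤_ (ℤ.*-identityˡ _) (sym eq′)
          (ℤ.*-monoʳ-≤-nonNeg (q^ rank μ (T ∪ U)) {{q^-nonNegative (rank μ (T ∪ U))}} s≥1))

-- Counting configurations of at most six columns

infixl 6 _:+_
infixl 7 _:*_

-- Integer polynomials kept as syntax: `value` respects sums and products by definition, so the
-- counting arguments need no polynomial arithmetic. Coefficients are extracted only at the very
-- end, by `normalForm`.
data Expr : Set where
  const     : ℤ → Expr
  𝐱         : Expr
  _:+_ _:*_ : Expr → Expr → Expr

value : Expr → ℤ → ℤ
value (const c) x = c
value 𝐱         x = x
value (e :+ f)  x = value e x + value f x
value (e :* f)  x = value e x * value f x

infixr 8 _:^_
_:^_ : Expr → ℕ → Expr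
e :^ zero  = const 1ℤ
e :^ suc n = e :* e :^ n

value-:^ : ∀ e n x → value (e :^ n) x ≡ value e x ^ n
value-:^ e zero    x = refl
value-:^ e (suc n) x = cong (value e x *_) (value-:^ e n x)

𝐪 : Expr
𝐪 = const 1ℤ :+ 𝐱

∑-expr : List A → (A → Expr) → Expr
∑-expr []       f = const 0ℤ
∑-expr (a ∷ as) f = f a :+ ∑-expr as f

value-∑ : (as : List A) (f : A → Expr) (x : ℤ) → value (∑-expr as f) x ≡ (∑[ a ← as ] value (f a) x)
value-∑ []       f x = refl
value-∑ (a ∷ as) f x = cong (λ s → value (f a) x + s) (value-∑ as f x)

-- Here 𝐱 stands for q - 1, and y will stand for qᵏ.
Expr[y] : Set
Expr[y] = List Expr

value[y] : Expr[y] → ℤ → ℤ → ℤ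
value[y] []      x y = 0ℤ
value[y] (e ∷ p) x y = value e x + y * value[y] p x y

infixl 6 _:⊕_
infixr 7 _:•_

_:⊕_ : Expr[y] → Expr[y] → Expr[y]
[]      :⊕ q       = q
p       :⊕ []      = p
(e ∷ p) :⊕ (f ∷ q) = (e :+ f) ∷ (p :⊕ q)

_:•_ : Expr → Expr[y] → Expr[y]
e :• p = List.map (e :*_) p

value-:⊕ : ∀ p q x y → value[y] (p :⊕ q) x y ≡ value[y] p x y + value[y] q x y
value-:⊕ []      q       x y = sym (ℤ.+-identityˡ _)
value-:⊕ (e ∷ p) []      x y = sym (ℤ.+-identityʳ _)
value-:⊕ (e ∷ p) (f ∷ q) x y = trans (cong (λ s → value e x + value f x + y * s) (value-:⊕ p q x y))
  (lemma (value e x) (value f x) y _ _)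
  where
  lemma : ∀ e f y p q → e + f + y * (p + q) ≡ e + y * p + (f + y * q)
  lemma = solve-∀

value-:• : ∀ e p x y → value[y] (e :• p) x y ≡ value e x * value[y] p x y
value-:• e []      x y = sym (ℤ.*-zeroʳ (value e x))
value-:• e (f ∷ p) x y = trans (cong (λ s → value e x * value f x + y * s) (value-:• e p x y))
  (lemma (value e x) (value f x) y _)
  where
  lemma : ∀ e f y p → e * f + y * (e * p) ≡ e * (f + y * p)
  lemma = solve-∀

private
  restrict : {P Q : Set} (P? : Dec P) (Q? : Dec Q) {R : Set} (R? : Dec R) →
             ⟦ P? ×-dec (Q? ×-dec R?) ⟧ ≡ ⟦ Q? ⟧ * ⟦ P? ×-dec R? ⟧
  restrict P? Q? R? = trans (bit-∧ (does P?) _) (trans (cong (⟦ P? ⟧ *_) (bit-∧ (does Q?) (does R?)))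
    (trans (lemma ⟦ P? ⟧ ⟦ Q? ⟧ ⟦ R? ⟧) (cong (⟦ Q? ⟧ *_) (sym (bit-∧ (does P?) (does R?))))))
    where
    lemma : ∀ p q r → p * (q * r) ≡ q * (p * r)
    lemma = solve-∀

module _ (cnt : List B → Expr) where

  -- A sum over u of f applied to the table of truth values of the predicates
  -- P b u, by inclusion-exclusion from the sizes of the intersections.
  tableSum : List B → (List Bool → Expr[y]) → List B → Expr[y]
  -- Here `acc` lists the predicates required to hold; those required to fail were accounted for by
  -- subtraction, and `f` has absorbed all the truth values chosen on the way.
  tableSum []       f acc = cnt acc :• f []
  tableSum (b ∷ bs) f acc =
    tableSum bs (f ∘ (true ∷_)) (b ∷ acc) :⊕
    (tableSum bs (f ∘ (false ∷_)) acc :⊕ const (- 1ℤ) :• tableSum bs (f ∘ (false ∷_)) (b ∷ acc))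

  module _ {x y : ℤ} (us : List A) {Q : A → Set} (Q? : ∀ u → Dec (Q u)) {P : B → A → Set} (P? : ∀ b u → Dec (P b u))
           (cnt-correct : ∀ bs → (∑[ u ← us ] ⟦ Q? u ×-dec All.all? (λ b → P? b u) bs ⟧) ≡ value (cnt bs) x) where

    table : List B → A → List Bool
    table bs u = List.map (λ b → does (P? b u)) bs

    tableSum-correct : ∀ bs f acc →
      (∑[ u ← us ] ⟦ Q? u ×-dec All.all? (λ b → P? b u) acc ⟧ * value[y] (f (table bs u)) x y) ≡
      value[y] (tableSum bs f acc) x y
    tableSum-correct [] f acc = begin
      (∑[ u ← us ] ⟦ Q? u ×-dec All.all? (λ b → P? b u) acc ⟧ * value[y] (f []) x y)  ≡⟨ ∑-*ʳ _ us _ ⟩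
      (∑[ u ← us ] ⟦ Q? u ×-dec All.all? (λ b → P? b u) acc ⟧) * value[y] (f []) x y  ≡⟨ cong (_* _)
          (cnt-correct acc) ⟩
      value (cnt acc) x * value[y] (f []) x y                                        ≡⟨ value-:• (cnt acc)
          (f []) x y ⟨
      value[y] (cnt acc :• f []) x y                                                 ∎
    tableSum-correct (b ∷ bs) f acc = begin
      (∑[ u ← us ] ind acc u * val f (does (P? b u) ∷ table bs u))
        ≡⟨ ∑-cong us (λ u → trans (split (does (P? b u)) (ind acc u) (λ c → val f (c ∷ table bs u)))
             (sym (cong₂ (λ s t → s * val f (true ∷ table bs u) +
                 (ind acc u * val f (false ∷ table bs u) + - 1ℤ * (t * val f (false ∷ table bs u))))
               (restrict (Q? u) (P? b u) (All.all? (λ b → P? b u) acc))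
                   (restrict (Q? u) (P? b u) (All.all? (λ b → P? b u) acc))))) ⟩
      (∑[ u ← us ] ind (b ∷ acc) u * val f (true ∷ table bs u) +
          (ind acc u * val f (false ∷ table bs u) + - 1ℤ * (ind (b ∷ acc) u * val f (false ∷ table bs u))))
        ≡⟨ trans (∑-+ us w₁ (λ u → w₂ u + - 1ℤ * w₃ u))
            (cong (λ s → ∑ us w₁ + s)
            (trans (∑-+ us w₂ (λ u → - 1ℤ * w₃ u)) (cong (λ s → ∑ us w₂ + s) (∑-*ˡ (- 1ℤ) us w₃)))) ⟩
      (∑[ u ← us ] ind (b ∷ acc) u * val f (true ∷ table bs u)) +
      ((∑[ u ← us ] ind acc u * val f (false ∷ table bs u)) + - 1ℤ *
          (∑[ u ← us ] ind (b ∷ acc) u * val f (false ∷ table bs u)))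
        ≡⟨ cong₂ _+_ (tableSum-correct bs (f ∘ (true ∷_)) (b ∷ acc)) (cong₂ (λ s t → s + - 1ℤ * t)
             (tableSum-correct bs (f ∘ (false ∷_)) acc) (tableSum-correct bs (f ∘ (false ∷_)) (b ∷ acc))) ⟩
      value[y] t₁ x y + (value[y] t₂ x y + - 1ℤ * value[y] t₃ x y)
        ≡⟨ trans (value-:⊕ t₁ (t₂ :⊕ const (- 1ℤ) :• t₃) x y) (cong (λ s → value[y] t₁ x y + s)
             (trans (value-:⊕ t₂ (const (- 1ℤ) :• t₃) x y)
                 (cong (λ s → value[y] t₂ x y + s) (value-:• (const (- 1ℤ)) t₃ x y)))) ⟨
      value[y] (tableSum (b ∷ bs) f acc) x y ∎
      where
      ind : List B → A → ℤ
      ind acc u = ⟦ Q? u ×-dec All.all? (λ b → P? b u) acc ⟧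
      val : (List Bool → Expr[y]) → List Bool → ℤ
      val f t = value[y] (f t) x y
      w₁ w₂ w₃ : A → ℤ
      w₁ u = ind (b ∷ acc) u * val f (true ∷ table bs u)
      w₂ u = ind acc u * val f (false ∷ table bs u)
      w₃ u = ind (b ∷ acc) u * val f (false ∷ table bs u)
      t₁ = tableSum bs (f ∘ (true ∷_)) (b ∷ acc)
      t₂ = tableSum bs (f ∘ (false ∷_)) acc
      t₃ = tableSum bs (f ∘ (false ∷_)) (b ∷ acc)
      split : ∀ c i (g : Bool → ℤ) → i * g c ≡ bit c * i * g true + (i * g false + - 1ℤ * (bit c * i * g false))
      split true  i g = lemma i (g true) (g false)
        where
        lemma : ∀ i t f → i * t ≡ 1ℤ * i * t + (i * f + - 1ℤ * (1ℤ * i * f))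
        lemma = solve-∀
      split false i g = lemma i (g true) (g false)
        where
        lemma : ∀ i t f → i * f ≡ 0ℤ * i * t + (i * f + - 1ℤ * (0ℤ * i * f))
        lemma = solve-∀

-- The sum of f over all extensions of a configuration by one column: either
-- in the span of the others, or one of the y - q^rank remaining columns.
extensions : Conf n → (Conf (suc n) → Expr[y]) → Expr[y]
extensions {n} μ f = tableSum (λ Ts → 𝐪 :^ dimension μ Ts) (subsets n) (λ t → f (t , μ)) [] :⊕
  -- Prepending a zero coefficient multiplies by y, so this is (y - q^rank) g. A column outside the
  -- span of all the others lies in no smaller span either, which is why its table is constantly
  -- `false`.
  ((const 0ℤ ∷ g) :⊕ const (- 1ℤ) :• 𝐪 :^ rank μ full :• g)
  where
  g : Expr[y]
  g = f (List.map (λ _ → false) (subsets n) , μ)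

-- The sum runs through all tables, including those that no columns over the given field have. There
-- `f` may take meaningless values, but above realised columns the coefficient of a table counts the
-- vectors having that table, and so is 0 for such a table.
configurations : (n : ℕ) → (Conf n → Expr[y]) → Expr[y]
configurations zero    f = f _
configurations (suc n) f = configurations n λ μ → extensions μ f

module Configurations {q : ℕ} (F : FiniteField q) where

  open Spans F public
  open Subspace

  x : ℤ
  x = + q - 1ℤ

  value-𝐪^ : ∀ e → value (𝐪 :^ e) x ≡ q^ e
  value-𝐪^ e = trans (value-:^ 𝐪 e x) (cong (_^ e) (lemma (+ q)))
    where
    lemma : ∀ q → 1ℤ + (q - 1ℤ) ≡ q
    lemma = solve-∀

  ∑-space-1 : ∀ k → (∑[ u ← space k ] 1ℤ) ≡ q^ k
  ∑-space-1 zero    = refl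
  ∑-space-1 (suc k) = trans (∑-vectors elements k _) (trans (∑-const _) (cong (+ q *_) (∑-space-1 k)))

  extensions-correct : n ≤ 5 → (V : Mat n k) (f : Conf (suc n) → Expr[y]) →
    (∑[ v ← space k ] value[y] (f (conf (v ∷ V))) x (q^ k)) ≡ value[y] (extensions (conf V) f) x (q^ k)
  extensions-correct {n} {k} n≤5 V f = begin
    (∑[ v ← space k ] val v)
      ≡⟨ ∑-cong (space k) (λ v → trans (split ⟦ in? v ⟧ (val v))
          (cong₂ _+_ (cong (_* val v) (unit v)) (outer v (in? v)))) ⟩
    (∑[ v ← space k ] ⟦ in? v ×-dec All.all? (λ T → mem? (span V T) v) [] ⟧ * val v + (1ℤ + - 1ℤ * ⟦ in? v ⟧) * G)
      ≡⟨ trans (∑-+ (space k) w₁ (λ v → w₂ v * G)) (cong (λ s → ∑ (space k) w₁ + s) (∑-*ʳ G (space k) w₂)) ⟩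
    (∑[ v ← space k ] ⟦ in? v ×-dec All.all? (λ T → mem? (span V T) v) [] ⟧ * val v) +
        (∑[ v ← space k ] 1ℤ + - 1ℤ * ⟦ in? v ⟧) * G
      ≡⟨ cong₂ (λ s t → s + t * G)
           (tableSum-correct (λ Ts → 𝐪 :^ dimension μ Ts) (space k) in? (λ T v → mem? (span V T) v)
             (λ Ts → trans (count-meets n≤5 V Ts) (sym (value-𝐪^ (dimension μ Ts)))) (subsets n) (λ t → f (t , μ)) [])
           (trans (∑-+ (space k) (λ _ → 1ℤ) (λ v → - 1ℤ * ⟦ in? v ⟧)) (cong₂ _+_ (∑-space-1 k)
             (trans (∑-*ˡ (- 1ℤ) (space k) _) (cong (- 1ℤ *_) (size-span V full))))) ⟩
    value[y] t x y + (y + - 1ℤ * q^ rank μ full) * G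
      ≡⟨ trans (value-:⊕ t _ x y)
          (cong (λ s → value[y] t x y + s)
          (trans (value-:⊕ (const 0ℤ ∷ g) (const (- 1ℤ) :• 𝐪 :^ rank μ full :• g) x y)
           (trans (cong (λ s → 0ℤ + y * G + s) (trans (value-:• (const (- 1ℤ)) (𝐪 :^ rank μ full :• g) x y)
               (cong (- 1ℤ *_) (trans (value-:• (𝐪 :^ rank μ full) g x y) (cong (_* G) (value-𝐪^ (rank μ full)))))))
             (lemma y G (q^ rank μ full))))) ⟨
    value[y] (extensions μ f) x y ∎
    where
    μ = conf V
    y = q^ k
    in? = mem? (span V full)
    val : Vec K k → ℤ
    val v = value[y] (f (conf (v ∷ V))) x y
    g = f (List.map (λ _ → false) (subsets n) , μ)
    G = value[y] g x y
    w₁ w₂ : Vec K k → ℤ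
    w₁ v = ⟦ in? v ×-dec All.all? (λ T → mem? (span V T) v) [] ⟧ * val v
    w₂ v = 1ℤ + - 1ℤ * ⟦ in? v ⟧
    h = (const 0ℤ ∷ g) :⊕ const (- 1ℤ) :• 𝐪 :^ rank μ full :• g
    t = tableSum (λ Ts → 𝐪 :^ dimension μ Ts) (subsets n) (λ t → f (t , μ)) []
    split : ∀ b a → a ≡ b * a + (1ℤ + - 1ℤ * b) * a
    split = solve-∀
    unit : ∀ v → ⟦ in? v ⟧ ≡ ⟦ in? v ×-dec All.all? (λ T → mem? (span V T) v) [] ⟧
    unit v = ⟦⟧-cong (in? v) (in? v ×-dec All.all? (λ T → mem? (span V T) v) []) (λ v∈ → v∈ , []) proj₁
    lemma : ∀ y G r → 0ℤ + y * G + - 1ℤ * (r * G) ≡ (y + - 1ℤ * r) * G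
    lemma = solve-∀
    no-table : ∀ v → ¬ Mem (span V full) v → (Ts : List (Subset n)) →
               List.map (λ T → does (mem? (span V T) v)) Ts ≡ List.map (λ _ → false) Ts
    no-table v v∉ []       = refl
    no-table v v∉ (T ∷ Ts) = cong₂ _∷_ (dec-false (mem? (span V T) v) (v∉ ∘ span-mono V (λ _ → Subset.∈⊤)))
        (no-table v v∉ Ts)
    outer : ∀ v (v∈? : Dec (Mem (span V full) v)) → (1ℤ + - 1ℤ * ⟦ v∈? ⟧) * val v ≡ (1ℤ + - 1ℤ * ⟦ v∈? ⟧) * G
    outer v (yes _)  = refl
    outer v (no v∉) = cong (λ t → (1ℤ + - 1ℤ * 0ℤ) * value[y] (f (t , μ)) x y) (no-table v v∉ (subsets n))

  -- The bound exceeds that of `extensions-correct` by one, since a new column is compared only with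
  -- the spans of the columns already chosen.
  configurations-correct : n ≤ 6 → (f : Conf n → Expr[y]) →
    (∑[ V ← vectors (space k) n ] value[y] (f (conf V)) x (q^ k)) ≡ value[y] (configurations n f) x (q^ k)
  configurations-correct {zero}      n≤6 f = ℤ.+-identityʳ _
  configurations-correct {suc n} {k} (ℕ.s≤s n≤5) f = begin
    (∑[ V ← vectors (space k) (suc n) ] value[y] (f (conf V)) x (q^ k))
      ≡⟨ trans (∑-vectors (space k) n _) (∑-swap (space k) (vectors (space k) n) _) ⟩
    (∑[ V ← vectors (space k) n ] ∑[ v ← space k ] value[y] (f (conf (v ∷ V))) x (q^ k))
      ≡⟨ ∑-cong (vectors (space k) n) (λ V → extensions-correct n≤5 V f) ⟩
    (∑[ V ← vectors (space k) n ] value[y] (extensions (conf V) f) x (q^ k))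
      ≡⟨ configurations-correct (ℕ.≤-trans n≤5 (ℕ.n≤1+n 5)) (λ μ → extensions μ f) ⟩
    value[y] (configurations (suc n) f) x (q^ k) ∎

-- Relations among columns and moments of the nullity

-- The indicator function of "the support is S" is the signed sum of those of
-- "the support is contained in T" over the pairs (sign , T).
signed : Subset n → List (ℤ × Subset n)
signed []            = (1ℤ , []) ∷ []
signed (outside ∷ S) = List.map (λ (s , T) → s , outside ∷ T) (signed S)
signed (inside ∷ S)  = List.map (λ (s , T) → s , inside ∷ T) (signed S) ++
                       List.map (λ (s , T) → - s , outside ∷ T) (signed S)

-- This is [n] = (qⁿ - 1) / x, written without division.
qNumber : ℕ → Expr
qNumber zero    = const 0ℤ
qNumber (suc n) = const 1ℤ :+ 𝐪 :* qNumber n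

-- The exponent of x that a row with support S contributes: nonzero relations come in orbits of size
-- x under scaling.
weight : Subset n → ℕ
weight []            = 0
weight (outside ∷ S) = weight S
weight (inside ∷ S)  = 1

-- The number of relations with support S, divided by x for nonempty S.
relationsE : Conf n → Subset n → Expr
relationsE μ S with weight S
... | zero  = const 1ℤ
... | suc _ = ∑-expr (signed S) λ (s , T) → const s :* qNumber (nullity μ T)

weights : Board m n → ℕ
weights []      = 0
weights (T ∷ S) = weight T ℕ.+ weights S

rowsE : Conf n → Board m n → Expr
rowsE μ []      = const 1ℤ
rowsE μ (T ∷ S) = relationsE μ T :* rowsE μ S

compress : (C : Subset n) → Vec A n → Vec A ∣ C ∣
compress []            []      = []
compress (outside ∷ C) (x ∷ v) = compress C v
compress (inside ∷ C)  (x ∷ v) = x ∷ compress C v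

skipped : Subset n → ℕ
skipped []            = 0
skipped (outside ∷ C) = suc (skipped C)
skipped (inside ∷ C)  = skipped C

shift[y] : ℕ → Expr[y] → Expr[y]
shift[y] zero    p = p
shift[y] (suc n) p = const 0ℤ ∷ shift[y] n p

value-shift : ∀ n p x y → value[y] (shift[y] n p) x y ≡ y ^ n * value[y] p x y
value-shift zero    p x y = sym (ℤ.*-identityˡ _)
value-shift (suc n) p x y = begin
  0ℤ + y * value[y] (shift[y] n p) x y  ≡⟨ ℤ.+-identityˡ _ ⟩
  y * value[y] (shift[y] n p) x y       ≡⟨ cong (y *_) (value-shift n p x y) ⟩
  y * (y ^ n * value[y] p x y)          ≡⟨ ℤ.*-assoc y _ _ ⟨
  y * y ^ n * value[y] p x y            ∎

-- The moments of the nullity of the matrices with support S, whose columns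
-- outside C vanish: the k-th moment is the value at y = qᵏ, divided by x^weights S.
momentsE : (C : Subset n) → Board m n → Expr[y]
momentsE C S = shift[y] (skipped C) (configurations ∣ C ∣ λ μ → rowsE μ (Vec.map (compress C) S) ∷ [])

coefficientE : Expr[y] → ℕ → Expr
coefficientE []      e       = const 0ℤ
coefficientE (a ∷ p) zero    = a
coefficientE (a ∷ p) (suc e) = coefficientE p e

-- Polynomials in y given by coefficient functions

horner : ℕ → (ℕ → ℤ) → ℤ → ℤ
horner zero    f y = 0ℤ
horner (suc N) f y = f 0 + y * horner N (f ∘ suc) y

horner-cong : ∀ N {f g : ℕ → ℤ} y → (∀ e → f e ≡ g e) → horner N f y ≡ horner N g y
horner-cong zero    y eq = refl
horner-cong (suc N) y eq = cong₂ (λ a b → a + y * b) (eq 0) (horner-cong N y (eq ∘ suc))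

horner-zero : ∀ N y → horner N (λ _ → 0ℤ) y ≡ 0ℤ
horner-zero zero    y = refl
horner-zero (suc N) y = trans (ℤ.+-identityˡ _) (trans (cong (y *_) (horner-zero N y)) (ℤ.*-zeroʳ y))

horner-linear : ∀ N c f g y → horner N (λ e → c * f e + g e) y ≡ c * horner N f y + horner N g y
horner-linear zero    c f g y = sym (trans (ℤ.+-identityʳ _) (ℤ.*-zeroʳ c))
horner-linear (suc N) c f g y = trans (cong (λ s → c * f 0 + g 0 + y * s) (horner-linear N c (f ∘ suc) (g ∘ suc) y))
  (lemma c (f 0) (g 0) y _ _)
  where
  lemma : ∀ c f g y s t → c * f + g + y * (c * s + t) ≡ c * (f + y * s) + (g + y * t)
  lemma = solve-∀

horner-∑ : ∀ N (as : List A) (w : A → ℤ) (f : A → ℕ → ℤ) y →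
           horner N (λ e → ∑[ a ← as ] w a * f a e) y ≡ (∑[ a ← as ] w a * horner N (f a) y)
horner-∑ N []       w f y = horner-zero N y
horner-∑ N (a ∷ as) w f y = trans (horner-linear N (w a) (f a) _ y)
    (cong (λ s → w a * horner N (f a) y + s) (horner-∑ N as w f y))

horner-δ : ∀ N d y → d < N → horner N (λ e → ⟦ d ℕ.≟ e ⟧) y ≡ y ^ d
horner-δ (suc N) zero    y d<N = trans (cong (λ s → 1ℤ + y * s) (horner-zero N y)) (cong (λ s → 1ℤ + s) (ℤ.*-zeroʳ y))
horner-δ (suc N) (suc d) y (ℕ.s≤s d<N) = trans (ℤ.+-identityˡ _) (cong (y *_)
  (trans (horner-cong N y λ e → ⟦⟧-cong (suc d ℕ.≟ suc e) (d ℕ.≟ e) ℕ.suc-injective (cong suc)) (horner-δ N d y d<N)))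

horner-value[y] : ∀ N p x y → List.length p ≤ N → horner N (λ e → value (coefficientE p e) x) y ≡ value[y] p x y
horner-value[y] N       []      x y _           = horner-zero N y
horner-value[y] (suc N) (a ∷ p) x y (ℕ.s≤s p≤N) = cong (λ s → value a x + y * s) (horner-value[y] N p x y p≤N)

n<m^n : ∀ m n → 1 < m → n < m ℕ.^ n
n<m^n m zero    1<m = ℕ.s≤s ℕ.z≤n
n<m^n m (suc n) 1<m = ℕ.<-≤-trans (ℕ.+-monoʳ-< 1 (n<m^n m n 1<m)) (ℕ.≤-trans
  (ℕ.≤-trans (ℕ.+-monoˡ-≤ (m ℕ.^ n) (ℕ.≤-trans (ℕ.s≤s ℕ.z≤n) (n<m^n m n 1<m)))
      (ℕ.≤-reflexive (cong (m ℕ.^ n ℕ.+_) (sym (ℕ.+-identityʳ _)))))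
  (ℕ.*-monoˡ-≤ (m ℕ.^ n) 1<m))

module Relations {q : ℕ} (F : FiniteField q) where

  open Configurations F public
  open Subspace

  -- A polynomial vanishing at all powers of q vanishes: its constant term is
  -- divisible by all of them.
  horner-injective : ∀ N f → (∀ k → horner N f (q^ k) ≡ 0ℤ) → ∀ {e} → e < N → f e ≡ 0ℤ
  horner-injective (suc N) f vanish {e} e<N = go e e<N
    where
    1<q = ℕ.nonTrivial⇒n>1 q {{FiniteField.order-nonTrivial F}}
    rest : ℕ → ℤ
    rest k = horner N (f ∘ suc) (q^ k)
    ∣f0∣ : ∀ k → ℤ.∣ f 0 ∣ ≡ q ℕ.^ k ℕ.* ℤ.∣ rest k ∣
    ∣f0∣ k = begin
      ℤ.∣ f 0 ∣                          ≡⟨ cong ℤ.∣_∣ (lemma (f 0) (q^ k * rest k)) ⟩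
      ℤ.∣ f 0 + q^ k * rest k + - (q^ k * rest k) ∣  ≡⟨ cong (λ s → ℤ.∣ s + - (q^ k * rest k) ∣) (vanish k) ⟩
      ℤ.∣ 0ℤ + - (q^ k * rest k) ∣       ≡⟨ cong ℤ.∣_∣ (ℤ.+-identityˡ (- (q^ k * rest k))) ⟩
      ℤ.∣ - (q^ k * rest k) ∣            ≡⟨ ℤ.∣-i∣≡∣i∣ (q^ k * rest k) ⟩
      ℤ.∣ q^ k * rest k ∣                ≡⟨ ℤ.∣i*j∣≡∣i∣*∣j∣ (q^ k) (rest k) ⟩
      ℤ.∣ q^ k ∣ ℕ.* ℤ.∣ rest k ∣        ≡⟨ cong (λ s → ℤ.∣ s ∣ ℕ.* ℤ.∣ rest k ∣) (pos-^ k) ⟨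
      q ℕ.^ k ℕ.* ℤ.∣ rest k ∣           ∎
      where
      lemma : ∀ a b → a ≡ a + b + - b
      lemma = solve-∀
    f0≡0 : f 0 ≡ 0ℤ
    -- Take k = |f 0|: then qᵏ divides f 0 and exceeds its absolute value, so f 0 must be 0.
    f0≡0 with ℤ.∣ rest ℤ.∣ f 0 ∣ ∣ in eq
    ... | zero  = ℤ.∣i∣≡0⇒i≡0
        (trans (∣f0∣ ℤ.∣ f 0 ∣) (trans (cong (q ℕ.^ ℤ.∣ f 0 ∣ ℕ.*_) eq) (ℕ.*-zeroʳ (q ℕ.^ ℤ.∣ f 0 ∣))))
    ... | suc r = contradiction (n<m^n q ℤ.∣ f 0 ∣ 1<q) (ℕ.≤⇒≯ (ℕ.≤-trans
      (ℕ.m≤m*n (q ℕ.^ ℤ.∣ f 0 ∣) (suc r))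
          (ℕ.≤-reflexive (sym (trans (∣f0∣ ℤ.∣ f 0 ∣) (cong (q ℕ.^ ℤ.∣ f 0 ∣ ℕ.*_) eq))))))
    go : ∀ e → e < suc N → f e ≡ 0ℤ
    go zero    _           = f0≡0
    go (suc e) (ℕ.s≤s e<N) = horner-injective N (f ∘ suc) (λ k → ℤ.*-cancelˡ-≡ (q^ k) _ _ {{q^-nonZero k}}
      (trans (sym (ℤ.+-identityˡ _)) (trans (cong (λ s → s + q^ k * rest k) (sym f0≡0))
          (trans (vanish k) (sym (ℤ.*-zeroʳ (q^ k))))))) e<N

  _≟ⱽ_ : DecidableEquality (Vec K k)
  _≟ⱽ_ {k} = Finite._≟_ (finiteSpace k)

  combine : Vec K k → Vec K n → Mat n k → Vec K k
  combine u []       []      = u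
  combine u (c ∷ cs) (v ∷ V) = combine (u +[ c ] v) cs V

  support : Vec K n → Subset n
  support = Vec.map λ c → not (does (c ≟ᴷ 0#))

  -- The inhomogeneous term u is there for the induction, in which fixing the first coefficient
  -- shifts it; the counts of matrices use u = 0.
  relations : Mat n k → Subset n → Vec K k → ℤ
  relations {n = n} V S u = ∑[ w ← space n ] ⟦ support w ≟ˢ S ⟧ * ⟦ combine u w V ≟ⱽ 𝟎 ⟧

  relations-∷ : (v : Vec K k) (V : Mat n k) (s : Bool) (S : Subset n) (u : Vec K k) →
    relations (v ∷ V) (s ∷ S) u ≡ (∑[ a ← elements ] ⟦ not (does (a ≟ᴷ 0#)) Bool.≟ s ⟧ * relations V S (u +[ a ] v))
  relations-∷ {n = n} v V s S u = trans (∑-vectors elements n _) (∑-cong elements λ a → trans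
    (∑-cong (space n) λ w → trans (cong (_* ⟦ combine (u +[ a ] v) w V ≟ⱽ 𝟎 ⟧)
      (bit-∧ (does (not (does (a ≟ᴷ 0#)) Bool.≟ s)) _)) (ℤ.*-assoc ⟦ not (does (a ≟ᴷ 0#)) Bool.≟ s ⟧ _ _))
    (∑-*ˡ ⟦ not (does (a ≟ᴷ 0#)) Bool.≟ s ⟧ (space n) _))

  relations-outside : (v : Vec K k) (V : Mat n k) (S : Subset n) (u : Vec K k) →
                      relations (v ∷ V) (outside ∷ S) u ≡ relations V S u
  relations-outside v V S u = begin
    relations (v ∷ V) (outside ∷ S) u
      ≡⟨ relations-∷ v V outside S u ⟩
    (∑[ a ← elements ] ⟦ not (does (a ≟ᴷ 0#)) Bool.≟ outside ⟧ * relations V S (u +[ a ] v))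
      ≡⟨ ∑-cong elements (λ a → cong (_* relations V S (u +[ a ] v))
          (trans (flip (does (a ≟ᴷ 0#))) (⟦⟧-cong (a ≟ᴷ 0#) (0# ≟ᴷ a) sym sym))) ⟩
    (∑[ a ← elements ] ⟦ 0# ≟ᴷ a ⟧ * relations V S (u +[ a ] v))
      ≡⟨ Finite.∑-δ finiteK 0# (λ a → relations V S (u +[ a ] v)) ⟩
    relations V S (u +[ 0# ] v)
      ≡⟨ cong (relations V S) (+[0] u v) ⟩
    relations V S u ∎
    where
    flip : ∀ b → ⟦ not b Bool.≟ outside ⟧ ≡ bit b
    flip true  = refl
    flip false = refl

  relations-inside : (v : Vec K k) (V : Mat n k) (S : Subset n) (u : Vec K k) →
    relations (v ∷ V) (inside ∷ S) u ≡ (∑[ a ← elements ] relations V S (u +[ a ] v)) + - relations V S u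
  relations-inside v V S u = begin
    relations (v ∷ V) (inside ∷ S) u
      ≡⟨ relations-∷ v V inside S u ⟩
    (∑[ a ← elements ] ⟦ not (does (a ≟ᴷ 0#)) Bool.≟ inside ⟧ * g a)
      ≡⟨ ∑-cong elements (λ a →
          trans (cong (_* g a) (trans (flip (does (a ≟ᴷ 0#)))
          (cong (λ s → 1ℤ + - s) (⟦⟧-cong (a ≟ᴷ 0#) (0# ≟ᴷ a) sym sym)))) (lemma ⟦ 0# ≟ᴷ a ⟧ (g a))) ⟩
    (∑[ a ← elements ] g a + - 1ℤ * (⟦ 0# ≟ᴷ a ⟧ * g a))
      ≡⟨ trans (∑-+ elements g (λ a → - 1ℤ * (⟦ 0# ≟ᴷ a ⟧ * g a)))
          (cong (λ s → ∑ elements g + s) (trans (∑-*ˡ (- 1ℤ) elements _) (ℤ.-1*i≡-i _))) ⟩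
    ∑ elements g + - (∑[ a ← elements ] ⟦ 0# ≟ᴷ a ⟧ * g a)
      ≡⟨ cong (λ s → ∑ elements g + - s) (trans (Finite.∑-δ finiteK 0# g) (cong (relations V S) (+[0] u v))) ⟩
    ∑ elements g + - relations V S u ∎
    where
    g : K → ℤ
    g a = relations V S (u +[ a ] v)
    flip : ∀ b → ⟦ not b Bool.≟ inside ⟧ ≡ 1ℤ + - bit b
    flip true  = refl
    flip false = refl
    lemma : ∀ b g → (1ℤ + - b) * g ≡ g + - 1ℤ * (b * g)
    lemma = solve-∀

  -- Coefficient vectors vanishing outside T that solve the equation form a coset of the relations
  -- among the columns in T, or do not exist, according to whether u is in the span of T. The exact
  -- support is then reached by signs: a nonzero coefficient means any coefficient minus the
  -- coefficient 0. Adding a column to T either multiplies the solutions by q or enlarges the span.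
  relations-signed : (V : Mat n k) (S : Subset n) (u : Vec K k) →
    relations V S u ≡ (∑[ (s , T) ← signed S ] s * (⟦ mem? (span V T) u ⟧ * q^ nullity (conf V) T))
  relations-signed []      []            u = cong (λ s → 1ℤ * s + 0ℤ) (sym (ℤ.*-identityʳ ⟦ u ≟ⱽ 𝟎 ⟧))
  relations-signed (v ∷ V) (outside ∷ S) u = trans (relations-outside v V S u) (trans (relations-signed V S u)
    (sym (∑-map (λ (s , T) → s , outside ∷ T) (signed S) _)))
  relations-signed (v ∷ V) (inside ∷ S)  u = begin
    relations (v ∷ V) (inside ∷ S) u
      ≡⟨ relations-inside v V S u ⟩
    (∑[ a ← elements ] relations V S (u +[ a ] v)) + - relations V S u
      ≡⟨ cong₂ (λ s t → s + - t) (trans (∑-cong elements λ a → relations-signed V S (u +[ a ] v))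
          (∑-swap elements (signed S) _)) (relations-signed V S u) ⟩
    (∑[ (s , T) ← signed S ] ∑[ a ← elements ] s * (⟦ mem? (span V T) (u +[ a ] v) ⟧ * q^ nullity (conf V) T)) + -
        (∑[ p ← signed S ] term p)
      ≡⟨ cong₂ _+_ (∑-cong (signed S) λ (s , T) → trans (∑-*ˡ s elements _)
          (cong (s *_) (trans (∑-*ʳ _ elements _) (step T))))
           (trans (sym (ℤ.-1*i≡-i _))
               (trans (sym (∑-*ˡ (- 1ℤ) (signed S) term)) (∑-cong (signed S) λ (s , T) → lemma s _))) ⟩
    (∑[ (s , T) ← signed S ] s * (⟦ mem? (span (v ∷ V) (inside ∷ T)) u ⟧ * q^ nullity (conf (v ∷ V)) (inside ∷ T))) +
    (∑[ (s , T) ← signed S ] - s * (⟦ mem? (span (v ∷ V) (outside ∷ T)) u ⟧ * q^ nullity (conf (v ∷ V))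
        (outside ∷ T)))
      ≡⟨ cong₂ _+_ (∑-map (λ (s , T) → s , inside ∷ T) (signed S) _)
          (∑-map (λ (s , T) → - s , outside ∷ T) (signed S) _) ⟨
    ∑ (List.map (λ (s , T) → s , inside ∷ T) (signed S)) term′ + ∑
        (List.map (λ (s , T) → - s , outside ∷ T) (signed S)) term′
      ≡⟨ ∑-++ (List.map (λ (s , T) → s , inside ∷ T) (signed S)) _ term′ ⟨
    ∑ (signed (inside ∷ S)) term′ ∎
    where
    term : ℤ × Subset _ → ℤ
    term (s , T) = s * (⟦ mem? (span V T) u ⟧ * q^ nullity (conf V) T)
    term′ : ℤ × Subset _ → ℤ
    term′ (s , T) = s * (⟦ mem? (span (v ∷ V) T) u ⟧ * q^ nullity (conf (v ∷ V)) T)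
    lemma : ∀ s t → - 1ℤ * (s * t) ≡ - s * t
    lemma = solve-∀
    step : ∀ T → (∑[ a ← elements ] ⟦ mem? (span V T) (u +[ a ] v) ⟧) * q^ nullity (conf V) T ≡
                 ⟦ mem? (adjoin (span V T) v) u ⟧ * q^ nullity (conf (v ∷ V)) (inside ∷ T)
    step T rewrite entry-conf v V T with mem? (span V T) v
    ... | yes v∈ = begin
      (∑[ a ← elements ] ⟦ mem? (span V T) (u +[ a ] v) ⟧) * q^ ν        ≡⟨ cong (_* q^ ν)
          (coefficients-in (span V T) v v∈ u) ⟩
      + q * ⟦ mem? (span V T) u ⟧ * q^ ν                                  ≡⟨ comm (+ q) ⟦ mem? (span V T) u ⟧ (q^ ν) ⟩
      ⟦ mem? (span V T) u ⟧ * (+ q * q^ ν)                                ≡⟨ cong (_* (+ q * q^ ν))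
          (⟦⟧-cong (mem? (span V T) u) (mem? (adjoin (span V T) v) u) (adjoin⁺ (span V T))
          (adjoin-mem (span V T) v∈)) ⟩
      ⟦ mem? (adjoin (span V T) v) u ⟧ * (+ q * q^ ν)                     ∎
      where
      ν = nullity (conf V) T
      comm : ∀ a b c → a * b * c ≡ b * (a * c)
      comm = solve-∀
    ... | no v∉ = cong (_* q^ nullity (conf V) T) (coefficients-out (span V T) v v∉ u)

∑-signed-∷ : (S : Subset n) (f : Subset (suc n) → ℤ) →
  (∑[ (s , T) ← signed (inside ∷ S) ] s * f T) ≡
  (∑[ (s , T) ← signed S ] s * (f (inside ∷ T) + - f (outside ∷ T)))
∑-signed-∷ S f = begin
  (∑[ (s , T) ← signed (inside ∷ S) ] s * f T)
    ≡⟨ trans (∑-++ (List.map (λ (s , T) → s , inside ∷ T) (signed S)) _ (λ (s , T) → s * f T))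
        (cong₂ _+_ (∑-map (λ (s , T) → s , inside ∷ T) (signed S) _)
            (∑-map (λ (s , T) → - s , outside ∷ T) (signed S) _)) ⟩
  (∑[ (s , T) ← signed S ] s * f (inside ∷ T)) + (∑[ (s , T) ← signed S ] - s * f (outside ∷ T))
    ≡⟨ ∑-+ (signed S) (λ (s , T) → s * f (inside ∷ T)) (λ (s , T) → - s * f (outside ∷ T)) ⟨
  (∑[ (s , T) ← signed S ] s * f (inside ∷ T) + - s * f (outside ∷ T))
    ≡⟨ ∑-cong (signed S) (λ (s , T) → lemma s (f (inside ∷ T)) (f (outside ∷ T))) ⟩
  (∑[ (s , T) ← signed S ] s * (f (inside ∷ T) + - f (outside ∷ T))) ∎
  where
  lemma : ∀ s a b → s * a + - s * b ≡ s * (a + - b)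
  lemma = solve-∀

-- Including or omitting one fixed element of S pairs off opposite signs.
signs-sum : (S : Subset n) → weight S ≢ 0 → (∑[ (s , T) ← signed S ] s * 1ℤ) ≡ 0ℤ
signs-sum []            w≢0 = contradiction refl w≢0
signs-sum (outside ∷ S) w≢0 = trans (∑-map (λ (s , T) → s , outside ∷ T) (signed S) _) (signs-sum S w≢0)
signs-sum (inside ∷ S)  w≢0 = trans (∑-signed-∷ S (λ _ → 1ℤ))
  (trans (∑-cong (signed S) λ (s , T) → ℤ.*-zeroʳ s) (∑-zero (signed S)))

signed-empty : (S : Subset n) → weight S ≡ 0 → signed S ≡ (1ℤ , ∅) ∷ []
signed-empty []            w≡0 = refl
signed-empty (outside ∷ S) w≡0 = cong (List.map λ (s , T) → s , outside ∷ T) (signed-empty S w≡0)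

nullity-∅ : (μ : Conf n) → nullity μ ∅ ≡ 0
nullity-∅ {zero}  μ       = refl
nullity-∅ {suc n} (t , μ) = nullity-∅ μ

weight-cases : (S : Subset n) → weight S ≡ 0 ⊎ weight S ≡ 1
weight-cases []            = inj₁ refl
weight-cases (outside ∷ S) = weight-cases S
weight-cases (inside ∷ S)  = inj₂ refl

weight-compress : (C T : Subset n) → T ⊆ C → weight (compress C T) ≡ weight T
weight-compress []            []            T⊆C = refl
weight-compress (outside ∷ C) (outside ∷ T) T⊆C = weight-compress C T (Subset.drop-∷-⊆ T⊆C)
weight-compress (outside ∷ C) (inside ∷ T)  T⊆C = contradiction (T⊆C here) λ ()
weight-compress (inside ∷ C)  (outside ∷ T) T⊆C = weight-compress C T (Subset.drop-∷-⊆ T⊆C)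
weight-compress (inside ∷ C)  (inside ∷ T)  T⊆C = refl

_≟ᴮ_ : DecidableEquality (Board m n)
_≟ᴮ_ = Vec.≡-dec _≟ˢ_

module Moments {q : ℕ} (F : FiniteField q) where

  open Relations F public
  open Subspace

  value-qNumber : ∀ n → 1ℤ + x * value (qNumber n) x ≡ q^ n
  value-qNumber zero    = cong (λ s → 1ℤ + s) (ℤ.*-zeroʳ x)
  value-qNumber (suc n) = trans (lemma (+ q) (value (qNumber n) x)) (cong (+ q *_) (value-qNumber n))
    where
    lemma : ∀ q ν → 1ℤ + (q - 1ℤ) * (1ℤ + (1ℤ + (q - 1ℤ)) * ν) ≡ q * (1ℤ + (q - 1ℤ) * ν)
    lemma = solve-∀

  relations-𝟎 : (V : Mat n k) (S : Subset n) →
    relations V S 𝟎 ≡ (∑[ (s , T) ← signed S ] s * q^ nullity (conf V) T)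
  relations-𝟎 V S = trans (relations-signed V S 𝟎) (∑-cong (signed S) λ (s , T) → cong (s *_)
    (trans (cong (_* q^ nullity (conf V) T) (⟦⟧-true (mem? (span V T) 𝟎) (𝟎∈ (span V T)))) (ℤ.*-identityˡ _)))

  -- For nonempty S the signs cancel, so every power of q in `relations-𝟎` may be diminished by 1;
  -- each term then shows the factor x. For empty S there is only the zero relation.
  relations-value : (V : Mat n k) (S : Subset n) →
                    relations V S 𝟎 ≡ x ^ weight S * value (relationsE (conf V) S) x
  relations-value V S with weight S in eq
  ... | zero  = trans (relations-𝟎 V S)
      (trans (cong (λ l → ∑[ (s , T) ← l ] s * q^ nullity (conf V) T) (signed-empty S eq))
    (cong (λ e → 1ℤ * q^ e + 0ℤ) (nullity-∅ (conf V))))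
  ... | suc w = begin
    relations V S 𝟎
      ≡⟨ relations-𝟎 V S ⟩
    (∑[ (s , T) ← signed S ] s * q^ nullity (conf V) T)
      ≡⟨ ∑-cong (signed S) (λ (s , T) → trans (cong (s *_) (sym (value-qNumber (nullity (conf V) T))))
          (lemma s x _)) ⟩
    (∑[ (s , T) ← signed S ] s * 1ℤ + x * (s * value (qNumber (nullity (conf V) T)) x))
      ≡⟨ trans (∑-+ (signed S) (λ (s , T) → s * 1ℤ) (λ (s , T) → x * (s * value (qNumber (nullity (conf V) T)) x)))
           (cong₂ _+_ (signs-sum S (λ w≡0 → contradiction (trans (sym eq) w≡0) λ ())) (∑-*ˡ x (signed S) _)) ⟩
    0ℤ + x * (∑[ (s , T) ← signed S ] s * value (qNumber (nullity (conf V) T)) x)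
      ≡⟨ trans (ℤ.+-identityˡ _)
          (cong (x *_) (sym (value-∑ (signed S) (λ (s , T) → const s :* qNumber (nullity (conf V) T)) x))) ⟩
    x * value (∑-expr (signed S) λ (s , T) → const s :* qNumber (nullity (conf V) T)) x
      ≡⟨ cong (_* value (∑-expr (signed S) λ (s , T) → const s :* qNumber (nullity (conf V) T)) x)
          (sym (trans (cong (x ^_) w≡0) (ℤ.*-identityʳ x))) ⟩
    x ^ suc w * value (∑-expr (signed S) λ (s , T) → const s :* qNumber (nullity (conf V) T)) x ∎
    where
    lemma : ∀ s x ν → s * (1ℤ + x * ν) ≡ s * 1ℤ + x * (s * ν)
    lemma = solve-∀
    w≡0 : suc w ≡ 1
    w≡0 with weight-cases S
    ... | inj₁ ≡0 = contradiction (trans (sym eq) ≡0) λ ()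
    ... | inj₂ ≡1 = trans (sym eq) ≡1

  rowRelations : Mat n k → Board m n → ℤ
  rowRelations V []      = 1ℤ
  rowRelations V (T ∷ S) = relations V T 𝟎 * rowRelations V S

  rowRelations-value : (V : Mat n k) (S : Board m n) →
                       rowRelations V S ≡ x ^ weights S * value (rowsE (conf V) S) x
  rowRelations-value V []      = refl
  rowRelations-value V (T ∷ S) = begin
    relations V T 𝟎 * rowRelations V S
      ≡⟨ cong₂ _*_ (relations-value V T) (rowRelations-value V S) ⟩
    x ^ weight T * e * (x ^ weights S * f)
      ≡⟨ lemma (x ^ weight T) e (x ^ weights S) f ⟩
    x ^ weight T * x ^ weights S * (e * f)
      ≡⟨ cong (_* (e * f)) (ℤ.^-distribˡ-+-* x (weight T) (weights S)) ⟨
    x ^ (weight T ℕ.+ weights S) * (e * f) ∎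
    where
    e = value (relationsE (conf V) T) x
    f = value (rowsE (conf V) S) x
    lemma : ∀ a b c d → a * b * (c * d) ≡ a * c * (b * d)
    lemma = solve-∀

  relations-compress : (C : Subset n) (V : Mat n k) (T : Subset n) → T ⊆ C → ∀ u →
                       relations V T u ≡ relations (compress C V) (compress C T) u
  relations-compress []            []      []            T⊆C u = refl
  relations-compress (outside ∷ C) (v ∷ V) (outside ∷ T) T⊆C u =
    trans (relations-outside v V T u) (relations-compress C V T (Subset.drop-∷-⊆ T⊆C) u)
  relations-compress (outside ∷ C) (v ∷ V) (inside ∷ T)  T⊆C u = contradiction (T⊆C here) λ ()
  relations-compress (inside ∷ C)  (v ∷ V) (t ∷ T)       T⊆C u =
    trans (relations-∷ v V t T u)
        (trans (∑-cong elements λ a → cong (⟦ not (does (a ≟ᴷ 0#)) Bool.≟ t ⟧ *_)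
        (relations-compress C V T (Subset.drop-∷-⊆ T⊆C) (u +[ a ] v)))
      (sym (relations-∷ v (compress C V) t (compress C T) u)))

  ColumnsIn : Subset n → Board m n → Set
  ColumnsIn C = VecAll.All (_⊆ C)

  rowRelations-compress : (C : Subset n) (V : Mat n k) (S : Board m n) → ColumnsIn C S →
                          rowRelations V S ≡ rowRelations (compress C V) (Vec.map (compress C) S)
  rowRelations-compress C V []      []          = refl
  rowRelations-compress C V (T ∷ S) (T⊆C ∷ S⊆C) = cong₂ _*_ (relations-compress C V T T⊆C 𝟎)
      (rowRelations-compress C V S S⊆C)

  weights-compress : (C : Subset n) (S : Board m n) → ColumnsIn C S → weights (Vec.map (compress C) S) ≡ weights S
  weights-compress C []      []          = refl
  weights-compress C (T ∷ S) (T⊆C ∷ S⊆C) = cong₂ ℕ._+_ (weight-compress C T T⊆C) (weights-compress C S S⊆C)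

  -- The vectors at positions outside C are unconstrained, each contributing a factor y = qᵏ.
  ∑-compress : (C : Subset n) (h : Mat ∣ C ∣ k → ℤ) →
    (∑[ V ← vectors (space k) n ] h (compress C V)) ≡ (q^ k) ^ skipped C * ∑ (vectors (space k) ∣ C ∣) h
  ∑-compress []            h = sym (ℤ.*-identityˡ _)
  ∑-compress {suc n} {k} (outside ∷ C) h = begin
    (∑[ V ← vectors (space k) (suc n) ] h (compress (outside ∷ C) V))
      ≡⟨ ∑-vectors (space k) n _ ⟩
    (∑[ v ← space k ] ∑[ V ← vectors (space k) n ] h (compress C V))
      ≡⟨ ∑-cong (space k) (λ v → trans (∑-compress C h) (sym (ℤ.*-identityˡ _))) ⟩
    (∑[ v ← space k ] 1ℤ * ((q^ k) ^ skipped C * ∑ (vectors (space k) ∣ C ∣) h))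
      ≡⟨ trans (∑-*ʳ _ (space k) _) (cong (_* ((q^ k) ^ skipped C * ∑ (vectors (space k) ∣ C ∣) h)) (∑-space-1 k)) ⟩
    q^ k * ((q^ k) ^ skipped C * ∑ (vectors (space k) ∣ C ∣) h)
      ≡⟨ ℤ.*-assoc (q^ k) _ _ ⟨
    q^ k * (q^ k) ^ skipped C * ∑ (vectors (space k) ∣ C ∣) h ∎
  ∑-compress {suc n} {k} (inside ∷ C)  h = begin
    (∑[ V ← vectors (space k) (suc n) ] h (compress (inside ∷ C) V))
      ≡⟨ ∑-vectors (space k) n _ ⟩
    (∑[ v ← space k ] ∑[ V ← vectors (space k) n ] h (v ∷ compress C V))
      ≡⟨ ∑-cong (space k) (λ v → ∑-compress C (h ∘ (v ∷_))) ⟩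
    (∑[ v ← space k ] (q^ k) ^ skipped C * (∑[ V ← vectors (space k) ∣ C ∣ ] h (v ∷ V)))
      ≡⟨ trans (∑-*ˡ ((q^ k) ^ skipped C) (space k) _)
          (cong ((q^ k) ^ skipped C *_) (sym (∑-vectors (space k) ∣ C ∣ h))) ⟩
    (q^ k) ^ skipped C * ∑ (vectors (space k) (suc ∣ C ∣)) h ∎

  ∑-rowRelations : (C : Subset n) → ∣ C ∣ ≤ 6 → (S : Board m n) → ColumnsIn C S → ∀ k →
    (∑[ V ← vectors (space k) n ] rowRelations V S) ≡ x ^ weights S * value[y] (momentsE C S) x (q^ k)
  ∑-rowRelations {n} C C≤6 S S⊆C k = begin
    (∑[ V ← vectors (space k) n ] rowRelations V S)
      ≡⟨ ∑-cong (vectors (space k) n)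
          (λ V → trans (rowRelations-compress C V S S⊆C) (rowRelations-value (compress C V) S′)) ⟩
    (∑[ V ← vectors (space k) n ] x ^ weights S′ * value (rowsE (conf (compress C V)) S′) x)
      ≡⟨ trans (∑-*ˡ (x ^ weights S′) (vectors (space k) n) _) (cong₂ (λ w s → x ^ w * s) (weights-compress C S S⊆C)
           (∑-compress C λ V → value (rowsE (conf V) S′) x)) ⟩
    x ^ weights S * (y ^ skipped C * (∑[ V ← vectors (space k) ∣ C ∣ ] value (rowsE (conf V) S′) x))
      ≡⟨ cong (λ s → x ^ weights S * (y ^ skipped C * s)) (trans
           (∑-cong (vectors (space k) ∣ C ∣) λ V →
               sym (trans (cong (λ s → value (rowsE (conf V) S′) x + s) (ℤ.*-zeroʳ y)) (ℤ.+-identityʳ _)))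
           (configurations-correct C≤6 (λ μ → rowsE μ S′ ∷ []))) ⟩
    x ^ weights S * (y ^ skipped C * value[y] (configurations ∣ C ∣ λ μ → rowsE μ S′ ∷ []) x y)
      ≡⟨ cong (x ^ weights S *_) (value-shift (skipped C) _ x y) ⟨
    x ^ weights S * value[y] (momentsE C S) x y ∎
    where
    y = q^ k
    S′ = Vec.map (compress C) S

  -- Moments of the kernel size

  dot : K → Vec K n → Vec K n → K
  dot s []       []       = s
  dot s (a ∷ as) (c ∷ cs) = dot (s ⊹ a · c) as cs

  combine-zip : (s : K) (u : Vec K k) (a : Vec K n) (c : Vec K n) (V : Mat n k) →
                combine (s ∷ u) a (Vec.zipWith _∷_ c V) ≡ dot s a c ∷ combine u a V
  combine-zip s u []      []      []      = refl
  combine-zip s u (a ∷ as) (c ∷ cs) (v ∷ V) = combine-zip (s ⊹ a · c) (u +[ a ] v) as cs V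

  annihilates : Mat m n → Mat n k → ℤ
  annihilates []      V = 1ℤ
  annihilates (a ∷ A) V = ⟦ combine 𝟎 a V ≟ⱽ 𝟎 ⟧ * annihilates A V

  kills : Mat m n → Vec K n → ℤ
  kills []      c = 1ℤ
  kills (a ∷ A) c = ⟦ dot 0# a c ≟ᴷ 0# ⟧ * kills A c

  annihilates-zip : (A : Mat m n) (c : Vec K n) (V : Mat n k) →
                    annihilates A (Vec.zipWith _∷_ c V) ≡ kills A c * annihilates A V
  annihilates-zip []      c V = refl
  annihilates-zip {k = k} (a ∷ A) c V = begin
    ⟦ combine 𝟎 a (Vec.zipWith _∷_ c V) ≟ⱽ 𝟎 ⟧ * annihilates A (Vec.zipWith _∷_ c V)
      ≡⟨ cong₂ (λ u s → ⟦ u ≟ⱽ 𝟎 ⟧ * s) (combine-zip 0# 𝟎 a c V) (annihilates-zip A c V) ⟩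
    ⟦ (dot 0# a c ∷ combine 𝟎 a V) ≟ⱽ 𝟎 ⟧ * (kills A c * annihilates A V)
      ≡⟨ cong (_* (kills A c * annihilates A V)) (bit-∧ (does (dot 0# a c ≟ᴷ 0#)) _) ⟩
    ⟦ dot 0# a c ≟ᴷ 0# ⟧ * ⟦ combine 𝟎 a V ≟ⱽ 𝟎 ⟧ * (kills A c * annihilates A V)
      ≡⟨ lemma ⟦ dot 0# a c ≟ᴷ 0# ⟧ ⟦ combine 𝟎 a V ≟ⱽ 𝟎 ⟧ _ _ ⟩
    kills (a ∷ A) c * annihilates (a ∷ A) V ∎
    where
    lemma : ∀ a b c d → a * b * (c * d) ≡ a * c * (b * d)
    lemma = solve-∀

  ∑-zip : ∀ n k (f : Mat n (suc k) → ℤ) →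
    ∑ (vectors (space (suc k)) n) f ≡ (∑[ c ← space n ] ∑[ V ← vectors (space k) n ] f (Vec.zipWith _∷_ c V))
  ∑-zip zero    k f = sym (ℤ.+-identityʳ _)
  ∑-zip (suc n) k f = begin
    ∑ (vectors (space (suc k)) (suc n)) f
      ≡⟨ trans (∑-vectors (space (suc k)) n f) (∑-vectors elements k _) ⟩
    (∑[ a ← elements ] ∑[ v ← space k ] ∑[ V ← vectors (space (suc k)) n ] f ((a ∷ v) ∷ V))
      ≡⟨ ∑-cong elements (λ a → trans (∑-cong (space k) λ v → ∑-zip n k _) (∑-swap (space k) (space n) _)) ⟩
    (∑[ a ← elements ] ∑[ c ← space n ] ∑[ v ← space k ] ∑[ V ← vectors (space k) n ] f
        ((a ∷ v) ∷ Vec.zipWith _∷_ c V))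
      ≡⟨ trans (∑-vectors elements n _) (∑-cong elements λ a → ∑-cong (space n) λ c → ∑-vectors (space k) n _) ⟨
    (∑[ c ← space (suc n) ] ∑[ V ← vectors (space k) (suc n) ] f (Vec.zipWith _∷_ c V)) ∎

  kernelSize : Mat m n → ℤ
  kernelSize {n = n} A = ∑[ c ← space n ] kills A c

  -- Read the family V of n vectors coordinatewise: A annihilates it exactly when all k coordinate
  -- vectors lie in the kernel, so the annihilated families are the k-tuples of kernel vectors.
  kernelSize-^ : (A : Mat m n) (k : ℕ) → (∑[ V ← vectors (space k) n ] annihilates A V) ≡ kernelSize A ^ k
  kernelSize-^ {n = n} A zero    = trans (∑-cong (vectors (space 0) n) (ones A)) (points n)
    where
    ones : ∀ {m} (A : Mat m n) (V : Mat n 0) → annihilates A V ≡ 1ℤ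
    ones []      V = refl
    ones (a ∷ A) V with combine 𝟎 a V
    ... | [] = trans (ℤ.*-identityˡ _) (ones A V)
    points : ∀ n → (∑[ V ← vectors (space 0) n ] 1ℤ) ≡ 1ℤ
    points zero    = refl
    points (suc n) = trans (∑-vectors (space 0) n _) (trans (ℤ.+-identityʳ _) (points n))
  kernelSize-^ {n = n} A (suc k) = begin
    (∑[ V ← vectors (space (suc k)) n ] annihilates A V)
      ≡⟨ ∑-zip n k _ ⟩
    (∑[ c ← space n ] ∑[ V ← vectors (space k) n ] annihilates A (Vec.zipWith _∷_ c V))
      ≡⟨ ∑-cong (space n) (λ c → trans (∑-cong (vectors (space k) n) λ V → annihilates-zip A c V)
          (∑-*ˡ (kills A c) (vectors (space k) n) _)) ⟩
    (∑[ c ← space n ] kills A c * (∑[ V ← vectors (space k) n ] annihilates A V))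
      ≡⟨ trans (∑-*ʳ _ (space n) (kills A)) (cong (kernelSize A *_) (kernelSize-^ A k)) ⟩
    kernelSize A ^ suc k ∎

  matrices : (m n : ℕ) → List (Mat m n)
  matrices m n = vectors (space n) m

  hasSupport : Board m n → Mat m n → ℤ
  hasSupport S A = ⟦ Vec.map support A ≟ᴮ S ⟧

  support-annihilates : (V : Mat n k) (S : Board m n) (A : Mat m n) →
    hasSupport S A * annihilates A V ≡ ∏ (Vec.map (λ T a → ⟦ support a ≟ˢ T ⟧ * ⟦ combine 𝟎 a V ≟ⱽ 𝟎 ⟧) S) A
  support-annihilates V []      []      = refl
  support-annihilates V (T ∷ S) (a ∷ A) = begin
    hasSupport (T ∷ S) (a ∷ A) * (⟦ combine 𝟎 a V ≟ⱽ 𝟎 ⟧ * annihilates A V)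
      ≡⟨ cong (_* (⟦ combine 𝟎 a V ≟ⱽ 𝟎 ⟧ * annihilates A V)) (bit-∧ (does (support a ≟ˢ T)) _) ⟩
    ⟦ support a ≟ˢ T ⟧ * hasSupport S A * (⟦ combine 𝟎 a V ≟ⱽ 𝟎 ⟧ * annihilates A V)
      ≡⟨ lemma ⟦ support a ≟ˢ T ⟧ (hasSupport S A) ⟦ combine 𝟎 a V ≟ⱽ 𝟎 ⟧ _ ⟩
    ⟦ support a ≟ˢ T ⟧ * ⟦ combine 𝟎 a V ≟ⱽ 𝟎 ⟧ * (hasSupport S A * annihilates A V)
      ≡⟨ cong (⟦ support a ≟ˢ T ⟧ * ⟦ combine 𝟎 a V ≟ⱽ 𝟎 ⟧ *_) (support-annihilates V S A) ⟩
    ∏ (Vec.map (λ T a → ⟦ support a ≟ˢ T ⟧ * ⟦ combine 𝟎 a V ≟ⱽ 𝟎 ⟧) (T ∷ S)) (a ∷ A) ∎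
    where
    lemma : ∀ a b c d → a * b * (c * d) ≡ a * c * (b * d)
    lemma = solve-∀

  ∏-sums-relations : (V : Mat n k) (S : Board m n) →
    ∏-sums (space n) (Vec.map (λ T a → ⟦ support a ≟ˢ T ⟧ * ⟦ combine 𝟎 a V ≟ⱽ 𝟎 ⟧) S) ≡ rowRelations V S
  ∏-sums-relations V []      = refl
  ∏-sums-relations V (T ∷ S) = cong (relations V T 𝟎 *_) (∏-sums-relations V S)

  moments : (C : Subset n) → ∣ C ∣ ≤ 6 → (S : Board m n) → ColumnsIn C S → ∀ k →
    (∑[ A ← matrices m n ] hasSupport S A * kernelSize A ^ k) ≡ x ^ weights S * value[y] (momentsE C S) x (q^ k)
  moments {n} {m} C C≤6 S S⊆C k = begin
    (∑[ A ← matrices m n ] hasSupport S A * kernelSize A ^ k)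
      ≡⟨ ∑-cong (matrices m n) (λ A → trans (cong (hasSupport S A *_) (sym (kernelSize-^ A k)))
          (sym (∑-*ˡ (hasSupport S A) (vectors (space k) n) _))) ⟩
    (∑[ A ← matrices m n ] ∑[ V ← vectors (space k) n ] hasSupport S A * annihilates A V)
      ≡⟨ ∑-swap (matrices m n) (vectors (space k) n) _ ⟩
    (∑[ V ← vectors (space k) n ] ∑[ A ← matrices m n ] hasSupport S A * annihilates A V)
      ≡⟨ ∑-cong (vectors (space k) n) (λ V → trans (∑-cong (matrices m n) (support-annihilates V S))
           (trans (∑-∏ (space n) (Vec.map (λ T a → ⟦ support a ≟ˢ T ⟧ * ⟦ combine 𝟎 a V ≟ⱽ 𝟎 ⟧) S))
               (∏-sums-relations V S))) ⟩
    (∑[ V ← vectors (space k) n ] rowRelations V S)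
      ≡⟨ ∑-rowRelations C C≤6 S S⊆C k ⟩
    x ^ weights S * value[y] (momentsE C S) x (q^ k) ∎

  -- Both sides are polynomials in y = qᵏ, and the k-th moments agree for all k.
  nullity-counts : (C : Subset n) → ∣ C ∣ ≤ 6 → (S : Board m n) → ColumnsIn C S →
    (null : Mat m n → ℕ) → (∀ A → null A ≤ n) → (∀ A → kernelSize A ≡ q^ null A) → ∀ e →
    (∑[ A ← matrices m n ] hasSupport S A * ⟦ null A ℕ.≟ e ⟧) ≡ x ^ weights S * value (coefficientE (momentsE C S) e)
        x
  nullity-counts {n} {m} C C≤6 S S⊆C null null≤n kernelSize≡ e = begin
    count e                                        ≡⟨ lemma (count e) (c * coeff e) ⟩
    - 1ℤ * (c * coeff e + - 1ℤ * count e) + c * coeff e  ≡⟨ cong (λ s → - 1ℤ * s + c * coeff e)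
        (horner-injective N diff vanish (ℕ.m≤n+m (suc e) _)) ⟩
    0ℤ + c * coeff e                                ≡⟨ ℤ.+-identityˡ _ ⟩
    c * coeff e                                     ∎
    where
    c = x ^ weights S
    p = momentsE C S
    -- Large enough to cover every coefficient of p, every possible nullity, and the index e in
    -- question.
    N = List.length p ℕ.+ suc n ℕ.+ suc e
    count coeff diff : ℕ → ℤ
    count e = ∑[ A ← matrices m n ] hasSupport S A * ⟦ null A ℕ.≟ e ⟧
    coeff e = value (coefficientE p e) x
    diff e = c * coeff e + - 1ℤ * count e
    lemma : ∀ a b → a ≡ - 1ℤ * (b + - 1ℤ * a) + b
    lemma = solve-∀
    flip^ : ∀ i a b → (i ^ a) ^ b ≡ (i ^ b) ^ a
    flip^ i a b = trans (ℤ.^-*-assoc i a b) (trans (cong (i ^_) (ℕ.*-comm a b)) (sym (ℤ.^-*-assoc i b a)))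
    counts : ∀ k → horner N count (q^ k) ≡ (∑[ A ← matrices m n ] hasSupport S A * kernelSize A ^ k)
    counts k = trans (horner-∑ N (matrices m n) (hasSupport S) (λ A e → ⟦ null A ℕ.≟ e ⟧) (q^ k))
      (∑-cong (matrices m n) λ A → cong (hasSupport S A *_) (trans
        (horner-δ N (null A) (q^ k)
            (ℕ.≤-trans (ℕ.s≤s (null≤n A)) (ℕ.≤-trans (ℕ.m≤n+m (suc n) (List.length p)) (ℕ.m≤m+n _ (suc e)))))
        (trans (flip^ (+ q) k (null A)) (cong (_^ k) (sym (kernelSize≡ A))))))
    vanish : ∀ k → horner N diff (q^ k) ≡ 0ℤ
    vanish k = begin
      horner N diff (q^ k)
        ≡⟨ horner-linear N c coeff (λ e → - 1ℤ * count e) (q^ k) ⟩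
      c * horner N coeff (q^ k) + horner N (λ e → - 1ℤ * count e) (q^ k)
        ≡⟨ cong₂ (λ s t → c * s + t)
            (horner-value[y] N p x (q^ k) (ℕ.≤-trans (ℕ.m≤m+n _ (suc n)) (ℕ.m≤m+n _ (suc e))))
             (trans (horner-cong N (q^ k) (λ e → sym (ℤ.+-identityʳ _)))
                 (trans (horner-linear N (- 1ℤ) count (λ _ → 0ℤ) (q^ k))
               (trans (cong₂ (λ s t → - 1ℤ * s + t) (counts k) (horner-zero N (q^ k))) (ℤ.+-identityʳ _)))) ⟩
      c * value[y] p x (q^ k) + - 1ℤ * (∑[ A ← matrices m n ] hasSupport S A * kernelSize A ^ k)
        ≡⟨ cong (λ s → c * value[y] p x (q^ k) + - 1ℤ * s) (moments C C≤6 S S⊆C k) ⟩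
      c * value[y] p x (q^ k) + - 1ℤ * (c * value[y] p x (q^ k))
        ≡⟨ cancel (c * value[y] p x (q^ k)) ⟩
      0ℤ ∎
      where
      cancel : ∀ a → a + - 1ℤ * a ≡ 0ℤ
      cancel = solve-∀

-- Rank and nullity

module Ranks {q : ℕ} (F : FiniteField q) where

  open Moments F public
  open Subspace

  dot-linear : (a u v : Vec K n) (s t b : K) → dot (s ⊹ b · t) a (u +[ b ] v) ≡ dot s a u ⊹ b · dot t a v
  dot-linear []      []      []      s t b = refl
  dot-linear (a ∷ as) (u ∷ us) (v ∷ vs) s t b = trans
    (cong (λ r → dot r as (us +[ b ] vs))
      (S.solve 6 (λ s t a u v b → s S.:+ b S.:* t S.:+ a S.:* (u S.:+ b S.:* v) S.:= s S.:+ a S.:* u S.:+ b S.:*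
          (t S.:+ a S.:* v)) refl s t a u v b))
    (dot-linear as us vs (s ⊹ a · u) (t ⊹ a · v) b)

  dot-+[] : (a u v : Vec K n) (b : K) → dot 0# a (u +[ b ] v) ≡ dot 0# a u ⊹ b · dot 0# a v
  dot-+[] a u v b = trans (cong (λ s → dot s a (u +[ b ] v)) (sym (trans (K.+-identityˡ _) (K.zeroʳ b))))
      (dot-linear a u v 0# 0# b)

  dot-𝟎 : (s : K) (a : Vec K n) → dot s a 𝟎 ≡ s
  dot-𝟎 s []      = refl
  dot-𝟎 s (a ∷ as) = trans (cong (λ t → dot t as 𝟎) (trans (cong (s ⊹_) (K.zeroʳ a)) (K.+-identityʳ s))) (dot-𝟎 s as)

  𝟎-dot : (s : K) (c : Vec K n) → dot s 𝟎 c ≡ s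
  𝟎-dot s []      = refl
  𝟎-dot s (c ∷ cs) = trans (cong (λ t → dot t 𝟎 cs) (trans (cong (s ⊹_) (K.zeroˡ c)) (K.+-identityʳ s))) (𝟎-dot s cs)

  everything : Subspace n
  everything = record { Mem = λ _ → Unit ; mem? = λ _ → yes tt ; 𝟎∈ = tt ; closed = λ _ _ _ → tt }

  size-everything : size (everything {n}) ≡ q^ n
  size-everything {n} = ∑-space-1 n

  hyperplane : Vec K n → Subspace n
  hyperplane a = record
    { Mem    = λ c → dot 0# a c ≡ 0#
    ; mem?   = λ c → dot 0# a c ≟ᴷ 0#
    ; 𝟎∈     = dot-𝟎 0# a
    ; closed = λ {u} {v} b u∈ v∈ → trans (dot-+[] a u v b)
        (trans (cong₂ (λ s t → s ⊹ b · t) u∈ v∈) (trans (K.+-identityˡ _) (K.zeroʳ b)))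
    }

  kernel : Mat m n → Subspace n
  kernel []      = everything
  kernel (a ∷ A) = hyperplane a ⊓ kernel A

  kills-kernel : (A : Mat m n) (c : Vec K n) → kills A c ≡ ⟦ mem? (kernel A) c ⟧
  kills-kernel []      c = refl
  kills-kernel (a ∷ A) c = trans (cong (⟦ dot 0# a c ≟ᴷ 0# ⟧ *_) (kills-kernel A c))
    (sym (⟦⟧-× (dot 0# a c ≟ᴷ 0#) (mem? (kernel A) c)))

  kernelSize≡size : (A : Mat m n) → kernelSize A ≡ size (kernel A)
  kernelSize≡size {n = n} A = ∑-cong (space n) (kills-kernel A)

  coordinates : Subset n → Subspace n
  coordinates T = record
    { Mem    = λ c → ∀ j → j ∉ T → lookup c j ≡ 0#
    ; mem?   = λ c → Fin.all? λ j → ¬? (j Subset.∈? T) →-dec (lookup c j ≟ᴷ 0#)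
    ; 𝟎∈     = λ j _ → Vec.lookup-replicate j 0#
    ; closed = λ {u} {v} b u∈ v∈ j j∉ → trans (Vec.lookup-zipWith _ j u v)
        (trans (cong₂ (λ s t → s ⊹ b · t) (u∈ j j∉) (v∈ j j∉)) (trans (K.+-identityˡ _) (K.zeroʳ b)))
    }

  ∑-δ-coordinate : (g : K → ℤ) → (∑[ a ← elements ] ⟦ a ≟ᴷ 0# ⟧ * g a) ≡ g 0#
  ∑-δ-coordinate g = trans (∑-cong elements λ a → cong (_* g a) (⟦⟧-cong (a ≟ᴷ 0#) (0# ≟ᴷ a) sym sym))
      (Finite.∑-δ finiteK 0# g)

  size-coordinates : (T : Subset n) → size (coordinates T) ≡ q^ ∣ T ∣
  size-coordinates []            = refl
  size-coordinates {suc n} (inside ∷ T) = begin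
    size (coordinates (inside ∷ T))
      ≡⟨ ∑-vectors elements n _ ⟩
    (∑[ a ← elements ] ∑[ c ← space n ] ⟦ mem? (coordinates (inside ∷ T)) (a ∷ c) ⟧)
      ≡⟨ ∑-cong elements (λ a → ∑-cong (space n) λ c → ⟦⟧-cong (mem? (coordinates (inside ∷ T)) (a ∷ c))
          (mem? (coordinates T) c)
           (λ c∈ j j∉ → c∈ (suc j) (λ { (there j∈) → j∉ j∈ })) λ { c∈ zero 0∉ → contradiction here 0∉ ; c∈
               (suc j) j∉ → c∈ j (j∉ ∘ there) }) ⟩
    (∑[ a ← elements ] size (coordinates T))
      ≡⟨ trans (∑-const _) (cong (+ q *_) (size-coordinates T)) ⟩
    q^ ∣ inside ∷ T ∣ ∎
  size-coordinates {suc n} (outside ∷ T) = begin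
    size (coordinates (outside ∷ T))
      ≡⟨ ∑-vectors elements n _ ⟩
    (∑[ a ← elements ] ∑[ c ← space n ] ⟦ mem? (coordinates (outside ∷ T)) (a ∷ c) ⟧)
      ≡⟨ ∑-cong elements (λ a →
          trans (∑-cong (space n) λ c →
          trans (⟦⟧-cong (mem? (coordinates (outside ∷ T)) (a ∷ c)) ((a ≟ᴷ 0#) ×-dec mem? (coordinates T) c)
           (λ c∈ → c∈ zero (λ ()) , λ j j∉ → c∈ (suc j) (λ { (there j∈) → j∉ j∈ }))
           λ { (a≡0 , c∈) zero _ → a≡0 ; (a≡0 , c∈) (suc j) j∉ → c∈ j (j∉ ∘ there) })
               (⟦⟧-× (a ≟ᴷ 0#) (mem? (coordinates T) c)))
           (∑-*ˡ ⟦ a ≟ᴷ 0# ⟧ (space n) _)) ⟩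
    (∑[ a ← elements ] ⟦ a ≟ᴷ 0# ⟧ * size (coordinates T))
      ≡⟨ trans (∑-δ-coordinate (λ _ → size (coordinates T))) (size-coordinates T) ⟩
    q^ ∣ outside ∷ T ∣ ∎

  tailSpace : Subspace (suc n) → Subspace n
  tailSpace U = record
    { Mem    = λ c → Mem U (0# ∷ c)
    ; mem?   = λ c → mem? U (0# ∷ c)
    ; 𝟎∈     = 𝟎∈ U
    ; closed = λ b u∈ v∈ → subst (λ z → Mem U (z ∷ _)) (trans (K.+-identityˡ _) (K.zeroʳ b)) (closed U b u∈ v∈)
    }

  Transverse : Subspace n → Subset n → Set
  Transverse U T = ∀ c → Mem U c → Mem (coordinates T) c → c ≡ 𝟎

  -- Elimination, one coordinate at a time. If U has a vector with first coordinate 1, that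
  -- coordinate is a pivot: it multiplies the size by q and is left out of T. Otherwise all of U
  -- vanishes there, and the coordinate joins T. For a kernel, the result gives both its dimension
  -- and a largest set of independent columns.
  coordinateComplement : (U : Subspace n) →
    ∃[ e ] ∃[ T ] (size U ≡ q^ e × ∣ T ∣ ℕ.+ e ≡ n × Transverse U T)
  coordinateComplement {zero}  U = 0 , [] , trans (ℤ.+-identityʳ _) (⟦⟧-true (mem? U []) (𝟎∈ U)) , refl , λ { [] _ _ →
      refl }
  coordinateComplement {suc n} U
    with coordinateComplement (tailSpace U) | ∃? (finiteSpace n) (λ c → mem? U (1# ∷ c))
  ... | e , T , size≡ , ∣T∣+e , transverse | yes (c₀ , 1∷c₀∈) =
    suc e , outside ∷ T , size≡′ , trans (ℕ.+-suc ∣ T ∣ e) (cong suc ∣T∣+e) , transverse′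
    where
    size≡′ : size U ≡ q^ suc e
    size≡′ = begin
      size U
        ≡⟨ ∑-vectors elements n _ ⟩
      (∑[ a ← elements ] ∑[ c ← space n ] ⟦ mem? U (a ∷ c) ⟧)
        ≡⟨ ∑-cong elements (λ a → trans (sym (∑-translate c₀ a (λ c → ⟦ mem? U (a ∷ c) ⟧)))
             (∑-cong (space n) λ c → ⟦⟧-cong (mem? U (a ∷ (c +[ a ] c₀))) (mem? U (0# ∷ c))
               (λ ∈U → shift U a 1∷c₀∈ (subst (Mem U) (eq a c) ∈U))
                   (λ ∈U → subst (Mem U) (sym (eq a c)) (closed U a ∈U 1∷c₀∈)))) ⟩
      (∑[ a ← elements ] size (tailSpace U))
        ≡⟨ trans (∑-const _) (cong (+ q *_) size≡) ⟩
      q^ suc e ∎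
      where
      eq : ∀ a c → a ∷ (c +[ a ] c₀) ≡ (0# ∷ c) +[ a ] (1# ∷ c₀)
      eq a c = cong (_∷ (c +[ a ] c₀)) (sym (trans (K.+-identityˡ _) (K.*-identityʳ a)))
    transverse′ : Transverse U (outside ∷ T)
    transverse′ (a ∷ c) ∈U ∈T with ∈T zero (λ ())
    ... | refl = cong (0# ∷_) (transverse c ∈U λ j j∉ → ∈T (suc j) λ { (there j∈) → j∉ j∈ })
  ... | e , T , size≡ , ∣T∣+e , transverse | no ∄ =
    e , inside ∷ T , size≡′ , cong suc ∣T∣+e , transverse′
    where
    head≡0 : ∀ {a c} → Mem U (a ∷ c) → a ≡ 0#
    head≡0 {a} {c} ∈U with a ≟ᴷ 0#
    ... | yes a≡0 = a≡0
    ... | no  a≢0 = contradiction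
        (𝟎 +[ proj₁ (inverse a≢0) ] c , subst (λ z → Mem U (z ∷ (𝟎 +[ proj₁ (inverse a≢0) ] c)))
      (trans (K.+-identityˡ _) (proj₂ (inverse a≢0))) (scaled U (proj₁ (inverse a≢0)) ∈U)) ∄
    size≡′ : size U ≡ q^ e
    size≡′ = begin
      size U
        ≡⟨ ∑-vectors elements n _ ⟩
      (∑[ a ← elements ] ∑[ c ← space n ] ⟦ mem? U (a ∷ c) ⟧)
        ≡⟨ ∑-cong elements (λ a →
            trans (∑-cong (space n) λ c → trans (⟦⟧-cong (mem? U (a ∷ c)) ((a ≟ᴷ 0#) ×-dec mem? U (0# ∷ c))
             (λ ∈U → head≡0 ∈U , subst (λ z → Mem U (z ∷ c)) (head≡0 ∈U) ∈U) (λ { (refl , ∈U) → ∈U }))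
                 (⟦⟧-× (a ≟ᴷ 0#) (mem? U (0# ∷ c))))
             (∑-*ˡ ⟦ a ≟ᴷ 0# ⟧ (space n) _)) ⟩
      (∑[ a ← elements ] ⟦ a ≟ᴷ 0# ⟧ * size (tailSpace U))
        ≡⟨ trans (∑-δ-coordinate (λ _ → size (tailSpace U))) size≡ ⟩
      q^ e ∎
    transverse′ : Transverse U (inside ∷ T)
    transverse′ (a ∷ c) ∈U ∈T with head≡0 ∈U
    ... | refl = cong (0# ∷_) (transverse c ∈U λ j j∉ → ∈T (suc j) λ { (there j∈) → j∉ j∈ })

  null : Mat m n → ℕ
  null A = proj₁ (coordinateComplement (kernel A))

  kernelSize-null : (A : Mat m n) → kernelSize A ≡ q^ null A
  kernelSize-null A = trans (kernelSize≡size A) (proj₁ (proj₂ (proj₂ (coordinateComplement (kernel A)))))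

  null≤n : (A : Mat m n) → null A ≤ n
  null≤n A = let _ , T , _ , eq , _ = coordinateComplement (kernel A) in
    ℕ.≤-trans (ℕ.m≤n+m _ ∣ T ∣) (ℕ.≤-reflexive eq)

  rk : Mat m n → ℕ
  rk {n = n} A = n ∸ null A

  -- With trivial intersection the modular law makes the sum of the two spaces have size q^(|T| +
  -- null A), and this sum lies inside Kⁿ.
  transverse-≤ : (A : Mat m n) (T : Subset n) → Transverse (kernel A) T → ∣ T ∣ ≤ rk A
  transverse-≤ {n = n} A T transverse = ℕ.m+n≤o⇒m≤o∸n ∣ T ∣ (q^-cancel-≤ (subst (ℤ._≤ q^ n) eq
    (ℤ.≤-trans (size-mono (coordinates T ⊞ U) everything λ _ → _) (ℤ.≤-reflexive (size-everything {n})))))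
    where
    U = kernel A
    eq : size (coordinates T ⊞ U) ≡ q^ (∣ T ∣ ℕ.+ null A)
    eq = begin
      size (coordinates T ⊞ U)                                ≡⟨ ℤ.*-identityˡ _ ⟨
      1ℤ * size (coordinates T ⊞ U)                           ≡⟨ cong (_* size (coordinates T ⊞ U)) (trans
        (size-cong (coordinates T ⊓ U) origin (λ (∈T , ∈U) → transverse _ ∈U ∈T)
            (λ { refl → 𝟎∈ (coordinates T ⊓ U) })) (size-origin {n})) ⟨
      size (coordinates T ⊓ U) * size (coordinates T ⊞ U)     ≡⟨ size-⊓-⊞ (coordinates T) U ⟨
      size (coordinates T) * size U                           ≡⟨ cong₂ _*_ (size-coordinates T)
          (trans (sym (kernelSize≡size A)) (kernelSize-null A)) ⟩
      q^ ∣ T ∣ * q^ null A                                    ≡⟨ ℤ.^-distribˡ-+-* (+ q) ∣ T ∣ (null A) ⟨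
      q^ (∣ T ∣ ℕ.+ null A)                                   ∎

  open FiniteField F using (sum-syntax)

  dot-sum : (s : K) (a c : Vec K n) → dot s a c ≡ s ⊹ (∑[ j < n ] (lookup c j · lookup a j))
  dot-sum s []       []       = sym (K.+-identityʳ s)
  dot-sum s (a ∷ as) (c ∷ cs) = trans (dot-sum (s ⊹ a · c) as cs) (trans (K.+-assoc s (a · c) _)
    (cong (s ⊹_) (cong₂ _⊹_ (K.*-comm a c) refl)))

  kernel⁺ : (A : Mat m n) (c : Vec K n) →
            (∀ i → ∑[ j < n ] (lookup c j · lookup (lookup A i) j) ≡ 0#) → Mem (kernel A) c
  kernel⁺ []      c eq = _
  kernel⁺ (a ∷ A) c eq = trans (dot-sum 0# a c) (trans (K.+-identityˡ _) (eq zero)) , kernel⁺ A c (eq ∘ suc)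

  kernel⁻ : (A : Mat m n) (c : Vec K n) → Mem (kernel A) c →
            ∀ i → ∑[ j < n ] (lookup c j · lookup (lookup A i) j) ≡ 0#
  kernel⁻ (a ∷ A) c (a∙c , _) zero    = trans (sym (K.+-identityˡ _)) (trans (sym (dot-sum 0# a c)) a∙c)
  kernel⁻ (a ∷ A) c (_ , c∈)  (suc i) = kernel⁻ A c c∈ i

  independent⇒transverse : (A : Mat m n) (T : Subset n) → IndependentColumns F A T → Transverse (kernel A) T
  independent⇒transverse A T indep c ∈U ∈T = zeros c (indep c ∈T (kernel⁻ A c ∈U))
    where
    zeros : ∀ {n} (c : Vec K n) → (∀ j → lookup c j ≡ 0#) → c ≡ 𝟎
    zeros []      eq = refl
    zeros (a ∷ c) eq = cong₂ _∷_ (eq zero) (zeros c (eq ∘ suc))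

  transverse⇒independent : (A : Mat m n) (T : Subset n) → Transverse (kernel A) T → IndependentColumns F A T
  transverse⇒independent A T transverse c ∈T ∈U j =
    trans (cong (λ c → lookup c j) (transverse c (kernel⁺ A c ∈U) ∈T)) (Vec.lookup-replicate j 0#)

  -- Columns are independent exactly when no nonzero kernel vector is supported on them. Thus
  -- `coordinateComplement` attains the value `rk A`, and `transverse-≤` shows that nothing exceeds
  -- it.
  hasRank-rk : (A : Mat m n) → HasRank F A (rk A)
  hasRank-rk A with coordinateComplement (kernel A) | transverse-≤ A
  ... | e , T , _ , ∣T∣+e , transverse | bound =
    (T , transverse⇒independent A T transverse , trans (sym (ℕ.m+n∸n≡m ∣ T ∣ e)) (cong (_∸ e) ∣T∣+e)) ,
    λ T′ indep → bound T′ (independent⇒transverse A T′ indep)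

  hasRank-unique : (A : Mat m n) {r : ℕ} → HasRank F A r → rk A ≡ r
  hasRank-unique A ((T , indep , refl) , bound) with hasRank-rk A
  ... | (T′ , indep′ , ∣T′∣≡) , bound′ =
    ℕ.≤-antisym (subst (_≤ ∣ T ∣) ∣T′∣≡ (bound T′ indep′)) (bound′ T indep)

  -- If some v in the kernel of A is not killed by a, every other kernel vector is corrected by a
  -- multiple of v to one that is killed; if there is no such v, the kernel does not shrink at all.
  size-kernel-∷ : (a : Vec K n) (A : Mat m n) → size (kernel A) ℤ.≤ + q * size (kernel (a ∷ A))
  size-kernel-∷ {n} a A with ∃? (finiteSpace n) (λ c → mem? (kernel A) c ×-dec ¬? (dot 0# a c ≟ᴷ 0#))
  ... | yes (v , v∈ , a∙v≢0) = ℤ.≤-trans (size-mono (kernel A) (adjoin (kernel (a ∷ A)) v) λ {u} u∈ → solve-for u u∈)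
    (ℤ.≤-reflexive (size-adjoin-out (kernel (a ∷ A)) v λ (a∙v≡0 , _) → a∙v≢0 a∙v≡0))
    where
    solve-for : ∀ u → Mem (kernel A) u → Mem (adjoin (kernel (a ∷ A)) v) u
    solve-for u u∈ = b , (begin
      dot 0# a (u +[ b ] v)          ≡⟨ dot-+[] a u v b ⟩
      dot 0# a u ⊹ b · dot 0# a v    ≡⟨ cong (dot 0# a u ⊹_)
          (trans (K.*-assoc _ _ _) (trans (cong (⊖ dot 0# a u ·_) (proj₂ (inverse a∙v≢0))) (K.*-identityʳ _))) ⟩
      dot 0# a u ⊹ ⊖ dot 0# a u      ≡⟨ K.-‿inverseʳ _ ⟩
      0#                             ∎) , closed (kernel A) b u∈ v∈
      where b = ⊖ dot 0# a u · proj₁ (inverse a∙v≢0)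
  ... | no ∄ = ℤ.≤-trans (size-mono (kernel A) (kernel (a ∷ A)) λ {u} u∈ → killed u u∈ , u∈)
      (le _ (∑-nonNegative (space n) _ λ c → 0≤⟦⟧ (mem? (kernel (a ∷ A)) c)))
    where
    killed : ∀ u → Mem (kernel A) u → dot 0# a u ≡ 0#
    killed u u∈ with dot 0# a u ≟ᴷ 0#
    ... | yes eq = eq
    ... | no  ne = contradiction (u , u∈ , ne) ∄
    le : ∀ s → 0ℤ ℤ.≤ s → s ℤ.≤ + q * s
    le s 0≤s = subst (ℤ._≤ + q * s) (ℤ.*-identityˡ s)
      (ℤ.*-monoʳ-≤-nonNeg s {{ℤ.nonNegative 0≤s}}
          (ℤ.+≤+ (ℕ.≤-trans (ℕ.s≤s ℕ.z≤n) (ℕ.nonTrivial⇒n>1 q {{FiniteField.order-nonTrivial F}}))))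

  support-empty : (a : Vec K n) → weight (support a) ≡ 0 → a ≡ 𝟎
  support-empty []       w≡0 = refl
  support-empty (a ∷ as) w≡0 = go (a ≟ᴷ 0#) w≡0
    where
    go : (d : Dec (a ≡ 0#)) → weight (not (does d) ∷ support as) ≡ 0 → a ∷ as ≡ 𝟎
    go (yes refl) w≡0 = cong (0# ∷_) (support-empty as w≡0)

  -- Zero rows leave the kernel unchanged, and each other row costs at most a factor q; so the rank
  -- is at most the number of nonzero rows.
  null-weights : (A : Mat m n) → n ≤ null A ℕ.+ weights (Vec.map support A)
  null-weights {n = n} A = q^-cancel-≤ (ℤ.≤-trans (go A) (ℤ.≤-reflexive (begin
    size (kernel A) * q^ w A   ≡⟨ cong (_* q^ w A) (trans (sym (kernelSize≡size A)) (kernelSize-null A)) ⟩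
    q^ null A * q^ w A         ≡⟨ ℤ.^-distribˡ-+-* (+ q) (null A) (w A) ⟨
    q^ (null A ℕ.+ w A)        ∎)))
    where
    w : ∀ {m} → Mat m n → ℕ
    w A = weights (Vec.map support A)
    go : ∀ {m} (A : Mat m n) → q^ n ℤ.≤ size (kernel A) * q^ w A
    go []      = ℤ.≤-reflexive (trans (sym (size-everything {n})) (sym (ℤ.*-identityʳ _)))
    go (a ∷ A) with weight-cases (support a)
    ... | inj₁ ≡0 = ℤ.≤-trans (go A) (ℤ.≤-reflexive (cong₂ (λ s e → s * q^ e)
      (size-cong (kernel A) (kernel (a ∷ A)) (λ {u} u∈ → trans (cong (λ a → dot 0# a u) (support-empty a ≡0))
          (𝟎-dot 0# u) , u∈) proj₂)
      (cong (ℕ._+ w A) (sym ≡0))))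
    ... | inj₂ ≡1 = ℤ.≤-trans (go A) (ℤ.≤-trans
      (ℤ.*-monoʳ-≤-nonNeg (q^ w A) {{q^-nonNegative (w A)}} (size-kernel-∷ a A))
      (ℤ.≤-reflexive (trans (lemma (+ q) (size (kernel (a ∷ A))) (q^ w A))
          (cong (λ e → size (kernel (a ∷ A)) * q^ (e ℕ.+ w A)) (sym ≡1)))))
      where
      lemma : ∀ q s t → q * s * t ≡ s * (q * t)
      lemma = solve-∀

  rk≤weights : (A : Mat m n) → rk A ≤ weights (Vec.map support A)
  rk≤weights {n = n} A = ℕ.m≤n+o⇒m∸n≤o n (null A) (null-weights A)

-- Components of a support and the torus action

-- Rows R and columns C reached from one row along the positions of S; each of the k
-- steps will be paid for by one scaling of the torus.
data Reach {m n : ℕ} (S : Board m n) : Subset m → Subset n → ℕ → Set where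
  start     : ∀ i → Reach S ⁅ i ⁆ ∅ 0
  addColumn : ∀ {R C k i j} → Reach S R C k → i ∈ R → j ∉ C → j ∈ lookup S i → Reach S R (C ∪ ⁅ j ⁆) (suc k)
  addRow    : ∀ {R C k i j} → Reach S R C k → j ∈ C → i ∉ R → j ∈ lookup S i → Reach S (R ∪ ⁅ i ⁆) C (suc k)

∣∪⁅⁆∣ : (p : Subset n) (i : Fin n) → i ∉ p → ∣ p ∪ ⁅ i ⁆ ∣ ≡ suc ∣ p ∣
∣∪⁅⁆∣ (inside ∷ p)  zero    i∉ = contradiction here i∉
∣∪⁅⁆∣ (outside ∷ p) zero    i∉ = cong (suc ∘ ∣_∣) (Subset.∪-identityʳ p)
∣∪⁅⁆∣ (inside ∷ p)  (suc i) i∉ = cong suc (∣∪⁅⁆∣ p i (i∉ ∘ there))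
∣∪⁅⁆∣ (outside ∷ p) (suc i) i∉ = ∣∪⁅⁆∣ p i (i∉ ∘ there)

-- The steps are the edges of a tree whose vertices are the rows in R and the columns in C.
reach-size : {S : Board m n} {R : Subset m} {C : Subset n} → Reach S R C k → ∣ R ∣ ℕ.+ ∣ C ∣ ≡ suc k
reach-size {n = n} (start i) = cong₂ ℕ._+_ (Subset.∣⁅x⁆∣≡1 i) (Subset.∣⊥∣≡0 n)
reach-size {R = R} (addColumn {C = C} {j = j} r _ j∉ _) =
  trans (cong (∣ R ∣ ℕ.+_) (∣∪⁅⁆∣ C j j∉)) (trans (ℕ.+-suc ∣ R ∣ ∣ C ∣) (cong suc (reach-size r)))
reach-size {C = C} (addRow {R = R} {i = i} r _ i∉ _) =
  trans (cong (ℕ._+ ∣ C ∣) (∣∪⁅⁆∣ R i i∉)) (cong suc (reach-size r))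

Closed : Board m n → Subset m → Subset n → Set
Closed S R C = ∀ i j → j ∈ lookup S i → (i ∈ R → j ∈ C) × (j ∈ C → i ∈ R)

component : (S : Board m n) (i₀ : Fin m) → ∃[ R ] ∃[ C ] ∃[ k ] (Reach S R C k × i₀ ∈ R × Closed S R C)
component {m} {n} S i₀ = grow (m ℕ.+ n) (start i₀) (Subset.x∈⁅x⁆ i₀) ℕ.≤-refl
  where
  grow : ∀ f {R C k} → Reach S R C k → i₀ ∈ R → m ℕ.+ n ≤ k ℕ.+ f →
         ∃[ R ] ∃[ C ] ∃[ k ] (Reach S R C k × i₀ ∈ R × Closed S R C)
  -- The fuel cannot run out: that would mean m + n ≤ k, whereas k + 1 = |R| + |C| ≤ m + n.
  grow zero {R} {C} {k} r i₀∈ ≤k = contradiction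
    (ℕ.≤-trans (ℕ.≤-reflexive (sym (reach-size r))) (ℕ.≤-trans (ℕ.+-mono-≤ (Subset.∣p∣≤n R) (Subset.∣p∣≤n C))
      (ℕ.≤-trans ≤k (ℕ.≤-reflexive (ℕ.+-identityʳ k))))) ℕ.1+n≰n
  grow (suc f) {R} {C} {k} r i₀∈ ≤k
    with Fin.any? (λ i → Fin.any? λ j → (j Subset.∈? lookup S i) ×-dec (i Subset.∈? R) ×-dec ¬? (j Subset.∈? C))
       | Fin.any? (λ i → Fin.any? λ j → (j Subset.∈? lookup S i) ×-dec (j Subset.∈? C) ×-dec ¬? (i Subset.∈? R))
  ... | yes (i , j , ij∈S , i∈R , j∉C) | _ =
    grow f (addColumn r i∈R j∉C ij∈S) i₀∈ (ℕ.≤-trans ≤k (ℕ.≤-reflexive (ℕ.+-suc k f)))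
  ... | no _ | yes (i , j , ij∈S , j∈C , i∉R) =
    grow f (addRow r j∈C i∉R ij∈S) (Subset.p⊆p∪q ⁅ i ⁆ i₀∈) (ℕ.≤-trans ≤k (ℕ.≤-reflexive (ℕ.+-suc k f)))
  ... | no ∄column | no ∄row = R , C , k , r , i₀∈ , λ i j ij∈S →
    (λ i∈R → decidable-stable (j Subset.∈? C) λ j∉C → ∄column (i , j , ij∈S , i∈R , j∉C)) ,
    (λ j∈C → decidable-stable (i Subset.∈? R) λ i∉R → ∄row (i , j , ij∈S , j∈C , i∉R))

-- Rows are emptied rather than deleted, so that both parts of a split keep the shape of the
-- original board.
inRows : Subset m → Board m n → Board m n
inRows = Vec.zipWith λ r T → if r then T else ∅

lookup-inRows : (R : Subset m) (S : Board m n) {i : Fin m} → i ∈ R → lookup (inRows R S) i ≡ lookup S i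
lookup-inRows R S {i} i∈ = trans (Vec.lookup-zipWith _ i R S)
    (cong (λ r → if r then lookup S i else ∅) (Vec.[]=⇒lookup i∈))

reach-inRows : {S : Board m n} {R R′ : Subset m} {C : Subset n} → Reach S R C k → R ⊆ R′ → Reach (inRows R′ S) R C k
reach-inRows (start i) R⊆ = start i
reach-inRows {S = S} {R′ = R′} (addColumn {j = j} r i∈ j∉ ij∈) R⊆ =
  addColumn (reach-inRows r R⊆) i∈ j∉ (subst (j ∈_) (sym (lookup-inRows R′ S (R⊆ i∈))) ij∈)
reach-inRows {S = S} {R′ = R′} (addRow {R = R} {i = i} {j} r j∈ i∉ ij∈) R⊆ =
  addRow (reach-inRows r (R⊆ ∘ Subset.p⊆p∪q ⁅ i ⁆)) j∈ i∉
    (subst (j ∈_) (sym (lookup-inRows R′ S (R⊆ (Subset.q⊆p∪q R ⁅ i ⁆ (Subset.x∈⁅x⁆ i))))) ij∈)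

-- The block form implied by `Closed`, stated row by row to suit recursion along the rows.
data Split {n : ℕ} (C : Subset n) : ∀ {m} → Subset m → Board m n → Set where
  []   : Split C [] []
  _∷ⁱ_ : ∀ {m T} {R : Subset m} {S} → T ⊆ C → Split C R S → Split C (inside ∷ R) (T ∷ S)
  _∷ᵒ_ : ∀ {m T} {R : Subset m} {S} → T ⊆ ∁ C → Split C R S → Split C (outside ∷ R) (T ∷ S)

closed⇒split : (S : Board m n) (R : Subset m) (C : Subset n) → Closed S R C → Split C R S
closed⇒split []      []            C closed = []
closed⇒split (T ∷ S) (inside ∷ R)  C closed = (λ {j} j∈ → proj₁ (closed zero j j∈) here) ∷ⁱ
  closed⇒split S R C λ i j ij∈ → (λ i∈ → proj₁ (closed (suc i) j ij∈) (there i∈)) , λ j∈ →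
      Subset.drop-there (proj₂ (closed (suc i) j ij∈) j∈)
closed⇒split (T ∷ S) (outside ∷ R) C closed =
  (λ {j} j∈ → Subset.x∉p⇒x∈∁p λ j∈C → contradiction (proj₂ (closed zero j j∈) j∈C) λ ()) ∷ᵒ
  closed⇒split S R C λ i j ij∈ → (λ i∈ → proj₁ (closed (suc i) j ij∈) (there i∈)) , λ j∈ →
      Subset.drop-there (proj₂ (closed (suc i) j ij∈) j∈)

split⇒columnsIn : {C : Subset n} {R : Subset m} {S : Board m n} → Split C R S → VecAll.All (_⊆ C) (inRows R S)
split⇒columnsIn []            = []
split⇒columnsIn (T⊆C ∷ⁱ s)    = T⊆C ∷ split⇒columnsIn s
split⇒columnsIn (_ ∷ᵒ s)      = Subset.⊥⊆ ∷ split⇒columnsIn s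

weight≤1 : (T : Subset n) → weight T ≤ 1
weight≤1 T with weight-cases T
... | inj₁ eq = ℕ.≤-trans (ℕ.≤-reflexive eq) ℕ.z≤n
... | inj₂ eq = ℕ.≤-reflexive eq

weight-∅ : ∀ n → weight (∅ {n}) ≡ 0
weight-∅ zero    = refl
weight-∅ (suc n) = weight-∅ n

weights-inRows : (R : Subset m) (S : Board m n) → weights (inRows R S) ≤ ∣ R ∣
weights-inRows []            []      = ℕ.z≤n
weights-inRows (inside ∷ R)  (T ∷ S) = ℕ.+-mono-≤ (weight≤1 T) (weights-inRows R S)
weights-inRows {n = n} (outside ∷ R) (T ∷ S) = ℕ.≤-trans
    (ℕ.≤-reflexive (cong (ℕ._+ weights (inRows R S)) (weight-∅ n))) (weights-inRows R S)

-- Convolutions of rank distributions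

convolution : ℕ → (ℕ → ℤ) → (ℕ → ℤ) → ℤ
convolution zero    f g = f 0 * g 0
convolution (suc d) f g = f 0 * g (suc d) + convolution d (f ∘ suc) g

convolution-cong : ∀ d {f f′ g g′ : ℕ → ℤ} → (∀ i → f i ≡ f′ i) → (∀ i → g i ≡ g′ i) → convolution d f g ≡
    convolution d f′ g′
convolution-cong zero    f≡ g≡ = cong₂ _*_ (f≡ 0) (g≡ 0)
convolution-cong (suc d) f≡ g≡ = cong₂ _+_ (cong₂ _*_ (f≡ 0) (g≡ (suc d))) (convolution-cong d (f≡ ∘ suc) g≡)

convolution-zero : ∀ d (f g : ℕ → ℤ) → (∀ i → f i ≡ 0ℤ) → convolution d f g ≡ 0ℤ
convolution-zero zero    f g f≡0 = cong (_* g 0) (f≡0 0)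
convolution-zero (suc d) f g f≡0 = cong₂ (λ a b → a * g (suc d) + b) (f≡0 0)
    (convolution-zero d (f ∘ suc) g (f≡0 ∘ suc))

convolution-δ : ∀ d r s → convolution d (λ i → ⟦ r ℕ.≟ i ⟧) (λ i → ⟦ s ℕ.≟ i ⟧) ≡ ⟦ r ℕ.+ s ℕ.≟ d ⟧
convolution-δ zero    zero    s = ℤ.*-identityˡ _
convolution-δ zero    (suc r) s = refl
convolution-δ (suc d) zero    s = trans
    (cong₂ _+_ (ℤ.*-identityˡ ⟦ s ℕ.≟ suc d ⟧) (convolution-zero d (λ i → ⟦ 0 ℕ.≟ suc i ⟧) (λ i → ⟦ s ℕ.≟ i ⟧) λ _ →
    refl)) (ℤ.+-identityʳ _)
convolution-δ (suc d) (suc r) s = trans (ℤ.+-identityˡ _) (trans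
  (convolution-cong d (λ i → ⟦⟧-cong (suc r ℕ.≟ suc i) (r ℕ.≟ i) ℕ.suc-injective (cong suc)) (λ _ → refl))
  (trans (convolution-δ d r s) (⟦⟧-cong (r ℕ.+ s ℕ.≟ d) (suc (r ℕ.+ s) ℕ.≟ suc d) (cong suc) ℕ.suc-injective)))

convolution-∑ˡ : ∀ d (as : List A) (w : A → ℤ) (f : A → ℕ → ℤ) (g : ℕ → ℤ) →
  (∑[ a ← as ] w a * convolution d (f a) g) ≡ convolution d (λ i → ∑[ a ← as ] w a * f a i) g
convolution-∑ˡ zero    as w f g = trans (∑-cong as λ a → sym (ℤ.*-assoc (w a) _ _)) (∑-*ʳ (g 0) as _)
convolution-∑ˡ (suc d) as w f g = trans (∑-cong as λ a → lemma (w a) (f a 0) (g (suc d)) _)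
  (trans (∑-+ as (λ a → w a * f a 0 * g (suc d)) (λ a → w a * convolution d (f a ∘ suc) g))
    (cong₂ _+_ (∑-*ʳ (g (suc d)) as _) (convolution-∑ˡ d as w (λ a → f a ∘ suc) g)))
  where
  lemma : ∀ w f g c → w * (f * g + c) ≡ w * f * g + w * c
  lemma = solve-∀

convolution-∑ʳ : ∀ d (as : List A) (w : A → ℤ) (f : ℕ → ℤ) (g : A → ℕ → ℤ) →
  (∑[ a ← as ] w a * convolution d f (g a)) ≡ convolution d f (λ i → ∑[ a ← as ] w a * g a i)
convolution-∑ʳ zero    as w f g = trans (∑-cong as λ a → lemma (w a) (f 0) (g a 0)) (∑-*ˡ (f 0) as _)
  where
  lemma : ∀ w f g → w * (f * g) ≡ f * (w * g)
  lemma = solve-∀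
convolution-∑ʳ (suc d) as w f g = trans (∑-cong as λ a → lemma (w a) (f 0) (g a (suc d)) _)
  (trans (∑-+ as (λ a → f 0 * (w a * g a (suc d))) (λ a → w a * convolution d (f ∘ suc) (g a)))
    (cong₂ _+_ (∑-*ˡ (f 0) as _) (convolution-∑ʳ d as w (f ∘ suc) g)))
  where
  lemma : ∀ w f g c → w * (f * g + c) ≡ f * (w * g) + w * c
  lemma = solve-∀

module Torus {q : ℕ} (F : FiniteField q) where

  open Ranks F public
  open Subspace

  scaleRow : Fin m → K → Mat m n → Mat m n
  scaleRow i b A = Vec.updateAt A i (Vec.map (b ·_))

  scaleColumn : Fin n → K → Mat m n → Mat m n
  scaleColumn j b A = Vec.map (λ a → Vec.updateAt a j (b ·_)) A

  ·≡0 : ∀ {a b} → b ≢ 0# → b · a ≡ 0# → a ≡ 0#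
  ·≡0 {a} {b} b≢0 ba≡0 = begin
    a                              ≡⟨ K.*-identityˡ a ⟨
    1# · a                         ≡⟨ cong (_· a) (proj₂ (inverse b≢0)) ⟨
    proj₁ (inverse b≢0) · b · a    ≡⟨ K.*-assoc _ b a ⟩
    proj₁ (inverse b≢0) · (b · a)  ≡⟨ cong (proj₁ (inverse b≢0) ·_) ba≡0 ⟩
    proj₁ (inverse b≢0) · 0#       ≡⟨ K.zeroʳ _ ⟩
    0#                             ∎

  nonZero-scale : ∀ {b} → b ≢ 0# → ∀ a → not (does (b · a ≟ᴷ 0#)) ≡ not (does (a ≟ᴷ 0#))
  nonZero-scale {b} b≢0 a = cong not (does-⇔ (mk⇔ (·≡0 b≢0) λ { refl → K.zeroʳ b }) (b · a ≟ᴷ 0#) (a ≟ᴷ 0#))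

  support-map : ∀ {b} → b ≢ 0# → (a : Vec K n) → support (Vec.map (b ·_) a) ≡ support a
  support-map b≢0 []      = refl
  support-map b≢0 (a ∷ as) = cong₂ _∷_ (nonZero-scale b≢0 a) (support-map b≢0 as)

  support-updateAt : ∀ {b} → b ≢ 0# → (j : Fin n) (a : Vec K n) → support (Vec.updateAt a j (b ·_)) ≡ support a
  support-updateAt b≢0 zero    (a ∷ as) = cong (_∷ support as) (nonZero-scale b≢0 a)
  support-updateAt b≢0 (suc j) (a ∷ as) = cong (_ ∷_) (support-updateAt b≢0 j as)

  support-scaleRow : ∀ {b} → b ≢ 0# → (i : Fin m) (A : Mat m n) → Vec.map support (scaleRow i b A) ≡ Vec.map support A
  support-scaleRow b≢0 zero    (a ∷ A) = cong (_∷ Vec.map support A) (support-map b≢0 a)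
  support-scaleRow b≢0 (suc i) (a ∷ A) = cong (support a ∷_) (support-scaleRow b≢0 i A)

  support-scaleColumn : ∀ {b} → b ≢ 0# → (j : Fin n) (A : Mat m n) → Vec.map support (scaleColumn j b A) ≡
      Vec.map support A
  support-scaleColumn b≢0 j []      = refl
  support-scaleColumn b≢0 j (a ∷ A) = cong₂ _∷_ (support-updateAt b≢0 j a) (support-scaleColumn b≢0 j A)

  dot-map : (b s : K) (a c : Vec K n) → dot (b · s) (Vec.map (b ·_) a) c ≡ b · dot s a c
  dot-map b s []      []      = refl
  dot-map b s (a ∷ as) (c ∷ cs) = trans (cong (λ t → dot t (Vec.map (b ·_) as) cs)
    (S.solve 4 (λ b s a c → b S.:* s S.:+ b S.:* a S.:* c S.:= b S.:* (s S.:+ a S.:* c)) refl b s a c))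
        (dot-map b (s ⊹ a · c) as cs)

  dot-updateAt : (j : Fin n) (b s : K) (a c : Vec K n) → dot s (Vec.updateAt a j (b ·_)) c ≡
      dot s a (Vec.updateAt c j (b ·_))
  dot-updateAt zero    b s (a ∷ as) (c ∷ cs) = cong (λ t → dot (s ⊹ t) as cs)
    (S.solve 3 (λ b a c → b S.:* a S.:* c S.:= a S.:* (b S.:* c)) refl b a c)
  dot-updateAt (suc j) b s (a ∷ as) (c ∷ cs) = dot-updateAt j b (s ⊹ a · c) as cs

  kills-scaleRow : ∀ {b} → b ≢ 0# → (i : Fin m) (A : Mat m n) (c : Vec K n) → kills (scaleRow i b A) c ≡ kills A c
  kills-scaleRow {b = b} b≢0 zero    (a ∷ A) c = cong (_* kills A c) (trans
    (cong (λ t → ⟦ t ≟ᴷ 0# ⟧) (trans (cong (λ s → dot s (Vec.map (b ·_) a) c) (sym (K.zeroʳ b))) (dot-map b 0# a c)))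
    (⟦⟧-cong (b · dot 0# a c ≟ᴷ 0#) (dot 0# a c ≟ᴷ 0#) (·≡0 b≢0) λ eq → trans (cong (b ·_) eq) (K.zeroʳ b)))
  kills-scaleRow         b≢0 (suc i) (a ∷ A) c = cong (⟦ dot 0# a c ≟ᴷ 0# ⟧ *_) (kills-scaleRow b≢0 i A c)

  kills-scaleColumn : (j : Fin n) (b : K) (A : Mat m n) (c : Vec K n) → kills (scaleColumn j b A) c ≡
      kills A (Vec.updateAt c j (b ·_))
  kills-scaleColumn j b []      c = refl
  kills-scaleColumn j b (a ∷ A) c = cong₂ (λ t s → ⟦ t ≟ᴷ 0# ⟧ * s) (dot-updateAt j b 0# a c)
      (kills-scaleColumn j b A c)

  updateAt-inverse : (j : Fin n) {b b′ : K} → b · b′ ≡ 1# → (c : Vec K n) → Vec.updateAt (Vec.updateAt c j (b′ ·_)) j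
      (b ·_) ≡ c
  updateAt-inverse zero    {b} {b′} eq (c ∷ cs) = cong (_∷ cs)
      (trans (sym (K.*-assoc b b′ c)) (trans (cong (_· c) eq) (K.*-identityˡ c)))
  updateAt-inverse (suc j) eq (c ∷ cs) = cong (c ∷_) (updateAt-inverse j eq cs)

  map-inverse : {b b′ : K} → b · b′ ≡ 1# → (c : Vec K n) → Vec.map (b ·_) (Vec.map (b′ ·_) c) ≡ c
  map-inverse          eq []      = refl
  map-inverse {b = b} {b′} eq (c ∷ cs) = cong₂ _∷_
      (trans (sym (K.*-assoc b b′ c)) (trans (cong (_· c) eq) (K.*-identityˡ c))) (map-inverse eq cs)

  scaleRow-inverse : (i : Fin m) {b b′ : K} → b · b′ ≡ 1# → (A : Mat m n) → scaleRow i b (scaleRow i b′ A) ≡ A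
  scaleRow-inverse zero    eq (a ∷ A) = cong (_∷ A) (map-inverse eq a)
  scaleRow-inverse (suc i) eq (a ∷ A) = cong (a ∷_) (scaleRow-inverse i eq A)

  scaleColumn-inverse : (j : Fin n) {b b′ : K} → b · b′ ≡ 1# → (A : Mat m n) → scaleColumn j b (scaleColumn j b′ A) ≡
      A
  scaleColumn-inverse j eq []      = refl
  scaleColumn-inverse j eq (a ∷ A) = cong₂ _∷_ (updateAt-inverse j eq a) (scaleColumn-inverse j eq A)

  kernelSize⇒rk : ∀ {m′} (A : Mat m n) (A′ : Mat m′ n) → kernelSize A ≡ kernelSize A′ → rk A ≡ rk A′
  kernelSize⇒rk {n = n} A A′ eq = cong (n ∸_)
      (q^-injective {null A} {null A′} (trans (sym (kernelSize-null A)) (trans eq (kernelSize-null A′))))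

  rk-scaleRow : ∀ {b} → b ≢ 0# → (i : Fin m) (A : Mat m n) → rk (scaleRow i b A) ≡ rk A
  rk-scaleRow {n = n} b≢0 i A = kernelSize⇒rk (scaleRow i _ A) A (∑-cong (space n) (kills-scaleRow b≢0 i A))

  rk-scaleColumn : ∀ {b} → b ≢ 0# → (j : Fin n) (A : Mat m n) → rk (scaleColumn j b A) ≡ rk A
  rk-scaleColumn {n = n} {b = b} b≢0 j A = kernelSize⇒rk (scaleColumn j b A) A
      (trans (∑-cong (space n) (kills-scaleColumn j b A))
    (∑-bijection (finiteSpace n) (finiteSpace n) (λ c → Vec.updateAt c j (b ·_)) (λ c → Vec.updateAt c j (b′ ·_))
      (updateAt-inverse j b′b≡1) (updateAt-inverse j (trans (K.*-comm b b′) b′b≡1)) (kills A)))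
    where
    b′ = proj₁ (inverse b≢0)
    b′b≡1 = proj₂ (inverse b≢0)

  -- The scaling by b ≠ 0 carries the fibre of φ over 1 bijectively onto the fibre over b and
  -- preserves g. The x nonzero fibres therefore contribute equally, and the fibre over 0
  -- contributes nothing.
  ∑-slice : {M : Set} (𝕄 : Finite M) (σ : K → M → M) → (∀ {b b′} → b · b′ ≡ 1# → ∀ A → σ b (σ b′ A) ≡ A) →
            (φ : M → K) → (∀ b A → φ (σ b A) ≡ b · φ A) → (g : M → ℤ) → (∀ {b} → b ≢ 0# → ∀ A → g (σ b A) ≡ g A) →
            (∀ A → φ A ≡ 0# → g A ≡ 0ℤ) → ∑ (Finite.elems 𝕄) g ≡ x * (∑[ A ← Finite.elems 𝕄 ] ⟦ φ A ≟ᴷ 1# ⟧ * g A)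
  ∑-slice 𝕄 σ σ-inverse φ φ-σ g g-σ g-zero = begin
    ∑ M.elems g
      ≡⟨ ∑-fibres finiteK M.elems φ g ⟩
    (∑[ a ← elements ] ∑[ A ← M.elems ] ⟦ φ A ≟ᴷ a ⟧ * g A)
      ≡⟨ ∑-cong elements (λ a → fibre a (0# ≟ᴷ a)) ⟩
    (∑[ a ← elements ] (1ℤ + - 1ℤ * ⟦ 0# ≟ᴷ a ⟧) * s)
      ≡⟨ trans (∑-*ʳ s elements _) (cong (_* s) (trans (∑-+ elements (λ _ → 1ℤ) (λ a → - 1ℤ * ⟦ 0# ≟ᴷ a ⟧))
           (cong₂ _+_ ∑-1 (trans (∑-*ˡ (- 1ℤ) elements _) (cong (- 1ℤ *_) (Finite.once finiteK 0#)))))) ⟩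
    x * s ∎
    where
    module M = Finite 𝕄
    s = ∑[ A ← M.elems ] ⟦ φ A ≟ᴷ 1# ⟧ * g A
    fibre : ∀ a (d : Dec (0# ≡ a)) → (∑[ A ← M.elems ] ⟦ φ A ≟ᴷ a ⟧ * g A) ≡ (1ℤ + - 1ℤ * ⟦ d ⟧) * s
    fibre a (yes refl) = trans (∑-cong M.elems λ A → trans (⟦⟧-*-cong (φ A ≟ᴷ 0#) (g-zero A))
        (ℤ.*-zeroʳ ⟦ φ A ≟ᴷ 0# ⟧)) (∑-zero M.elems)
    fibre a (no 0≢a) = trans
        (sym (∑-bijection 𝕄 𝕄 (σ a) (σ a′) (σ-inverse a′a≡1) (σ-inverse (trans (K.*-comm a a′) a′a≡1)) _))
      (trans (∑-cong M.elems λ A → cong₂ _*_ (⟦⟧-cong (φ (σ a A) ≟ᴷ a) (φ A ≟ᴷ 1#) (to A) (from A)) (g-σ a≢0 A))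
          (sym (ℤ.*-identityˡ s)))
      where
      a≢0 : a ≢ 0#
      a≢0 = 0≢a ∘ sym
      a′ = proj₁ (inverse a≢0)
      a′a≡1 = proj₂ (inverse a≢0)
      from : ∀ A → φ A ≡ 1# → φ (σ a A) ≡ a
      from A eq = trans (φ-σ a A) (trans (cong (a ·_) eq) (K.*-identityʳ a))
      to : ∀ A → φ (σ a A) ≡ a → φ A ≡ 1#
      to A eq = begin
        φ A               ≡⟨ K.*-identityˡ (φ A) ⟨
        1# · φ A          ≡⟨ cong (_· φ A) a′a≡1 ⟨
        a′ · a · φ A      ≡⟨ K.*-assoc a′ a (φ A) ⟩
        a′ · (a · φ A)    ≡⟨ cong (a′ ·_) (trans (sym (φ-σ a A)) eq) ⟩
        a′ · a            ≡⟨ a′a≡1 ⟩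
        1#                ∎

  entryAt : Fin m → Fin n → Mat m n → K
  entryAt i j A = lookup (lookup A i) j

  entry-scaleRow : ∀ i j b (A : Mat m n) → entryAt i j (scaleRow i b A) ≡ b · entryAt i j A
  entry-scaleRow i j b A = trans (cong (λ a → lookup a j) (Vec.lookup∘updateAt i A))
      (Vec.lookup-map j (b ·_) (lookup A i))

  entry-scaleRow′ : ∀ i i′ j b (A : Mat m n) → i ≢ i′ → entryAt i j (scaleRow i′ b A) ≡ entryAt i j A
  entry-scaleRow′ i i′ j b A i≢i′ = cong (λ a → lookup a j) (Vec.lookup∘updateAt′ i i′ i≢i′ A)

  entry-scaleColumn : ∀ i j b (A : Mat m n) → entryAt i j (scaleColumn j b A) ≡ b · entryAt i j A
  entry-scaleColumn i j b A = trans (cong (λ a → lookup a j) (Vec.lookup-map i _ A))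
      (Vec.lookup∘updateAt j (lookup A i))

  entry-scaleColumn′ : ∀ i j j′ b (A : Mat m n) → j ≢ j′ → entryAt i j (scaleColumn j′ b A) ≡ entryAt i j A
  entry-scaleColumn′ i j j′ b A j≢j′ = trans (cong (λ a → lookup a j) (Vec.lookup-map i _ A))
      (Vec.lookup∘updateAt′ j j′ j≢j′ (lookup A i))

  -- The symmetry left over once the entries along a tree on R and C are normalised: scalings of
  -- rows and columns not yet in the tree.
  record Invariant (S : Board m n) (R : Subset m) (C : Subset n) (g : Mat m n → ℤ) : Set where
    field
      rows    : ∀ i {b} → b ≢ 0# → i ∉ R → ∀ A → g (scaleRow i b A) ≡ g A
      columns : ∀ j {b} → b ≢ 0# → j ∉ C → ∀ A → g (scaleColumn j b A) ≡ g A
      off     : ∀ A → Vec.map support A ≢ S → g A ≡ 0ℤ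

  ofRank : Board m n → ℕ → Mat m n → ℤ
  ofRank S d A = hasSupport S A * ⟦ rk A ℕ.≟ d ⟧

  count : Board m n → ℕ → ℤ
  count {m} {n} S d = ∑ (matrices m n) (ofRank S d)

  finiteMat : ∀ m n → Finite (Mat m n)
  finiteMat m n = vecFinite (finiteSpace n) m

  entry-off : {S : Board m n} {i : Fin m} {j : Fin n} (A : Mat m n) → j ∈ lookup S i → entryAt i j A ≡ 0# →
      Vec.map support A ≢ S
  entry-off {i = i} {j} A ij∈ eq refl = contradiction (trans (sym (Vec.[]=⇒lookup ij∈))
    (trans (cong (λ T → lookup T j) (Vec.lookup-map i support A))
        (trans (Vec.lookup-map j _ (lookup A i)) (cong not (dec-true (entryAt i j A ≟ᴷ 0#) eq))))) λ ()

  private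
    slice-off : {S : Board m n} {R : Subset m} {C : Subset n} {g : Mat m n → ℤ} (i : Fin m) (j : Fin n) →
      Invariant S R C g → ∀ A → Vec.map support A ≢ S → ⟦ entryAt i j A ≟ᴷ 1# ⟧ * g A ≡ 0ℤ
    slice-off i j inv A ≢S =
      trans (cong (⟦ entryAt i j A ≟ᴷ 1# ⟧ *_) (Invariant.off inv A ≢S)) (ℤ.*-zeroʳ ⟦ entryAt i j A ≟ᴷ 1# ⟧)

    x-shift : ∀ a x s → a * (x * s) ≡ x * a * s
    x-shift = solve-∀

  -- A new tree edge has exactly one new endpoint, whose scaling is still available. It is spent on
  -- normalising the entry at that edge to 1, nonzero since it lies in the support, and this
  -- releases one factor x. The function g ends up restricted to matrices with entries 1 along the
  -- tree.
  reach-divides : {S : Board m n} {R : Subset m} {C : Subset n} (d : ℕ) → Reach S R C k →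
    ∃[ g ] (Invariant S R C g × count S d ≡ x ^ k * ∑ (matrices m n) g)
  reach-divides {S = S} d (start i) = ofRank S d , record
    { rows    = λ i b≢0 _ A → cong₂ (λ T r → ⟦ T ≟ᴮ S ⟧ * ⟦ r ℕ.≟ d ⟧) (support-scaleRow b≢0 i A)
        (rk-scaleRow b≢0 i A)
    ; columns = λ j b≢0 _ A → cong₂ (λ T r → ⟦ T ≟ᴮ S ⟧ * ⟦ r ℕ.≟ d ⟧) (support-scaleColumn b≢0 j A)
        (rk-scaleColumn b≢0 j A)
    ; off     = λ A ≢S → cong (_* ⟦ rk A ℕ.≟ d ⟧) (⟦⟧-false (Vec.map support A ≟ᴮ S) ≢S)
    } , sym (ℤ.*-identityˡ _)
  reach-divides {m} {n} {suc k} d (addColumn {R} {C} {k} {i} {j} r i∈ j∉ ij∈) with reach-divides d r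
  ... | g , inv , eq = (λ A → ⟦ entryAt i j A ≟ᴷ 1# ⟧ * g A) , record
    { rows    = λ i′ b≢0 i′∉ A → cong₂ (λ e s → ⟦ e ≟ᴷ 1# ⟧ * s)
        (entry-scaleRow′ i i′ j _ A λ { refl → i′∉ i∈ }) (Invariant.rows inv i′ b≢0 i′∉ A)
    ; columns = λ j′ b≢0 j′∉ A → cong₂ (λ e s → ⟦ e ≟ᴷ 1# ⟧ * s)
        (entry-scaleColumn′ i j j′ _ A λ { refl → j′∉ (Subset.q⊆p∪q C ⁅ j ⁆ (Subset.x∈⁅x⁆ j)) })
        (Invariant.columns inv j′ b≢0 (j′∉ ∘ Subset.p⊆p∪q ⁅ j ⁆) A)
    ; off     = slice-off i j inv
    } , trans eq (trans (cong (x ^ k *_) (∑-slice (finiteMat m n) (scaleColumn j) (scaleColumn-inverse j)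
      (entryAt i j) (entry-scaleColumn i j) g (λ b≢0 → Invariant.columns inv j b≢0 j∉)
      λ A e≡0 → Invariant.off inv A (entry-off A ij∈ e≡0))) (x-shift (x ^ k) x _))
  reach-divides {m} {n} {suc k} d (addRow {R} {C} {k} {i} {j} r j∈ i∉ ij∈) with reach-divides d r
  ... | g , inv , eq = (λ A → ⟦ entryAt i j A ≟ᴷ 1# ⟧ * g A) , record
    { rows    = λ i′ b≢0 i′∉ A → cong₂ (λ e s → ⟦ e ≟ᴷ 1# ⟧ * s)
        (entry-scaleRow′ i i′ j _ A λ { refl → i′∉ (Subset.q⊆p∪q R ⁅ i ⁆ (Subset.x∈⁅x⁆ i)) })
        (Invariant.rows inv i′ b≢0 (i′∉ ∘ Subset.p⊆p∪q ⁅ i ⁆) A)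
    ; columns = λ j′ b≢0 j′∉ A → cong₂ (λ e s → ⟦ e ≟ᴷ 1# ⟧ * s)
        (entry-scaleColumn′ i j j′ _ A λ { refl → j′∉ j∈ }) (Invariant.columns inv j′ b≢0 j′∉ A)
    ; off     = slice-off i j inv
    } , trans eq (trans (cong (x ^ k *_) (∑-slice (finiteMat m n) (scaleRow i) (scaleRow-inverse i)
      (entryAt i j) (entry-scaleRow i j) g (λ b≢0 → Invariant.rows inv i b≢0 i∉)
      λ A e≡0 → Invariant.off inv A (entry-off A ij∈ e≡0))) (x-shift (x ^ k) x _))

-- Splitting a matrix into blocks

module Splitting {q : ℕ} (F : FiniteField q) where

  open Torus F public
  open Subspace

  mask : Subset m → Mat m n → Mat m n
  mask = Vec.zipWith λ r a → if r then a else 𝟎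

  support-𝟎 : ∀ n → support (𝟎 {n}) ≡ ∅
  support-𝟎 zero    = refl
  support-𝟎 (suc n) = cong₂ _∷_ (cong not (dec-true (0# ≟ᴷ 0#) refl)) (support-𝟎 n)

  ∑-support-∅ : (g : Vec K n → ℤ) → (∑[ a ← space n ] ⟦ support a ≟ˢ ∅ ⟧ * g a) ≡ g 𝟎
  ∑-support-∅ {n} g = trans (∑-cong (space n) λ a → cong (_* g a) (⟦⟧-cong (support a ≟ˢ ∅) (𝟎 ≟ⱽ a)
      (λ eq → sym (support-empty a (trans (cong weight eq) (weight-∅ n)))) λ { refl → support-𝟎 n }))
    (Finite.∑-δ (finiteSpace n) 𝟎 g)

  hasSupport-∷ : (T : Subset n) (S : Board m n) (a : Vec K n) (A : Mat m n) →
                 hasSupport (T ∷ S) (a ∷ A) ≡ ⟦ support a ≟ˢ T ⟧ * hasSupport S A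
  hasSupport-∷ T S a A = bit-∧ (does (support a ≟ˢ T)) _

  -- A matrix with support S amounts to a pair with complementary nonzero rows: in every row, one of
  -- the two is forced to be 0.
  ∑-split : (R : Subset m) (S : Board m n) (h : Mat m n → Mat m n → ℤ) →
    (∑[ A ← matrices m n ] hasSupport (inRows R S) A * (∑[ E ← matrices m n ] hasSupport (inRows (∁ R) S) E * h A E))
        ≡
    (∑[ A ← matrices m n ] hasSupport S A * h (mask R A) (mask (∁ R) A))
  ∑-split []      []      h = cong (λ s → 1ℤ * s + 0ℤ)
      (trans (ℤ.+-identityʳ (1ℤ * h [] [])) (ℤ.*-identityˡ (h [] [])))
  ∑-split {suc m} {n} (r ∷ R) (T ∷ S) h = begin
    (∑[ A ← matrices (suc m) n ] hasSupport (inRows (r ∷ R) (T ∷ S)) A *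
        (∑[ E ← matrices (suc m) n ] hasSupport (inRows (∁ (r ∷ R)) (T ∷ S)) E * h A E))
      ≡⟨ ∑-vectors (space n) m _ ⟩
    (∑[ a ← space n ] ∑[ A ← matrices m n ] hasSupport (inRows (r ∷ R) (T ∷ S)) (a ∷ A) *
        (∑[ E ← matrices (suc m) n ] hasSupport (inRows (∁ (r ∷ R)) (T ∷ S)) E * h (a ∷ A) E))
      ≡⟨ ∑-cong (space n) (λ a → trans (∑-cong (matrices m n) λ A → cong₂ _*_ (hasSupport-∷ T₁ S₁ a A) (inner a A))
          (outer a)) ⟩
    (∑[ a ← space n ] ⟦ support a ≟ˢ T₁ ⟧ * (∑[ e ← space n ] ⟦ support e ≟ˢ T₂ ⟧ *
      (∑[ A ← matrices m n ] hasSupport S A * h (a ∷ mask R A) (e ∷ mask (∁ R) A))))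
      ≡⟨ head r (λ a e → ∑[ A ← matrices m n ] hasSupport S A * h (a ∷ mask R A) (e ∷ mask (∁ R) A)) ⟩
    (∑[ a ← space n ] ⟦ support a ≟ˢ T ⟧ * (∑[ A ← matrices m n ] hasSupport S A * h (mask (r ∷ R) (a ∷ A))
        (mask (∁ (r ∷ R)) (a ∷ A))))
      ≡⟨ ∑-cong (space n) (λ a → trans (sym (∑-*ˡ ⟦ support a ≟ˢ T ⟧ (matrices m n) _)) (∑-cong (matrices m n) λ A →
           trans (sym (ℤ.*-assoc ⟦ support a ≟ˢ T ⟧ (hasSupport S A) _))
               (cong (_* h (mask (r ∷ R) (a ∷ A)) (mask (∁ (r ∷ R)) (a ∷ A))) (sym (hasSupport-∷ T S a A))))) ⟩
    (∑[ a ← space n ] ∑[ A ← matrices m n ] hasSupport (T ∷ S) (a ∷ A) * h (mask (r ∷ R) (a ∷ A))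
        (mask (∁ (r ∷ R)) (a ∷ A)))
      ≡⟨ ∑-vectors (space n) m _ ⟨
    (∑[ A ← matrices (suc m) n ] hasSupport (T ∷ S) A * h (mask (r ∷ R) A) (mask (∁ (r ∷ R)) A)) ∎
    where
    T₁ = if r then T else ∅
    T₂ = if not r then T else ∅
    S₁ = inRows R S
    S₂ = inRows (∁ R) S
    inner : ∀ a A → (∑[ E ← matrices (suc m) n ] hasSupport (inRows (∁ (r ∷ R)) (T ∷ S)) E * h (a ∷ A) E) ≡
            (∑[ e ← space n ] ⟦ support e ≟ˢ T₂ ⟧ * (∑[ E ← matrices m n ] hasSupport S₂ E * h (a ∷ A) (e ∷ E)))
    inner a A = trans (∑-vectors (space n) m _) (∑-cong (space n) λ e → trans
      (∑-cong (matrices m n) λ E → trans (cong (_* h (a ∷ A) (e ∷ E)) (hasSupport-∷ T₂ S₂ e E))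
          (ℤ.*-assoc ⟦ support e ≟ˢ T₂ ⟧ (hasSupport S₂ E) _))
      (∑-*ˡ ⟦ support e ≟ˢ T₂ ⟧ (matrices m n) _))
    rearrange : ∀ a b c d → a * b * (c * d) ≡ a * (c * (b * d))
    rearrange = solve-∀
    outer : ∀ a → (∑[ A ← matrices m n ] ⟦ support a ≟ˢ T₁ ⟧ * hasSupport S₁ A *
        (∑[ e ← space n ] ⟦ support e ≟ˢ T₂ ⟧ * (∑[ E ← matrices m n ] hasSupport S₂ E * h (a ∷ A) (e ∷ E)))) ≡
            ⟦ support a ≟ˢ T₁ ⟧ *
                (∑[ e ← space n ] ⟦ support e ≟ˢ T₂ ⟧ * (∑[ A ← matrices m n ] hasSupport S A * h (a ∷ mask R A)
                (e ∷ mask (∁ R) A)))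
    outer a = begin
      (∑[ A ← matrices m n ] w * hasSupport S₁ A * (∑[ e ← space n ] v e * u A e))
        ≡⟨ ∑-cong (matrices m n) (λ A → trans (sym (∑-*ˡ (w * hasSupport S₁ A) (space n) _))
            (∑-cong (space n) λ e → rearrange w (hasSupport S₁ A) (v e) (u A e))) ⟩
      (∑[ A ← matrices m n ] ∑[ e ← space n ] w * (v e * (hasSupport S₁ A * u A e)))
        ≡⟨ trans (∑-swap (matrices m n) (space n) _)
            (trans (∑-cong (space n) λ e → trans (∑-*ˡ w (matrices m n) _)
            (cong (w *_) (∑-*ˡ (v e) (matrices m n) _))) (∑-*ˡ w (space n) _)) ⟩
      w * (∑[ e ← space n ] v e * (∑[ A ← matrices m n ] hasSupport S₁ A * u A e))
        ≡⟨ cong (w *_) (∑-cong (space n) λ e → cong (v e *_) (∑-split R S (λ A E → h (a ∷ A) (e ∷ E)))) ⟩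
      w * (∑[ e ← space n ] v e * (∑[ A ← matrices m n ] hasSupport S A * h (a ∷ mask R A) (e ∷ mask (∁ R) A))) ∎
      where
      w = ⟦ support a ≟ˢ T₁ ⟧
      v : Vec K n → ℤ
      v e = ⟦ support e ≟ˢ T₂ ⟧
      u : Mat m n → Vec K n → ℤ
      u A e = ∑[ E ← matrices m n ] hasSupport S₂ E * h (a ∷ A) (e ∷ E)
    head : ∀ r (H : Vec K n → Vec K n → ℤ) →
      (∑[ a ← space n ] ⟦ support a ≟ˢ (if r then T else ∅) ⟧ *
          (∑[ e ← space n ] ⟦ support e ≟ˢ (if not r then T else ∅) ⟧ * H a e)) ≡
      (∑[ a ← space n ] ⟦ support a ≟ˢ T ⟧ * H (if r then a else 𝟎) (if not r then a else 𝟎))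
    head true  H = ∑-cong (space n) λ a → cong (⟦ support a ≟ˢ T ⟧ *_) (∑-support-∅ (H a))
    head false H = ∑-support-∅ (λ a → ∑[ e ← space n ] ⟦ support e ≟ˢ T ⟧ * H a e)

  mix : Subset n → Vec K n → Vec K n → Vec K n
  mix []            []       []       = []
  mix (inside ∷ C)  (c ∷ cs) (e ∷ es) = c ∷ mix C cs es
  mix (outside ∷ C) (c ∷ cs) (e ∷ es) = e ∷ mix C cs es

  -- Of the 2n coordinates of the pair, `mix` keeps n; the discarded ones range freely.
  ∑-mix : (C : Subset n) (f : Vec K n → ℤ) → (∑[ c ← space n ] ∑[ e ← space n ] f (mix C c e)) ≡ q^ n * ∑ (space n) f
  ∑-mix []            f = trans (ℤ.+-identityʳ _) (sym (ℤ.*-identityˡ _))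
  ∑-mix {suc n} (s ∷ C) f = begin
    (∑[ c ← space (suc n) ] ∑[ e ← space (suc n) ] f (mix (s ∷ C) c e))
      ≡⟨ trans (∑-vectors elements n _) (∑-cong elements λ a → trans (∑-cong (space n) λ c → ∑-vectors elements n _)
          (∑-swap (space n) elements _)) ⟩
    (∑[ a ← elements ] ∑[ b ← elements ] ∑[ c ← space n ] ∑[ e ← space n ] f (mix (s ∷ C) (a ∷ c) (b ∷ e)))
      ≡⟨ head s ⟩
    + q * (∑[ a ← elements ] q^ n * (∑[ c ← space n ] f (a ∷ c)))
      ≡⟨ trans (cong (+ q *_) (∑-*ˡ (q^ n) elements _)) (sym (ℤ.*-assoc (+ q) (q^ n) _)) ⟩
    q^ suc n * (∑[ a ← elements ] ∑[ c ← space n ] f (a ∷ c))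
      ≡⟨ cong (q^ suc n *_) (∑-vectors elements n f) ⟨
    q^ suc n * ∑ (space (suc n)) f ∎
    where
    head : ∀ s → (∑[ a ← elements ] ∑[ b ← elements ] ∑[ c ← space n ] ∑[ e ← space n ] f
        (mix (s ∷ C) (a ∷ c) (b ∷ e))) ≡
                 + q * (∑[ a ← elements ] q^ n * (∑[ c ← space n ] f (a ∷ c)))
    head inside  = trans (∑-cong elements λ a → ∑-const _)
        (trans (∑-*ˡ (+ q) elements _) (cong (+ q *_) (∑-cong elements λ a → ∑-mix C (f ∘ (a ∷_)))))
    head outside = trans (∑-const _) (cong (+ q *_) (∑-cong elements λ b → ∑-mix C (f ∘ (b ∷_))))

  support-head : ∀ {a : K} {as : Vec K n} {C : Subset n} → support (a ∷ as) ⊆ outside ∷ C → a ≡ 0#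
  support-head {a = a} {as} ⊆C with a ≟ᴷ 0#
  ... | yes a≡0 = a≡0
  ... | no  a≢0 = contradiction (⊆C (Vec.lookup⇒[]= zero (support (a ∷ as)) (cong not (dec-false (a ≟ᴷ 0#) a≢0))))
      λ ()

  dot-mix : (C : Subset n) (s : K) (a c e : Vec K n) → support a ⊆ C → dot s a (mix C c e) ≡ dot s a c
  dot-mix []            s []       []       []       ⊆C = refl
  dot-mix (inside ∷ C)  s (a ∷ as) (c ∷ cs) (e ∷ es) ⊆C = dot-mix C (s ⊹ a · c) as cs es (Subset.drop-∷-⊆ ⊆C)
  dot-mix (outside ∷ C) s (a ∷ as) (c ∷ cs) (e ∷ es) ⊆C with support-head {as = as} ⊆C
  ... | refl = trans (dot-mix C (s ⊹ 0# · e) as cs es (Subset.drop-∷-⊆ ⊆C))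
    (cong (λ t → dot (s ⊹ t) as cs) (trans (K.zeroˡ e) (sym (K.zeroˡ c))))

  mix-∁ : (C : Subset n) (c e : Vec K n) → mix (∁ C) e c ≡ mix C c e
  mix-∁ []            []       []       = refl
  mix-∁ (inside ∷ C)  (c ∷ cs) (e ∷ es) = cong (c ∷_) (mix-∁ C cs es)
  mix-∁ (outside ∷ C) (c ∷ cs) (e ∷ es) = cong (e ∷_) (mix-∁ C cs es)

  𝟎-row : (c : Vec K n) → ⟦ dot 0# 𝟎 c ≟ᴷ 0# ⟧ ≡ 1ℤ
  𝟎-row c = ⟦⟧-true (dot 0# 𝟎 c ≟ᴷ 0#) (𝟎-dot 0# c)

  kills-split : {C : Subset n} {R : Subset m} {S : Board m n} (A : Mat m n) → Vec.map support A ≡ S → Split C R S →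
      ∀ c e →
                kills (mask R A) c * kills (mask (∁ R) A) e ≡ kills A (mix C c e)
  kills-split []      refl []          c e = refl
  kills-split {C = C} (a ∷ A) refl (_∷ⁱ_ {R = R} T⊆ s) c e = begin
    ⟦ dot 0# a c ≟ᴷ 0# ⟧ * kills (mask R A) c * (⟦ dot 0# 𝟎 e ≟ᴷ 0# ⟧ * kills (mask (∁ R) A) e)
      ≡⟨ trans (cong (λ s → ⟦ dot 0# a c ≟ᴷ 0# ⟧ * kills (mask R A) c * (s * kills (mask (∁ R) A) e)) (𝟎-row e))
          (lemma ⟦ dot 0# a c ≟ᴷ 0# ⟧ (kills (mask R A) c) (kills (mask (∁ R) A) e)) ⟩
    ⟦ dot 0# a c ≟ᴷ 0# ⟧ * (kills (mask R A) c * kills (mask (∁ R) A) e)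
      ≡⟨ cong₂ (λ t s → ⟦ t ≟ᴷ 0# ⟧ * s) (sym (dot-mix C 0# a c e T⊆)) (kills-split A refl s c e) ⟩
    kills (a ∷ A) (mix C c e) ∎
    where
    lemma : ∀ a b c → a * b * (1ℤ * c) ≡ a * (b * c)
    lemma = solve-∀
  kills-split {C = C} (a ∷ A) refl (_∷ᵒ_ {R = R} T⊆ s) c e = begin
    ⟦ dot 0# 𝟎 c ≟ᴷ 0# ⟧ * kills (mask R A) c * (⟦ dot 0# a e ≟ᴷ 0# ⟧ * kills (mask (∁ R) A) e)
      ≡⟨ trans (cong (λ s → s * kills (mask R A) c * (⟦ dot 0# a e ≟ᴷ 0# ⟧ * kills (mask (∁ R) A) e)) (𝟎-row c))
          (lemma ⟦ dot 0# a e ≟ᴷ 0# ⟧ (kills (mask R A) c) (kills (mask (∁ R) A) e)) ⟩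
    ⟦ dot 0# a e ≟ᴷ 0# ⟧ * (kills (mask R A) c * kills (mask (∁ R) A) e)
      ≡⟨ cong₂ (λ t s → ⟦ t ≟ᴷ 0# ⟧ * s) (trans (sym (dot-mix (∁ C) 0# a e c T⊆)) (cong (dot 0# a) (mix-∁ C c e)))
          (kills-split A refl s c e) ⟩
    kills (a ∷ A) (mix C c e) ∎
    where
    lemma : ∀ a b c → 1ℤ * b * (a * c) ≡ a * (b * c)
    lemma = solve-∀

  -- The two masked matrices use disjoint sets of columns, so a pair of their kernel vectors amounts
  -- to a kernel vector of A together with n free coordinates. Hence the nullities add up to n +
  -- null A, and the ranks add.
  rk-split : {C : Subset n} {R : Subset m} {S : Board m n} (A : Mat m n) → Vec.map support A ≡ S → Split C R S →
             rk (mask R A) ℕ.+ rk (mask (∁ R) A) ≡ rk A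
  rk-split {n} {C = C} {R} A eq s = ranks (null≤n A₁) (null≤n A₂) (null≤n A) nulls
    where
    A₁ = mask R A
    A₂ = mask (∁ R) A
    kernelSizes : kernelSize A₁ * kernelSize A₂ ≡ q^ n * kernelSize A
    kernelSizes = begin
      kernelSize A₁ * kernelSize A₂
        ≡⟨ ∑-*ʳ (kernelSize A₂) (space n) (kills A₁) ⟨
      (∑[ c ← space n ] kills A₁ c * kernelSize A₂)
        ≡⟨ ∑-cong (space n) (λ c → trans (sym (∑-*ˡ (kills A₁ c) (space n) _))
            (∑-cong (space n) λ e → kills-split A eq s c e)) ⟩
      (∑[ c ← space n ] ∑[ e ← space n ] kills A (mix C c e))
        ≡⟨ ∑-mix C (kills A) ⟩
      q^ n * kernelSize A ∎
    nulls : null A₁ ℕ.+ null A₂ ≡ n ℕ.+ null A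
    nulls = q^-injective {null A₁ ℕ.+ null A₂} {n ℕ.+ null A} (begin
      q^ (null A₁ ℕ.+ null A₂)        ≡⟨ ℤ.^-distribˡ-+-* (+ q) (null A₁) (null A₂) ⟩
      q^ null A₁ * q^ null A₂         ≡⟨ cong₂ _*_ (kernelSize-null A₁) (kernelSize-null A₂) ⟨
      kernelSize A₁ * kernelSize A₂   ≡⟨ kernelSizes ⟩
      q^ n * kernelSize A             ≡⟨ cong (q^ n *_) (kernelSize-null A) ⟩
      q^ n * q^ null A                ≡⟨ ℤ.^-distribˡ-+-* (+ q) n (null A) ⟨
      q^ (n ℕ.+ null A)               ∎)
    ranks : ∀ {a b c} → a ≤ n → b ≤ n → c ≤ n → a ℕ.+ b ≡ n ℕ.+ c → n ∸ a ℕ.+ (n ∸ b) ≡ n ∸ c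
    ranks {a} {b} {c} a≤ b≤ c≤ eq = ℕ.+-cancelʳ-≡ (a ℕ.+ b) _ _ (begin
      n ∸ a ℕ.+ (n ∸ b) ℕ.+ (a ℕ.+ b)     ≡⟨ shuffle (n ∸ a) (n ∸ b) a b ⟩
      n ∸ a ℕ.+ a ℕ.+ (n ∸ b ℕ.+ b)       ≡⟨ cong₂ ℕ._+_ (ℕ.m∸n+n≡m a≤) (ℕ.m∸n+n≡m b≤) ⟩
      n ℕ.+ n                             ≡⟨ cong (n ℕ.+_) (ℕ.m∸n+n≡m c≤) ⟨
      n ℕ.+ (n ∸ c ℕ.+ c)                 ≡⟨ shuffle′ n (n ∸ c) c ⟩
      n ∸ c ℕ.+ (n ℕ.+ c)                 ≡⟨ cong (n ∸ c ℕ.+_) eq ⟨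
      n ∸ c ℕ.+ (a ℕ.+ b)                 ∎)
      where
      shuffle : ∀ u v a b → u ℕ.+ v ℕ.+ (a ℕ.+ b) ≡ u ℕ.+ a ℕ.+ (v ℕ.+ b)
      shuffle = solveℕ-∀
      shuffle′ : ∀ n u c → n ℕ.+ (u ℕ.+ c) ≡ u ℕ.+ (n ℕ.+ c)
      shuffle′ = solveℕ-∀

  count-split : {C : Subset n} {R : Subset m} {S : Board m n} → Split C R S → ∀ d →
                count S d ≡ convolution d (count (inRows R S)) (count (inRows (∁ R) S))
  count-split {n} {m} {C} {R} {S} s d = begin
    count S d
      ≡⟨ ∑-cong (matrices m n) (λ A → ⟦⟧-*-cong (Vec.map support A ≟ᴮ S) λ eq →
          cong (λ r → ⟦ r ℕ.≟ d ⟧) (sym (rk-split A eq s))) ⟩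
    (∑[ A ← matrices m n ] hasSupport S A * ⟦ rk (mask R A) ℕ.+ rk (mask (∁ R) A) ℕ.≟ d ⟧)
      ≡⟨ ∑-split R S (λ A E → ⟦ rk A ℕ.+ rk E ℕ.≟ d ⟧) ⟨
    (∑[ A ← matrices m n ] hasSupport S₁ A * (∑[ E ← matrices m n ] hasSupport S₂ E * ⟦ rk A ℕ.+ rk E ℕ.≟ d ⟧))
      ≡⟨ ∑-cong (matrices m n) (λ A → cong (hasSupport S₁ A *_) (trans
           (∑-cong (matrices m n) λ E → cong (hasSupport S₂ E *_) (sym (convolution-δ d (rk A) (rk E))))
           (convolution-∑ʳ d (matrices m n) (hasSupport S₂) (λ i → ⟦ rk A ℕ.≟ i ⟧) (λ E i → ⟦ rk E ℕ.≟ i ⟧)))) ⟩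
    (∑[ A ← matrices m n ] hasSupport S₁ A * convolution d (λ i → ⟦ rk A ℕ.≟ i ⟧) (count S₂))
      ≡⟨ convolution-∑ˡ d (matrices m n) (hasSupport S₁) (λ A i → ⟦ rk A ℕ.≟ i ⟧) (count S₂) ⟩
    convolution d (count S₁) (count S₂) ∎
    where
    S₁ = inRows R S
    S₂ = inRows (∁ R) S

Family : Set₁
Family = ∀ {q} → FiniteField q → ℤ

-- Divisibility and congruence of the counts

-- The expression is common to all fields, while the multiplier k may vary with the field. The
-- congruence concerns the quotient by xᵖ, because a rook number is such a quotient.
record Good (p : ℕ) (a : Family) : Set₁ where
  constructor good
  field
    expr    : Expr
    correct : ∀ {q} (F : FiniteField q) → let x = + q - 1ℤ in ∃[ k ] a F ≡ x ^ p * (value expr x + k * x ^ 6)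

private variable
  α β : Family
  d₁ d₂ : ℕ

good-cong : (∀ {q} (F : FiniteField q) → α F ≡ β F) → Good d₁ β → Good d₁ α
good-cong eq (good e correct) = good e λ F → let k , b≡ = correct F in k , trans (eq F) b≡

good-+ : Good d₁ α → Good d₁ β → Good d₁ (λ F → α F + β F)
good-+ {p} (good e e≡) (good f f≡) = good (e :+ f) λ {q} F →
  let k , a≡ = e≡ F ; l , b≡ = f≡ F ; x = + q - 1ℤ in
  k + l , trans (cong₂ _+_ a≡ b≡) (lemma (x ^ p) (value e x) (value f x) k l (x ^ 6))
  where
  lemma : ∀ p e f k l x → p * (e + k * x) + p * (f + l * x) ≡ p * (e + f + (k + l) * x)
  lemma = solve-∀

good-* : Good d₁ α → Good d₂ β → Good (d₁ ℕ.+ d₂) (λ F → α F * β F)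
good-* {p} {d₂ = r} (good e e≡) (good f f≡) = good (e :* f) λ {q} F →
  let k , a≡ = e≡ F ; l , b≡ = f≡ F ; x = + q - 1ℤ in
  k * value f x + value e x * l + k * l * x ^ 6 , trans (cong₂ _*_ a≡ b≡) (trans
    (lemma (x ^ p) (x ^ r) (value e x) (value f x) k l (x ^ 6))
    (cong (_* (value e x * value f x + (k * value f x + value e x * l + k * l * x ^ 6) * x ^ 6))
        (sym (ℤ.^-distribˡ-+-* x p r))))
  where
  lemma : ∀ p r e f k l x → p * (e + k * x) * (r * (f + l * x)) ≡ p * r * (e * f + (k * f + e * l + k * l * x) * x)
  lemma = solve-∀

good-expr : (e : Expr) → Good 0 (λ {q} F → value e (+ q - 1ℤ))
good-expr e = good e λ {q} F → 0ℤ , sym (trans (ℤ.*-identityˡ _) (ℤ.+-identityʳ _))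

good-0 : Good d₁ (λ F → 0ℤ)
good-0 {p} = good (const 0ℤ) λ {q} F → 0ℤ , sym (ℤ.*-zeroʳ ((+ q - 1ℤ) ^ p))

good-≡ : d₁ ≡ d₂ → Good d₁ α → Good d₂ α
good-≡ refl g = g

good-∑ : {A : Set} (as : List A) (f : A → Family) → (∀ a → Good d₁ (f a)) → Good d₁ (λ F → ∑[ a ← as ] f a F)
good-∑ []       f gf = good-0
good-∑ (a ∷ as) f gf = good-+ (gf a) (good-∑ as f gf)

-- In each term the exponents add up to d₁ + d. The offset d₁ is what lets the induction pass from
-- `f` to `f ∘ suc`.
good-convolution : ∀ d (f g : ℕ → Family) → (∀ i → Good (d₁ ℕ.+ i) (f i)) → (∀ i → Good i (g i)) →
                   Good (d₁ ℕ.+ d) (λ F → convolution d (λ i → f i F) (λ i → g i F))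
good-convolution {p} zero    f g gf gg = good-≡ (ℕ.+-identityʳ (p ℕ.+ 0)) (good-* (gf 0) (gg 0))
good-convolution {p} (suc d) f g gf gg = good-+
  (good-≡ (cong (ℕ._+ suc d) (ℕ.+-identityʳ p)) (good-* (gf 0) (gg (suc d))))
  (good-≡ (sym (ℕ.+-suc p d)) (good-convolution d (f ∘ suc) g (λ i → good-≡ (ℕ.+-suc p i) (gf (suc i))) gg))

count : Board m n → ℕ → Family
count S d F = Torus.count F S d

count-zero : (S : Board m n) (d : ℕ) {q : ℕ} (F : FiniteField q) →
  (∀ A → Vec.map (Ranks.support F) A ≡ S → Ranks.rk F A < d) → count S d F ≡ 0ℤ
count-zero {m} {n} S d F rk<d = trans (∑-cong (matrices m n) λ A → trans
    (⟦⟧-*-cong (Vec.map support A ≟ᴮ S) λ eq → ⟦⟧-false (rk A ℕ.≟ d) (ℕ.<⇒≢ (rk<d A eq)))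
    (ℤ.*-zeroʳ (hasSupport S A))) (∑-zero (matrices m n))
  where open Ranks F

count-weights : (S : Board m n) (d : ℕ) → weights S < d → ∀ {q} (F : FiniteField q) → count S d F ≡ 0ℤ
count-weights S d w<d F = count-zero S d F λ { A refl → ℕ.≤-<-trans (Ranks.rk≤weights F A) w<d }

count-columns : (S : Board m n) (d : ℕ) → n < d → ∀ {q} (F : FiniteField q) → count S d F ≡ 0ℤ
count-columns {n = n} S d n<d F = count-zero S d F λ A _ → ℕ.≤-<-trans (ℕ.m∸n≤m n (Ranks.null F A)) n<d

count-nullity : (C : Subset n) → ∣ C ∣ ≤ 6 → (S : Board m n) → VecAll.All (_⊆ C) S → ∀ {d} → d ≤ n →
    ∀ {q} (F : FiniteField q) →
  count S d F ≡ (+ q - 1ℤ) ^ weights S * value (coefficientE (momentsE C S) (n ∸ d)) (+ q - 1ℤ)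
count-nullity {n} {m} C C≤6 S S⊆C {d} d≤n F = trans
  (∑-cong (matrices m n) λ A → cong (hasSupport S A *_) (⟦⟧-cong (rk A ℕ.≟ d) (null A ℕ.≟ n ∸ d)
    (λ eq → trans (sym (ℕ.m∸[m∸n]≡n (null≤n A))) (cong (n ∸_) eq))
    (λ eq → trans (cong (n ∸_) eq) (ℕ.m∸[m∸n]≡n d≤n))))
  (nullity-counts C C≤6 S S⊆C null null≤n kernelSize-null (n ∸ d))
  where
  open Ranks F

few-columns : (C : Subset n) → ∣ C ∣ ≤ 6 → (S : Board m n) → VecAll.All (_⊆ C) S → ∀ d → Good d (count S d)
few-columns {n} C C≤6 S S⊆C d with d ℕ.≤? weights S | d ℕ.≤? n
-- Outside d ≤ w and d ≤ n no matrix has rank d; within, the subtractions w ∸ d and n ∸ d in the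
-- expression are exact.
... | no d≰w | _ = good-cong (count-weights S d (ℕ.≰⇒> d≰w)) good-0
... | yes _  | no d≰n = good-cong (count-columns S d (ℕ.≰⇒> d≰n)) good-0
... | yes d≤w | yes d≤n = good (𝐱 :^ (w ∸ d) :* coefficientE (momentsE C S) (n ∸ d)) λ {q} F →
  let x = + q - 1ℤ ; c = value (coefficientE (momentsE C S) (n ∸ d)) x in 0ℤ , (begin
    count S d F                          ≡⟨ count-nullity C C≤6 S S⊆C d≤n F ⟩
    x ^ w * c                            ≡⟨ cong (λ e → x ^ e * c) (ℕ.m+[n∸m]≡n d≤w) ⟨
    x ^ (d ℕ.+ (w ∸ d)) * c              ≡⟨ cong (_* c) (ℤ.^-distribˡ-+-* x d (w ∸ d)) ⟩
    x ^ d * x ^ (w ∸ d) * c              ≡⟨ lemma (x ^ d) (x ^ (w ∸ d)) c (x ^ 6) ⟩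
    x ^ d * (x ^ (w ∸ d) * c + 0ℤ * x ^ 6)  ≡⟨ cong (λ s → x ^ d * (s * c + 0ℤ * x ^ 6)) (value-:^ 𝐱 (w ∸ d) x) ⟨
    x ^ d * (value (𝐱 :^ (w ∸ d)) x * c + 0ℤ * x ^ 6) ∎)
  where
  w = weights S
  lemma : ∀ a b c y → a * b * c ≡ a * (b * c + 0ℤ * y)
  lemma = solve-∀

-- For a connected S the torus provides at least d + 6 factors x.
many-columns : {S : Board m n} {R : Subset m} {C : Subset n} {k : ℕ} → Reach S R C k → weights S ≤ ∣ R ∣ → 7 ≤ ∣ C ∣ →
               ∀ d → Good d (count S d)
many-columns {m} {n} {S} {R} {C} {k} reach w≤R 7≤C d with d ℕ.≤? weights S
... | no d≰w = good-cong (count-weights S d (ℕ.≰⇒> d≰w)) good-0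
... | yes d≤w = good (const 0ℤ) λ {q} F → let
    x = + q - 1ℤ
    g , _ , eq = Torus.reach-divides F d reach
    s = ∑ (Moments.matrices F m n) g in
  x ^ (k ∸ (d ℕ.+ 6)) * s , (begin
    count S d F                                       ≡⟨ eq ⟩
    x ^ k * s                                         ≡⟨ cong (λ e → x ^ e * s) (ℕ.m+[n∸m]≡n d+6≤k) ⟨
    x ^ (d ℕ.+ 6 ℕ.+ (k ∸ (d ℕ.+ 6))) * s             ≡⟨ cong (_* s)
        (trans (ℤ.^-distribˡ-+-* x (d ℕ.+ 6) (k ∸ (d ℕ.+ 6)))
        (cong (_* x ^ (k ∸ (d ℕ.+ 6))) (ℤ.^-distribˡ-+-* x d 6))) ⟩
    x ^ d * x ^ 6 * x ^ (k ∸ (d ℕ.+ 6)) * s           ≡⟨ lemma (x ^ d) (x ^ 6) (x ^ (k ∸ (d ℕ.+ 6))) s ⟩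
    x ^ d * (0ℤ + x ^ (k ∸ (d ℕ.+ 6)) * s * x ^ 6)    ∎)
  where
  d+6≤k : d ℕ.+ 6 ≤ k
  d+6≤k = ℕ.s≤s⁻¹ (ℕ.≤-trans (ℕ.≤-reflexive (sym (ℕ.+-suc d 6)))
    (ℕ.≤-trans (ℕ.+-mono-≤ (ℕ.≤-trans d≤w w≤R) 7≤C) (ℕ.≤-reflexive (reach-size reach))))
  lemma : ∀ a b c s → a * b * c * s ≡ a * (0ℤ + c * s * b)
  lemma = solve-∀

good-component : {S : Board m n} {R : Subset m} {C : Subset n} {k : ℕ} → Reach S R C k → Split C R S →
                 ∀ d → Good d (count (inRows R S) d)
good-component {S = S} {R} {C} reach split d with ∣ C ∣ ℕ.≤? 6
... | yes C≤6 = few-columns C C≤6 (inRows R S) (split⇒columnsIn split) d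
... | no  C≰6 = many-columns (reach-inRows reach id) (weights-inRows R S) (ℕ.≰⇒> C≰6) d

-- The list contains all rows that may still be nonempty. Splitting off the component of its first
-- row empties that row in the remaining board, so the list shrinks; the components multiply by
-- convolution.
good-count : (is : List (Fin m)) (S : Board m n) → (∀ i → ¬ (i List.∈ is) → lookup S i ≡ ∅) → ∀ d → Good d (count S d)
good-count {n = n} []       S empty = few-columns ∅ (ℕ.≤-trans (ℕ.≤-reflexive (Subset.∣⊥∣≡0 n)) ℕ.z≤n) S
    (allEmpty S λ i → empty i λ ())
  where
  allEmpty : ∀ {m} (S : Board m n) → (∀ i → lookup S i ≡ ∅) → VecAll.All (_⊆ ∅) S
  allEmpty []      _     = []
  allEmpty (T ∷ S) empty = (λ j∈ → subst (_ ∈_) (empty zero) j∈) ∷ allEmpty S (empty ∘ suc)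
good-count {m} {n} (i ∷ is) S empty d with component S i
... | R , C , k , reach , i∈R , closed = good-cong (λ F → Splitting.count-split F split d)
  (good-convolution d (count (inRows R S)) (count (inRows (∁ R) S)) (good-component reach split)
      (good-count is (inRows (∁ R) S) empty′))
  where
  split = closed⇒split S R C closed
  empty′ : ∀ j → ¬ (j List.∈ is) → lookup (inRows (∁ R) S) j ≡ ∅
  empty′ j j∉ = trans (Vec.lookup-zipWith _ j (∁ R) S)
      (trans (cong (λ r → if r then lookup S j else ∅) (Vec.lookup-map j not R)) (go (j Fin.≟ i)))
    where
    collapse : ∀ r → lookup S j ≡ ∅ → (if not r then lookup S j else ∅) ≡ ∅
    collapse true  eq = refl
    collapse false eq = eq
    go : Dec (j ≡ i) → (if not (lookup R j) then lookup S j else ∅) ≡ ∅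
    go (yes refl) = cong (λ r → if not r then lookup S j else ∅) (Vec.[]=⇒lookup i∈R)
    go (no j≢i)   = collapse (lookup R j) (empty j λ { (Any.here eq) → j≢i eq ; (Any.there j∈) → j∉ j∈ })

-- From exact supports to boards

Below : Board m n → Board m n → Set
Below S B = ∀ i → lookup S i ⊆ lookup B i

below? : (S B : Board m n) → Dec (Below S B)
below? S B = Fin.all? λ i → lookup S i Subset.⊆? lookup B i

finiteBoard : ∀ m n → Finite (Board m n)
finiteBoard m n = vecFinite (vecFinite finite-Bool n) m

matrixCount-count : (B : Board m n) (d : ℕ) → ∀ {q} (F : FiniteField q) →
  + matrixCount F B d ≡ (∑[ S ← Finite.elems (finiteBoard m n) ] ⟦ below? S B ⟧ * count S d F)
matrixCount-count {m} {n} B d F = begin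
  + matrixCount F B d
    ≡⟨ ∑-filter (λ A → hasRank? F A d ×-dec supportedOn? F B A) (matrices m n) ⟩
  (∑[ A ← matrices m n ] ⟦ hasRank? F A d ×-dec supportedOn? F B A ⟧)
    ≡⟨ ∑-cong (matrices m n) (λ A → trans (⟦⟧-× (hasRank? F A d) (supportedOn? F B A)) (cong₂ _*_
         (⟦⟧-cong (hasRank? F A d) (rk A ℕ.≟ d) (hasRank-unique A) λ { refl → hasRank-rk A })
         (⟦⟧-cong (supportedOn? F B A) (below? (Vec.map support A) B) (to A) (from A)))) ⟩
  (∑[ A ← matrices m n ] ⟦ rk A ℕ.≟ d ⟧ * ⟦ below? (Vec.map support A) B ⟧)
    ≡⟨ ∑-cong (matrices m n)
        (λ A → trans (cong (⟦ rk A ℕ.≟ d ⟧ *_)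
        (sym (Finite.∑-δ (finiteBoard m n) (Vec.map support A) (λ S → ⟦ below? S B ⟧))))
         (trans (sym (∑-*ˡ ⟦ rk A ℕ.≟ d ⟧ boards _))
             (∑-cong boards λ S → lemma ⟦ rk A ℕ.≟ d ⟧ (hasSupport S A) ⟦ below? S B ⟧))) ⟩
  (∑[ A ← matrices m n ] ∑[ S ← boards ] ⟦ below? S B ⟧ * (hasSupport S A * ⟦ rk A ℕ.≟ d ⟧))
    ≡⟨ trans (∑-swap (matrices m n) boards _) (∑-cong boards λ S → ∑-*ˡ ⟦ below? S B ⟧ (matrices m n) _) ⟩
  (∑[ S ← boards ] ⟦ below? S B ⟧ * count S d F) ∎
  where
  open Torus F using (entryAt; hasRank-unique; hasRank-rk; rk; hasSupport; matrices; support; Mat; _≟ᴷ_; 0#)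
  boards = Finite.elems (finiteBoard m n)
  lemma : ∀ a b c → a * (b * c) ≡ c * (b * a)
  lemma = solve-∀
  entry-support : ∀ (A : Mat m n) i j → lookup (lookup (Vec.map support A) i) j ≡ not (does (entryAt i j A ≟ᴷ 0#))
  entry-support A i j = trans (cong (λ T → lookup T j) (Vec.lookup-map i support A)) (Vec.lookup-map j _ (lookup A i))
  to : ∀ (A : Mat m n) → SupportedOn F B A → Below (Vec.map support A) B
  to A sup i {j} ij∈ = sup i j λ eq → contradiction (trans (sym (Vec.[]=⇒lookup ij∈))
    (trans (entry-support A i j) (cong not (dec-true (entryAt i j A ≟ᴷ 0#) eq)))) λ ()
  from : ∀ (A : Mat m n) → Below (Vec.map support A) B → SupportedOn F B A
  from A below i j ne = below i
      (Vec.lookup⇒[]= j _ (trans (entry-support A i j) (cong not (dec-false (entryAt i j A ≟ᴷ 0#) ne))))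

good-matrixCount : (B : Board m n) (d : ℕ) → Good d (λ F → + matrixCount F B d)
good-matrixCount {m} {n} B d = good-cong (matrixCount-count B d) (good-∑ (Finite.elems (finiteBoard m n)) _ λ S →
  good-* (good-expr (const ⟦ below? S B ⟧)) (good-count (List.allFin m) S (λ i i∉ → contradiction (∈-allFin i) i∉) d))

-- The q-rook and q-hit numbers as rational numbers

-- The lists `Expr[y]` are reused for polynomials in 𝐱: their variable y now plays the part of 𝐱,
-- and the coefficients are constants.
normalForm : Expr → Expr[y]
multiply   : Expr[y] → Expr[y] → Expr[y]
multiply []      q = []
multiply (e ∷ p) q = e :• q :⊕ (const 0ℤ ∷ multiply p q)
normalForm (const c) = const c ∷ []
normalForm 𝐱         = const 0ℤ ∷ const 1ℤ ∷ []
normalForm (e :+ f)  = normalForm e :⊕ normalForm f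
normalForm (e :* f)  = multiply (normalForm e) (normalForm f)

value-multiply : ∀ p q x y → value[y] (multiply p q) x y ≡ value[y] p x y * value[y] q x y
value-multiply []      q x y = refl
value-multiply (e ∷ p) q x y = trans (value-:⊕ (e :• q) (const 0ℤ ∷ multiply p q) x y)
  (trans (cong₂ (λ s t → s + (0ℤ + y * t)) (value-:• e q x y) (value-multiply p q x y))
    (lemma (value e x) (value[y] q x y) y (value[y] p x y)))
  where
  lemma : ∀ e q y p → e * q + (0ℤ + y * (p * q)) ≡ (e + y * p) * q
  lemma = solve-∀

-- The coefficients of the normal form are constants, so z does not matter.
value-normalForm : ∀ e z x → value[y] (normalForm e) z x ≡ value e x
value-normalForm (const c) z x = trans (cong (λ s → c + s) (ℤ.*-zeroʳ x)) (ℤ.+-identityʳ c)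
value-normalForm 𝐱         z x = lemma x
  where
  lemma : ∀ x → 0ℤ + x * (1ℤ + x * 0ℤ) ≡ x
  lemma = solve-∀
value-normalForm (e :+ f)  z x = trans (value-:⊕ (normalForm e) (normalForm f) z x)
    (cong₂ _+_ (value-normalForm e z x) (value-normalForm f z x))
value-normalForm (e :* f)  z x = trans (value-multiply (normalForm e) (normalForm f) z x)
    (cong₂ _*_ (value-normalForm e z x) (value-normalForm f z x))

horner-split : ∀ M N f y → horner (M ℕ.+ N) f y ≡ horner M f y + horner N (λ i → f (M ℕ.+ i)) y * y ^ M
horner-split zero    N f y = sym (trans (ℤ.+-identityˡ _) (ℤ.*-identityʳ _))
horner-split (suc M) N f y = trans (cong (λ s → f 0 + y * s) (horner-split M N (f ∘ suc) y))
    (lemma (f 0) y (horner M (f ∘ suc) y) (horner N (λ i → f (suc M ℕ.+ i)) y) (y ^ M))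
  where
  lemma : ∀ a y s t m → a + y * (s + t * m) ≡ a + y * s + t * (y * m)
  lemma = solve-∀

horner-sum : ∀ N (P : Vec ℤ N) f y → (∀ i → lookup P i ≡ f (toℕ i)) →
             sumℤ (λ (i : Fin N) → lookup P i * y ^ toℕ i) ≡ horner N f y
horner-sum zero    []      f y eq = refl
horner-sum (suc N) (a ∷ P) f y eq = cong₂ _+_ (trans (ℤ.*-identityʳ a) (eq zero))
  (trans (shifted N P) (cong (y *_) (horner-sum N P (f ∘ suc) y (eq ∘ suc))))
  where
  swap : ∀ a y m → a * (y * m) ≡ y * (a * m)
  swap = solve-∀
  scaled : ∀ N (g h : Fin N → ℤ) → (∀ i → g i ≡ y * h i) → sumℤ g ≡ y * sumℤ h
  scaled zero    g h eq = sym (ℤ.*-zeroʳ y)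
  scaled (suc N) g h eq = trans (cong₂ _+_ (eq zero) (scaled N (g ∘ suc) (h ∘ suc) (eq ∘ suc)))
      (sym (ℤ.*-distribˡ-+ y (h zero) _))
  shifted : ∀ N (P : Vec ℤ N) → sumℤ (λ (i : Fin N) → lookup P i * (y * y ^ toℕ i)) ≡
      y * sumℤ (λ (i : Fin N) → lookup P i * y ^ toℕ i)
  shifted N P = scaled N _ _ λ i → swap (lookup P i) y (y ^ toℕ i)

truncate : Expr → ℤ[x]≤ 5
truncate e = Vec.tabulate λ i → value (coefficientE (normalForm e) (toℕ i)) 0ℤ

value-truncate : ∀ e x → ∃[ k ] value e x ≡ eval (truncate e) x + k * x ^ 6
value-truncate e x = horner N (λ i → c (6 ℕ.+ i)) x , (begin
  value e x                                                    ≡⟨ value-normalForm e 0ℤ x ⟨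
  value[y] (normalForm e) 0ℤ x                                 ≡⟨ horner-value[y] (6 ℕ.+ N) (normalForm e) 0ℤ x
      (ℕ.m≤n+m N 6) ⟨
  horner (6 ℕ.+ N) c x                                         ≡⟨ horner-split 6 N c x ⟩
  horner 6 c x + horner N (λ i → c (6 ℕ.+ i)) x * x ^ 6        ≡⟨ cong
      (λ s → s + horner N (λ i → c (6 ℕ.+ i)) x * x ^ 6)
    (horner-sum 6 (truncate e) c x (Vec.lookup∘tabulate _)) ⟨
  eval (truncate e) x + horner N (λ i → c (6 ℕ.+ i)) x * x ^ 6 ∎)
  where
  N = List.length (normalForm e)
  c : ℕ → ℤ
  c i = value (coefficientE (normalForm e) i) 0ℤ

-- Integers inside the rationals

fromℤ-homo : ∀ z → ℚ.toℚᵘ (fromℤ z) ℚᵘ.≃ mkℚᵘ z 0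
fromℤ-homo z = ℚ.toℚᵘ-fromℚᵘ (mkℚᵘ z 0)

fromℤ-+ : ∀ a b → fromℤ (a + b) ≡ fromℤ a ℚ.+ fromℤ b
fromℤ-+ a b = ℚ.toℚᵘ-injective (ℚᵘ.≃-trans (fromℤ-homo (a + b)) (ℚᵘ.≃-trans (*≡* (lemma a b))
  (ℚᵘ.≃-sym (ℚᵘ.≃-trans (ℚ.toℚᵘ-homo-+ (fromℤ a) (fromℤ b)) (ℚᵘ.+-cong (fromℤ-homo a) (fromℤ-homo b))))))
  where
  lemma : ∀ a b → (a + b) * 1ℤ ≡ (a * 1ℤ + b * 1ℤ) * 1ℤ
  lemma = solve-∀

fromℤ-* : ∀ a b → fromℤ (a * b) ≡ fromℤ a ℚ.* fromℤ b
fromℤ-* a b = ℚ.toℚᵘ-injective (ℚᵘ.≃-trans (fromℤ-homo (a * b)) (ℚᵘ.≃-sym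
  (ℚᵘ.≃-trans (ℚ.toℚᵘ-homo-* (fromℤ a) (fromℤ b)) (ℚᵘ.*-cong (fromℤ-homo a) (fromℤ-homo b)))))

fromℤ-neg : ∀ a → fromℤ (- a) ≡ ℚ.- fromℤ a
fromℤ-neg a = ℚ.toℚᵘ-injective (ℚᵘ.≃-trans (fromℤ-homo (- a)) (ℚᵘ.≃-sym
  (ℚᵘ.≃-trans (ℚ.toℚᵘ-homo‿- (fromℤ a)) (ℚᵘ.-‿cong (fromℤ-homo a)))))

/-exact : ∀ i z d .{{_ : ℕ.NonZero d}} → i ≡ z * + d → i / d ≡ fromℤ z
/-exact i z (suc d) eq = ℚ.fromℚᵘ-cong {mkℚᵘ i d} {mkℚᵘ z 0} (*≡* (trans (ℤ.*-identityʳ i) eq))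

good⇒congruent : {a : Family} → Good 0 a → (v : ∀ {q} → FiniteField q → ℚ) →
    (∀ {q} (F : FiniteField q) → v F ≡ fromℤ (a F)) →
  Σ[ P ∈ ℤ[x]≤ 5 ] (∀ {q} (F : FiniteField q) → v F ≡ eval P (+ q - 1ℤ) [mod (+ q - 1ℤ) ^ 6 ])
good⇒congruent {a} (good e correct) v v≡ = truncate e , λ {q} F →
  let x = + q - 1ℤ
      k , a≡ = correct F
      l , e≡ = value-truncate e x
      P = eval (truncate e) x in
  l + k , (begin
    v F ℚ.- fromℤ P                                     ≡⟨ cong₂ ℚ._+_ (v≡ F) (sym (fromℤ-neg P)) ⟩
    fromℤ (a F) ℚ.+ fromℤ (- P)                         ≡⟨ fromℤ-+ (a F) (- P) ⟨
    fromℤ (a F + - P)                                   ≡⟨ cong fromℤ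
        (trans (cong (λ s → s + - P) (trans a≡ (cong (λ s → 1ℤ * (s + k * x ^ 6)) e≡))) (lemma P l k (x ^ 6))) ⟩
    fromℤ ((l + k) * x ^ 6)                             ∎)
  where
  lemma : ∀ P l k x → 1ℤ * (P + l * x + k * x) + - P ≡ (l + k) * x
  lemma = solve-∀

good-sum : ∀ k (f : Fin k → Family) → (∀ j → Good 0 (f j)) → Good 0 (λ F → sumℤ λ j → f j F)
good-sum zero    f gf = good-0
good-sum (suc k) f gf = good-+ (gf zero) (good-sum k (f ∘ suc) (gf ∘ suc))

-- The integer quotient of the matrix count by xⁱ, taken from the factorisation that `Good` provides
-- instead of by dividing.
rook : (B : Board m n) → ℕ → Family
rook B i {q} F = let good e correct = good-matrixCount B i ; x = + q - 1ℤ in value e x + proj₁ (correct F) * x ^ 6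

good-rook : (B : Board m n) (i : ℕ) → Good 0 (rook B i)
good-rook B i = good (Good.expr (good-matrixCount B i)) λ F → proj₁ (Good.correct (good-matrixCount B i) F) , sym
    (ℤ.*-identityˡ _)

-- Coefficients of the hit polynomial

coefficient-• : ∀ a f k → coefficient (a • f) k ≡ a ℚ.* coefficient f k
coefficient-• a []      k       = sym (ℚ.*-zeroʳ a)
coefficient-• a (b ∷ f) zero    = refl
coefficient-• a (b ∷ f) (suc k) = coefficient-• a f k

coefficient-⊕ : ∀ f g k → coefficient (f ⊕ g) k ≡ coefficient f k ℚ.+ coefficient g k
coefficient-⊕ []      g       k       = sym (ℚ.+-identityˡ _)
coefficient-⊕ (a ∷ f) []      k       = sym (ℚ.+-identityʳ _)
coefficient-⊕ (a ∷ f) (b ∷ g) zero    = refl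
coefficient-⊕ (a ∷ f) (b ∷ g) (suc k) = coefficient-⊕ f g k

coefficient-∑ : ∀ (c : ℚ) k (f : Fin k → ℚ[t]) d (z : Fin k → ℤ) → (∀ j → c ℚ.* coefficient (f j) d ≡ fromℤ (z j)) →
                c ℚ.* coefficient (∑-poly k f) d ≡ fromℤ (sumℤ z)
coefficient-∑ c zero    f d z eq = ℚ.*-zeroʳ c
coefficient-∑ c (suc k) f d z eq = begin
  c ℚ.* coefficient (f zero ⊕ ∑-poly k (f ∘ suc)) d                        ≡⟨ cong (c ℚ.*_)
      (coefficient-⊕ (f zero) _ d) ⟩
  c ℚ.* (coefficient (f zero) d ℚ.+ coefficient (∑-poly k (f ∘ suc)) d)    ≡⟨ ℚ.*-distribˡ-+ c _ _ ⟩
  c ℚ.* coefficient (f zero) d ℚ.+ c ℚ.* coefficient (∑-poly k (f ∘ suc)) d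
      ≡⟨ cong₂ ℚ._+_ (eq zero) (coefficient-∑ c k (f ∘ suc) d (z ∘ suc) (eq ∘ suc)) ⟩
  fromℤ (z zero) ℚ.+ fromℤ (sumℤ (z ∘ suc))                                ≡⟨ fromℤ-+ (z zero) _ ⟨
  fromℤ (sumℤ z)                                                           ∎

coefficient-linear-zero : ∀ f c → coefficient (f ⊗ (1ℚ ∷ c ∷ [])) 0 ≡ coefficient f 0
coefficient-linear-zero []      c = refl
coefficient-linear-zero (a ∷ f) c = trans (ℚ.+-identityʳ _) (ℚ.*-identityʳ a)

coefficient-linear-suc : ∀ f c k → coefficient (f ⊗ (1ℚ ∷ c ∷ [])) (suc k) ≡
    coefficient f (suc k) ℚ.+ coefficient f k ℚ.* c
coefficient-linear-suc []      c k = sym (trans (ℚ.+-identityˡ _) (ℚ.*-zeroˡ c))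
coefficient-linear-suc (a ∷ f) c k = trans (coefficient-⊕ (a ℚ.* c ∷ []) (f ⊗ (1ℚ ∷ c ∷ [])) k) (go k)
  where
  go : ∀ k → coefficient (a ℚ.* c ∷ []) k ℚ.+ coefficient (f ⊗ (1ℚ ∷ c ∷ [])) k ≡ coefficient f k ℚ.+ coefficient
      (a ∷ f) k ℚ.* c
  go zero    = trans (cong (a ℚ.* c ℚ.+_) (coefficient-linear-zero f c)) (ℚ.+-comm (a ℚ.* c) _)
  go (suc k) = trans (ℚ.+-identityˡ _) (coefficient-linear-suc f c k)

triangle : ℕ → ℕ
triangle zero    = 0
triangle (suc n) = n ℕ.+ triangle n

C2≡triangle : ∀ n → n choose 2 ≡ triangle n
C2≡triangle zero    = refl
C2≡triangle (suc n) = trans (sym (nCk+nC[k+1]≡[n+1]C[k+1] n 1)) (cong₂ ℕ._+_ (nC1≡n n) (C2≡triangle n))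

triangle-mono : ∀ {i m} → i ≤ m → triangle i ≤ triangle m
triangle-mono {m = m} ℕ.z≤n     = ℕ.z≤n
triangle-mono         (ℕ.s≤s p) = ℕ.+-mono-≤ p (triangle-mono p)

-- The coefficients of q^(i choose 2) (t; 1/q)ᵢ = ∏ (qʲ - t).
pochhammerE : ℕ → ℕ → Expr
pochhammerE zero    zero    = const 1ℤ
pochhammerE zero    (suc d) = const 0ℤ
pochhammerE (suc i) zero    = 𝐪 :^ i :* pochhammerE i 0
pochhammerE (suc i) (suc d) = 𝐪 :^ i :* pochhammerE i (suc d) :+ const (- 1ℤ) :* pochhammerE i d

∑E : ∀ k → (Fin k → Expr) → Expr
∑E zero    f = const 0ℤ
∑E (suc k) f = f zero :+ ∑E k (f ∘ suc)

value-∑E : ∀ k (f : Fin k → Expr) (g : Fin k → ℕ) x → (∀ j → value (f j) x ≡ + g j) → value (∑E k f) x ≡ + sumℕ g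
value-∑E zero    f g x eq = refl
value-∑E (suc k) f g x eq = trans (cong₂ _+_ (eq zero) (value-∑E k (f ∘ suc) (g ∘ suc) x (eq ∘ suc)))
    (sym (ℤ.pos-+ (g zero) _))

qIntegerE : ℕ → Expr
qIntegerE k = ∑E k λ j → 𝐪 :^ toℕ j

-- The quotient [a + b]! / [b]!.
factorialE : ℕ → ℕ → Expr
factorialE zero    b = const 1ℤ
factorialE (suc a) b = qIntegerE (suc (a ℕ.+ b)) :* factorialE a b

q*1/q : ∀ q .{{_ : ℕ.NonZero q}} → fromℤ (+ q) ℚ.* (+ 1 / q) ≡ 1ℚ
q*1/q (suc q) = ℚ.toℚᵘ-injective (ℚᵘ.≃-trans (ℚ.toℚᵘ-homo-* (fromℤ (+ suc q)) (+ 1 / suc q))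
  (ℚᵘ.≃-trans (ℚᵘ.*-cong (fromℤ-homo (+ suc q)) (ℚ.toℚᵘ-fromℚᵘ (mkℚᵘ (+ 1) q))) (*≡*
    (trans (ℤ.*-identityʳ _)
        (trans (ℤ.*-identityʳ _) (trans (cong +_ (sym (ℕ.*-identityˡ (suc q)))) (sym (ℤ.*-identityˡ _))))))))

-- For i ≤ m ≤ n, the multiplier of the i-th rook number in the coefficient of tᵈ. The prefactor
-- with exponent m choose 2 is split so that its part with exponent i choose 2 clears the
-- denominators of (t; 1/q)ᵢ.
hitE : ℕ → ℕ → ℕ → ℕ → Expr
hitE m n i d = factorialE (m ∸ i) (n ∸ m) :* const ((- 1ℤ) ^ i) :* (𝐪 :^ (triangle m ∸ triangle i) :* pochhammerE i d)

hit : Board m n → ℕ → Family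
hit {m} {n} B d {q} F = sumℤ λ (j : Fin (suc m)) → rook B (toℕ j) F * value (hitE m n (toℕ j) d) (+ q - 1ℤ)

good-hit : (B : Board m n) (d : ℕ) → Good 0 (hit B d)
good-hit {m} {n} B d = good-sum (suc m) _ λ j → good-* (good-rook B (toℕ j)) (good-expr (hitE m n (toℕ j) d))

module Numbers {q : ℕ} (F : FiniteField q) where

  open Configurations F using (q^_; pos-^; x; value-𝐪^)

  private instance
    q-nonTrivial : ℕ.NonTrivial q
    q-nonTrivial = FiniteField.order-nonTrivial F
    q-nonZero : ℕ.NonZero q
    q-nonZero = ℕ.nonTrivial⇒nonZero q
    q∸1-nonZero : ℕ.NonZero (q ∸ 1)
    q∸1-nonZero = ℕ.>-nonZero (ℕ.m<n⇒0<n∸m (ℕ.nonTrivial⇒n>1 q))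

  x≡q∸1 : x ≡ + (q ∸ 1)
  x≡q∸1 = trans (ℤ.m-n≡m⊖n q 1) (ℤ.⊖-≥ (ℕ.<⇒≤ (ℕ.nonTrivial⇒n>1 q)))

  pos-[q∸1]^ : ∀ e → + ((q ∸ 1) ℕ.^ e) ≡ x ^ e
  pos-[q∸1]^ zero    = refl
  pos-[q∸1]^ (suc e) = trans (ℤ.pos-* (q ∸ 1) _) (cong₂ _*_ (sym x≡q∸1) (pos-[q∸1]^ e))

  qRookNumber-rook : (B : Board m n) (i : ℕ) → qRookNumber F B i ≡ fromℤ (rook B i F)
  qRookNumber-rook B i = /-exact (+ matrixCount F B i) (rook B i F) ((q ∸ 1) ℕ.^ i) {{ℕ.m^n≢0 (q ∸ 1) i}}
    (trans (proj₂ (Good.correct (good-matrixCount B i) F))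
        (trans (ℤ.*-comm _ (rook B i F)) (cong (rook B i F *_) (sym (pos-[q∸1]^ i)))))

  value-factorialE : ∀ a b → + qFactorial q (a ℕ.+ b) ≡ value (factorialE a b) x * + qFactorial q b
  value-factorialE zero    b = sym (ℤ.*-identityˡ _)
  value-factorialE (suc a) b = begin
    + (qInteger q (suc (a ℕ.+ b)) ℕ.* qFactorial q (a ℕ.+ b))
      ≡⟨ ℤ.pos-* (qInteger q (suc (a ℕ.+ b))) _ ⟩
    + qInteger q (suc (a ℕ.+ b)) * + qFactorial q (a ℕ.+ b)
      ≡⟨ cong₂ _*_ (sym (value-∑E (suc (a ℕ.+ b)) (λ j → 𝐪 :^ toℕ j) (λ j → q ℕ.^ toℕ j) x λ j →
          trans (value-𝐪^ (toℕ j)) (sym (pos-^ (toℕ j))))) (value-factorialE a b) ⟩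
    value (qIntegerE (suc (a ℕ.+ b))) x * (value (factorialE a b) x * + qFactorial q b)
      ≡⟨ ℤ.*-assoc (value (qIntegerE (suc (a ℕ.+ b))) x) _ _ ⟨
    value (factorialE (suc a) b) x * + qFactorial q b ∎

  factorial-ratio : ∀ {i m n} → i ≤ m → m ≤ n →
    (+ qFactorial q (n ∸ i) / qFactorial q (n ∸ m)) {{qFactorial-nonZero q (n ∸ m)}} ≡
        fromℤ (value (factorialE (m ∸ i) (n ∸ m)) x)
  factorial-ratio {i} {m} {n} i≤m m≤n = /-exact (+ qFactorial q (n ∸ i)) (value (factorialE (m ∸ i) (n ∸ m)) x)
      (qFactorial q (n ∸ m)) {{qFactorial-nonZero q (n ∸ m)}}
    (trans (cong (λ k → + qFactorial q k) eq) (value-factorialE (m ∸ i) (n ∸ m)))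
    where
    eq : n ∸ i ≡ m ∸ i ℕ.+ (n ∸ m)
    eq = begin
      n ∸ i                     ≡⟨ cong (_∸ i) (ℕ.m+[n∸m]≡n m≤n) ⟨
      (m ℕ.+ (n ∸ m)) ∸ i       ≡⟨ ℕ.+-∸-comm (n ∸ m) i≤m ⟩
      m ∸ i ℕ.+ (n ∸ m)         ∎

  1/q : ℚ
  1/q = + 1 / q

  private module S = +-*-Solver

  q^*1/q^ : ∀ i → fromℤ (q^ i) ℚ.* 1/q ^ℚ i ≡ 1ℚ
  q^*1/q^ zero    = refl
  q^*1/q^ (suc i) = begin
    fromℤ (+ q * q^ i) ℚ.* (1/q ℚ.* 1/q ^ℚ i)               ≡⟨ cong (ℚ._* (1/q ℚ.* 1/q ^ℚ i)) (fromℤ-* (+ q) (q^ i)) ⟩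
    fromℤ (+ q) ℚ.* fromℤ (q^ i) ℚ.* (1/q ℚ.* 1/q ^ℚ i)     ≡⟨ S.solve 4
        (λ a b c d → a S.:* b S.:* (c S.:* d) S.:= a S.:* c S.:* (b S.:* d)) refl (fromℤ (+ q)) (fromℤ (q^ i)) 1/q
        (1/q ^ℚ i) ⟩
    fromℤ (+ q) ℚ.* 1/q ℚ.* (fromℤ (q^ i) ℚ.* 1/q ^ℚ i)     ≡⟨ cong₂ ℚ._*_ (q*1/q q) (q^*1/q^ i) ⟩
    1ℚ ℚ.* 1ℚ                                               ≡⟨⟩
    1ℚ                                                      ∎

  -- The extra factor at each step clears one denominator: qⁱ (1 - t / qⁱ) = qⁱ - t.
  pochhammer-value : ∀ i d → fromℤ (q^ triangle i) ℚ.* coefficient (pochhammer 1/q i) d ≡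
      fromℤ (value (pochhammerE i d) x)
  pochhammer-value zero    zero    = refl
  pochhammer-value zero    (suc d) = refl
  pochhammer-value (suc i) zero    = begin
    fromℤ (q^ (i ℕ.+ triangle i)) ℚ.* coefficient (pochhammer 1/q (suc i)) 0
      ≡⟨ cong₂ ℚ._*_ (trans (cong fromℤ (ℤ.^-distribˡ-+-* (+ q) i (triangle i))) (fromℤ-* (q^ i) (q^ triangle i)))
          (coefficient-linear-zero (pochhammer 1/q i) _) ⟩
    fromℤ (q^ i) ℚ.* fromℤ (q^ triangle i) ℚ.* coefficient (pochhammer 1/q i) 0
      ≡⟨ trans (ℚ.*-assoc (fromℤ (q^ i)) _ _) (cong₂ ℚ._*_ (cong fromℤ (sym (value-𝐪^ i))) (pochhammer-value i 0)) ⟩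
    fromℤ (value (𝐪 :^ i) x) ℚ.* fromℤ (value (pochhammerE i 0) x)
      ≡⟨ fromℤ-* (value (𝐪 :^ i) x) _ ⟨
    fromℤ (value (pochhammerE (suc i) 0) x) ∎
  pochhammer-value (suc i) (suc d) = begin
    fromℤ (q^ (i ℕ.+ triangle i)) ℚ.* coefficient (pochhammer 1/q (suc i)) (suc d)
      ≡⟨ cong₂ ℚ._*_ (trans (cong fromℤ (ℤ.^-distribˡ-+-* (+ q) i (triangle i))) (fromℤ-* (q^ i) (q^ triangle i)))
          (coefficient-linear-suc (pochhammer 1/q i) _ d) ⟩
    Q ℚ.* T ℚ.* (a ℚ.+ b ℚ.* ℚ.- w)
      ≡⟨ S.solve 5 (λ Q T a b w → Q S.:* T S.:* (a S.:+ b S.:* S.:- w) S.:= Q S.:* (T S.:* a) S.:+ S.:-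
          (Q S.:* w S.:* (T S.:* b))) refl Q T a b w ⟩
    Q ℚ.* (T ℚ.* a) ℚ.+ ℚ.- (Q ℚ.* w ℚ.* (T ℚ.* b))
      ≡⟨ cong₂ (λ s t → Q ℚ.* s ℚ.+ ℚ.- t) (pochhammer-value i (suc d))
          (trans (cong₂ ℚ._*_ (q^*1/q^ i) (pochhammer-value i d)) (ℚ.*-identityˡ _)) ⟩
    Q ℚ.* fromℤ (value (pochhammerE i (suc d)) x) ℚ.+ ℚ.- fromℤ (value (pochhammerE i d) x)
      ≡⟨ cong₂ ℚ._+_ (trans (cong (λ s → fromℤ s ℚ.* fromℤ (value (pochhammerE i (suc d)) x)) (sym (value-𝐪^ i)))
          (sym (fromℤ-* (value (𝐪 :^ i) x) _)))
           (trans (sym (fromℤ-neg (value (pochhammerE i d) x)))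
               (cong fromℤ (sym (ℤ.-1*i≡-i (value (pochhammerE i d) x))))) ⟩
    fromℤ (value (𝐪 :^ i) x * value (pochhammerE i (suc d)) x) ℚ.+ fromℤ (- 1ℤ * value (pochhammerE i d) x)
      ≡⟨ fromℤ-+ (value (𝐪 :^ i) x * value (pochhammerE i (suc d)) x) _ ⟨
    fromℤ (value (pochhammerE (suc i) (suc d)) x) ∎
    where
    Q = fromℤ (q^ i)
    T = fromℤ (q^ triangle i)
    a = coefficient (pochhammer 1/q i) (suc d)
    b = coefficient (pochhammer 1/q i) d
    w = 1/q ^ℚ i

  fromℤ-sign : ∀ i → (ℚ.- 1ℚ) ^ℚ i ≡ fromℤ ((- 1ℤ) ^ i)
  fromℤ-sign zero    = refl
  fromℤ-sign (suc i) = trans (cong (ℚ.- 1ℚ ℚ.*_) (fromℤ-sign i)) (sym (fromℤ-* (- 1ℤ) ((- 1ℤ) ^ i)))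

  hit-term : ∀ {i m n} → i ≤ m → m ≤ n → ∀ d (v : ℚ) (M : ℤ) → v ≡ fromℤ M →
    fromℤ (+ (q ℕ.^ (m choose 2))) ℚ.* coefficient
        ((v ℚ.* (+ qFactorial q (n ∸ i) / qFactorial q (n ∸ m)) {{qFactorial-nonZero q (n ∸ m)}} ℚ.* (ℚ.- 1ℚ) ^ℚ i) •
        pochhammer 1/q i) d ≡
    fromℤ (M * value (hitE m n i d) x)
  hit-term {i} {m} {n} i≤m m≤n d v M v≡ = begin
    fromℤ (+ (q ℕ.^ (m choose 2))) ℚ.* coefficient ((v ℚ.* ratio ℚ.* (ℚ.- 1ℚ) ^ℚ i) • pochhammer 1/q i) d
      ≡⟨ cong₂ ℚ._*_ q^C2 (coefficient-• (v ℚ.* ratio ℚ.* (ℚ.- 1ℚ) ^ℚ i) (pochhammer 1/q i) d) ⟩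
    Q ℚ.* T ℚ.* (v ℚ.* ratio ℚ.* (ℚ.- 1ℚ) ^ℚ i ℚ.* p)
      ≡⟨ cong₂ (λ a s → Q ℚ.* T ℚ.* (a ℚ.* s ℚ.* p)) (cong₂ ℚ._*_ v≡ (factorial-ratio i≤m m≤n)) (fromℤ-sign i) ⟩
    Q ℚ.* T ℚ.* (fromℤ M ℚ.* fromℤ R ℚ.* fromℤ s ℚ.* p)
      ≡⟨ S.solve 6 (λ Q T M R s p → Q S.:* T S.:* (M S.:* R S.:* s S.:* p) S.:= M S.:*
          (R S.:* s S.:* (Q S.:* (T S.:* p)))) refl Q T (fromℤ M) (fromℤ R) (fromℤ s) p ⟩
    fromℤ M ℚ.* (fromℤ R ℚ.* fromℤ s ℚ.* (Q ℚ.* (T ℚ.* p)))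
      ≡⟨ cong₂ (λ a b → fromℤ M ℚ.* (a ℚ.* b)) (sym (fromℤ-* R s))
          (trans (cong₂ ℚ._*_ (cong fromℤ (sym (value-𝐪^ (triangle m ∸ triangle i)))) (pochhammer-value i d))
          (sym (fromℤ-* Q′ E))) ⟩
    fromℤ M ℚ.* (fromℤ (R * s) ℚ.* fromℤ (Q′ * E))
      ≡⟨ trans (fromℤ-* M (R * s * (Q′ * E))) (cong (fromℤ M ℚ.*_) (fromℤ-* (R * s) (Q′ * E))) ⟨
    fromℤ (M * (R * s * (Q′ * E))) ∎
    where
    ratio = (+ qFactorial q (n ∸ i) / qFactorial q (n ∸ m)) {{qFactorial-nonZero q (n ∸ m)}}
    p = coefficient (pochhammer 1/q i) d
    Q = fromℤ (q^ (triangle m ∸ triangle i))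
    T = fromℤ (q^ triangle i)
    R = value (factorialE (m ∸ i) (n ∸ m)) x
    s = (- 1ℤ) ^ i
    Q′ = value (𝐪 :^ (triangle m ∸ triangle i)) x
    E = value (pochhammerE i d) x
    q^C2 : fromℤ (+ (q ℕ.^ (m choose 2))) ≡ Q ℚ.* T
    q^C2 = trans (cong fromℤ (begin
      + (q ℕ.^ (m choose 2))                                       ≡⟨ pos-^ (m choose 2) ⟩
      q^ (m choose 2)                                              ≡⟨ cong q^_
          (trans (C2≡triangle m) (sym (ℕ.m∸n+n≡m (triangle-mono i≤m)))) ⟩
      q^ (triangle m ∸ triangle i ℕ.+ triangle i)             ≡⟨ ℤ.^-distribˡ-+-* (+ q) (triangle m ∸ triangle i)
          (triangle i) ⟩
      q^ (triangle m ∸ triangle i) * q^ triangle i            ∎))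
          (fromℤ-* (q^ (triangle m ∸ triangle i)) (q^ triangle i))

  qHitNumber-hit : m ≤ n → (B : Board m n) (d : ℕ) → qHitNumber F B d ≡ fromℤ (hit B d F)
  qHitNumber-hit {m} {n} m≤n B d = trans (coefficient-• c (∑-poly (suc m) f) d) (coefficient-∑ c (suc m) f d z λ j →
      hit-term (ℕ.s≤s⁻¹ (Fin.toℕ<n j)) m≤n d (qRookNumber F B (toℕ j)) (rook B (toℕ j) F)
          (qRookNumber-rook B (toℕ j)))
    where
    c = fromℤ (+ (q ℕ.^ (m choose 2)))
    f : Fin (suc m) → ℚ[t]
    f j = let i = toℕ j in
      (qRookNumber F B i ℚ.* (+ qFactorial q (n ∸ i) / qFactorial q (n ∸ m)) {{qFactorial-nonZero q (n ∸ m)}} ℚ.*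
          (ℚ.- 1ℚ) ^ℚ i) • pochhammer 1/q i
    z : Fin (suc m) → ℤ
    z j = rook B (toℕ j) F * value (hitE m n (toℕ j) d) x

corollary3p14 : ∀ (m n : ℕ) → m ≤ n → (B : Board m n) → (d : ℕ) → d ≤ m →
    Σ[ P ∈ ℤ[x]≤ 5 ] Σ[ Q ∈ ℤ[x]≤ 5 ]
    (∀ (q : ℕ) → IsPrimePower q → (F : FiniteField q) →
    (qRookNumber F B d ≡ eval P (+ q - 1ℤ) [mod (+ q - 1ℤ) ^ 6 ]) ×
    (qHitNumber F B d ≡ eval Q (+ q - 1ℤ) [mod (+ q - 1ℤ) ^ 6 ]))
corollary3p14 m n m≤n B d _ =
  let P , rook≡ = good⇒congruent (good-rook B d) (λ F → qRookNumber F B d) (λ F → Numbers.qRookNumber-rook F B d)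
      Q , hit≡  = good⇒congruent (good-hit B d) (λ F → qHitNumber F B d) (λ F → Numbers.qHitNumber-hit F m≤n B d)
  in P , Q , λ q _ F → rook≡ F , hit≡ F
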